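{- For every $n\ge1$, the noncrossing arc diagrams on $n$ points in which each arc has at most one inflection are in bijection with the generic rectangulations with $n$ rectangles.
   Context: Place $n$ distinct points on a vertical line, identified with $1,\ldots,n$ from bottom to top. An arc connects a point $p$ to a strictly higher point $q$, moving monotonically upward and passing either to the left or to the right of each point strictly between $p$ and $q$. Arcs are considered up to combinatorial equivalence (an arc is determined by its endpoints and which intermediate points lie to its left). A noncrossing arc diagram on $n$ points is a collection of such arcs such that no two arcs intersect except possibly at endpoints and no two arcs share the same upper endpoint or the same lower endpoint; diagrams are considered up to combinatorial equivalence. An inflection of an arc is a pair of adjacent points $i,i+1$ such that one of them is left of the arc and the other is right of the arc. A generic rectangulation with $n$ rectangles is a combinatorial type of decomposition of a square into $n$ rectangles such that no four rectangles share a common corner. -}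

module Defs where

open import Level using (0ℓ)
open import Data.Nat using (ℕ; zero; suc; _+_; _≤_; _<_)
open import Data.Bool using (Bool; true; false)
open import Data.Fin using (Fin)
open import Data.Fin.Permutation using (Permutation′; _⟨$⟩ʳ_; _⟨$⟩ˡ_; inverseʳ; id; flip; _∘ₚ_)
open import Data.List using (List)
open import Data.List.Membership.Propositional using (_∈_)
open import Data.List.Relation.Unary.All using (All)
open import Data.List.Relation.Unary.AllPairs using (AllPairs)
open import Data.Product using (Σ; ∃; _×_; _,_; proj₁; proj₂)
open import Data.Sum using (_⊎_)
open import Relation.Nullary using (¬_)
open import Relation.Binary using (Setoid; IsEquivalence)
open import Relation.Binary.PropositionalEquality using (_≡_; _≢_; refl; sym; trans; cong; subst)
open import Function.Bundles using (_⇔_; mk⇔; Equivalence)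

-- Noncrossing arc diagrams
-- Points are the natural numbers 1, …, n (bottom to top).

-- A (raw) arc: lower endpoint, upper endpoint, and for each point i
-- whether i lies to the LEFT of the arc (left i ≡ true) or to the right.
-- Only the values at points strictly between the endpoints are meaningful;
-- this is taken care of by the equivalence _≈ᴬ_ below.
record Arc : Set where
  constructor arc
  field
    bot  : ℕ
    top  : ℕ
    left : ℕ → Bool
open Arc public

ValidArc : ℕ → Arc → Set
ValidArc n a = (1 ≤ bot a) × (bot a < top a) × (top a ≤ n)

Inside : Arc → ℕ → Set
Inside a h = (bot a < h) × (h < top a)

Endpoint : Arc → ℕ → Set
Endpoint a h = (h ≡ bot a) ⊎ (h ≡ top a)

_≈ᴬ_ : Arc → Arc → Set
a ≈ᴬ b = (bot a ≡ bot b) × (top a ≡ top b) ×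
         (∀ h → Inside a h → left a h ≡ left b h)

-- At height h the arc a is forced to lie strictly to the left of the arc b:
--  * h is strictly inside both, h is right of a and left of b; or
--  * h is strictly inside a and an endpoint of b, and h is right of a; or
--  * h is an endpoint of a and strictly inside b, and h is left of b.
LeftAt : Arc → Arc → ℕ → Set
LeftAt a b h =
    (Inside a h × Inside b h × left a h ≡ false × left b h ≡ true)
  ⊎ (Inside a h × Endpoint b h × left a h ≡ false)
  ⊎ (Endpoint a h × Inside b h × left b h ≡ true)

Crossing : Arc → Arc → Set
Crossing a b = ∃ λ h → ∃ λ h′ → LeftAt a b h × LeftAt b a h′

NonCrossing : Arc → Arc → Set
NonCrossing a b = ¬ Crossing a b

Inflection : Arc → ℕ → Set
Inflection a i = Inside a i × Inside a (suc i) × (left a i ≢ left a (suc i))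

AtMostOneInflection : Arc → Set
AtMostOneInflection a = ∀ i j → Inflection a i → Inflection a j → i ≡ j

Compatible : Arc → Arc → Set
Compatible a b = (bot a ≢ bot b) × (top a ≢ top b) × NonCrossing a b

IsNCDiagram≤1 : ℕ → List Arc → Set
IsNCDiagram≤1 n D =
  All (ValidArc n) D × AllPairs Compatible D × All AtMostOneInflection D

NCDiagram≤1 : ℕ → Set
NCDiagram≤1 n = Σ (List Arc) (IsNCDiagram≤1 n)

_≈ᴰ_ : List Arc → List Arc → Set
D ≈ᴰ E = (∀ {a} → a ∈ D → ∃ λ b → b ∈ E × a ≈ᴬ b)
       × (∀ {b} → b ∈ E → ∃ λ a → a ∈ D × b ≈ᴬ a)

≈ᴬ-refl : ∀ {a} → a ≈ᴬ a
≈ᴬ-refl = refl , refl , λ _ _ → refl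

≈ᴬ-sym : ∀ {a b} → a ≈ᴬ b → b ≈ᴬ a
≈ᴬ-sym {a} {b} (p , q , r) = sym p , sym q ,
  λ h (l , u) → sym (r h (subst (_< h) (sym p) l , subst (h <_) (sym q) u))

≈ᴬ-trans : ∀ {a b c} → a ≈ᴬ b → b ≈ᴬ c → a ≈ᴬ c
≈ᴬ-trans (p , q , r) (p′ , q′ , r′) = trans p p′ , trans q q′ ,
  λ h (l , u) → trans (r h (l , u)) (r′ h (subst (_< h) p l , subst (h <_) q u))

≈ᴰ-refl : ∀ {D} → D ≈ᴰ D
≈ᴰ-refl = (λ {a} m → a , m , ≈ᴬ-refl) , (λ {b} m → b , m , ≈ᴬ-refl)

≈ᴰ-sym : ∀ {D E} → D ≈ᴰ E → E ≈ᴰ D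
≈ᴰ-sym (f , g) = g , f

≈ᴰ-trans : ∀ {D E F} → D ≈ᴰ E → E ≈ᴰ F → D ≈ᴰ F
≈ᴰ-trans (f , g) (f′ , g′) =
    (λ m → let (b , mb , ab) = f m ; (c , mc , bc) = f′ mb in c , mc , ≈ᴬ-trans ab bc)
  , (λ m → let (b , mb , cb) = g′ m ; (a , ma , ba) = g mb in a , ma , ≈ᴬ-trans cb ba)

NCDiagram≤1-Setoid : ℕ → Setoid 0ℓ 0ℓ
NCDiagram≤1-Setoid n = record
  { Carrier = NCDiagram≤1 n
  ; _≈_ = λ D E → proj₁ D ≈ᴰ proj₁ E
  ; isEquivalence = record
      { refl = λ {D} → ≈ᴰ-refl {proj₁ D}
      ; sym = λ {D} {E} → ≈ᴰ-sym {proj₁ D} {proj₁ E}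
      ; trans = λ {D} {E} {F} → ≈ᴰ-trans {proj₁ D} {proj₁ E} {proj₁ F} } }

-- Generic rectangulations
-- A rectangulation is realised on an N × N integer grid: the square is
-- [0,N] × [0,N] and rectangle i is [x₁ i, x₂ i] × [y₁ i, y₂ i].

record Rectangulation (n : ℕ) : Set where
  constructor rectangulation
  field
    N  : ℕ
    x₁ x₂ y₁ y₂ : Fin n → ℕ
open Rectangulation public

-- rectangle i contains the unit cell [a, a+1] × [b, b+1]
Covers : ∀ {n} → Rectangulation n → Fin n → ℕ → ℕ → Set
Covers R i a b = (x₁ R i ≤ a) × (a < x₂ R i) × (y₁ R i ≤ b) × (b < y₂ R i)

Corner : ∀ {n} → Rectangulation n → Fin n → ℕ → ℕ → Set
Corner R i x y = ((x ≡ x₁ R i) ⊎ (x ≡ x₂ R i)) × ((y ≡ y₁ R i) ⊎ (y ≡ y₂ R i))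

IsGenericRectangulation : ∀ {n} → Rectangulation n → Set
IsGenericRectangulation {n} R =
    (∀ i → (x₁ R i < x₂ R i) × (x₂ R i ≤ N R) × (y₁ R i < y₂ R i) × (y₂ R i ≤ N R))
  × (∀ a b → a < N R → b < N R →
       (∃ λ i → Covers R i a b) × (∀ i j → Covers R i a b → Covers R j a b → i ≡ j))
  × (∀ x y (i j k l : Fin n) → i ≢ j → i ≢ k → i ≢ l → j ≢ k → j ≢ l → k ≢ l →
       ¬ (Corner R i x y × Corner R j x y × Corner R k x y × Corner R l x y))

GenericRectangulation : ℕ → Set
GenericRectangulation n = Σ (Rectangulation n) IsGenericRectangulation

LeftAdj : ∀ {n} → Rectangulation n → Fin n → Fin n → Set
LeftAdj R i j = (x₂ R i ≡ x₁ R j) × (y₁ R i < y₂ R j) × (y₁ R j < y₂ R i)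

BelowAdj : ∀ {n} → Rectangulation n → Fin n → Fin n → Set
BelowAdj R i j = (y₂ R i ≡ y₁ R j) × (x₁ R i < x₂ R j) × (x₁ R j < x₂ R i)

_≈ᴿ_ : ∀ {n} → Rectangulation n → Rectangulation n → Set
_≈ᴿ_ {n} R S = ∃ λ (σ : Permutation′ n) → ∀ i j →
    (LeftAdj R i j ⇔ LeftAdj S (σ ⟨$⟩ʳ i) (σ ⟨$⟩ʳ j))
  × (BelowAdj R i j ⇔ BelowAdj S (σ ⟨$⟩ʳ i) (σ ⟨$⟩ʳ j))

private
  ⇔-sym : ∀ {A B : Set} → A ⇔ B → B ⇔ A
  ⇔-sym e = mk⇔ (Equivalence.from e) (Equivalence.to e)
  ⇔-trans : ∀ {A B C : Set} → A ⇔ B → B ⇔ C → A ⇔ C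
  ⇔-trans e f = mk⇔ (λ x → Equivalence.to f (Equivalence.to e x))
                    (λ x → Equivalence.from e (Equivalence.from f x))
  ⇔-refl : ∀ {A : Set} → A ⇔ A
  ⇔-refl = mk⇔ (λ x → x) (λ x → x)

≈ᴿ-refl : ∀ {n} {R : Rectangulation n} → R ≈ᴿ R
≈ᴿ-refl = id , λ i j → ⇔-refl , ⇔-refl

≈ᴿ-sym : ∀ {n} {R S : Rectangulation n} → R ≈ᴿ S → S ≈ᴿ R
≈ᴿ-sym {n} {R} {S} (σ , e) = flip σ , λ i j →
  let (l , b) = e (σ ⟨$⟩ˡ i) (σ ⟨$⟩ˡ j)
      fix : (P : Rectangulation n → Fin n → Fin n → Set) →
            P S (σ ⟨$⟩ʳ (σ ⟨$⟩ˡ i)) (σ ⟨$⟩ʳ (σ ⟨$⟩ˡ j)) ⇔ P S i j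
      fix P = subst (λ k → P S (σ ⟨$⟩ʳ (σ ⟨$⟩ˡ i)) (σ ⟨$⟩ʳ (σ ⟨$⟩ˡ j)) ⇔ P S k j)
                (inverseʳ σ)
                (subst (λ k → P S (σ ⟨$⟩ʳ (σ ⟨$⟩ˡ i)) (σ ⟨$⟩ʳ (σ ⟨$⟩ˡ j))
                              ⇔ P S (σ ⟨$⟩ʳ (σ ⟨$⟩ˡ i)) k)
                   (inverseʳ σ) ⇔-refl)
  in ⇔-sym (⇔-trans l (fix LeftAdj)) , ⇔-sym (⇔-trans b (fix BelowAdj))

≈ᴿ-trans : ∀ {n} {R S T : Rectangulation n} → R ≈ᴿ S → S ≈ᴿ T → R ≈ᴿ T
≈ᴿ-trans (σ , e) (τ , f) = σ ∘ₚ τ , λ i j →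
  ⇔-trans (proj₁ (e i j)) (proj₁ (f _ _)) , ⇔-trans (proj₂ (e i j)) (proj₂ (f _ _))

GenericRectangulation-Setoid : ℕ → Setoid 0ℓ 0ℓ
GenericRectangulation-Setoid n = record
  { Carrier = GenericRectangulation n
  ; _≈_ = λ R S → proj₁ R ≈ᴿ proj₁ S
  ; isEquivalence = record
      { refl = λ {R} → ≈ᴿ-refl {n} {proj₁ R}
      ; sym = λ {R} {S} → ≈ᴿ-sym {n} {proj₁ R} {proj₁ S}
      ; trans = λ {R} {S} {T} → ≈ᴿ-trans {n} {proj₁ R} {proj₁ S} {proj₁ T} } }

{-# OPTIONS --safe #-}
module Submission where

-- Both families are enumerated by the same generating tree, whose nodes are Path.
--
-- A noncrossing arc diagram is the set of descents of a permutation, built by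
-- inserting 1, 2, 3, … successively; a point inserted just before p makes the arc
-- rising from p end there.  The arc with bottom p has at most one inflection iff the
-- bits "was h inserted before p", for the successive h > p, change at most once.
--
-- A generic rectangulation loses its upper right rectangle when the rectangles below
-- it (or left of it, depending on the T-junction at its lower left vertex) are
-- extended over it.  The possible reinsertions are the contacts of the rectangles on
-- the top side with their left neighbours and of those on the right side with the
-- rectangles below them.  Read along the boundary from the upper left to the lower
-- right, these contacts evolve exactly as the sites p that can still be used.

-- The trees agree because the last bit of a site tells on which side of the newest letter it
-- stands. Sites before that letter (`LX`, `LM`) carry contacts of the top side, sites after it
-- (`RX`, `RM`) contacts of the right side, and the letter itself (`E`) stands at the corner. An X
-- means that the next contact along the boundary belongs to the same rectangle. When a rectangle
-- gets covered, all its contacts merge into one; those marked X vanish, and they are the sites that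
-- would receive a second change.
--
-- Equivalence of rectangulations sees only adjacencies, so each path carries an adjacency `Adj π`,
-- and a realisation in coordinates is built beside it to supply the order along the boundary. The
-- effect of a step on adjacencies is computed only for deletion; for insertion it then suffices
-- that deleting the inserted rectangle restores the old adjacencies. Transposition exchanges the
-- top and the right side, so one orientation is enough. Injectivity is rigidity: the adjacencies
-- determine the corner rectangle and the contact at which it was inserted.

open import Defs
open import Data.Nat
  using (ℕ; zero; suc; _≤_; _<_; z≤n; s≤s; _≟_; _<?_; _≤?_; pred; _⊔_; _+_; _∸_; _⊓_)
open import Data.Fin using (Fin; zero; suc; punchIn)
open import Data.Maybe using (Maybe; just; nothing; maybe′)
open import Data.List using (List; []; _∷_; length; lookup; mapMaybe; filter)
open import Data.List.Membership.Propositional using (_∈_)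
open import Data.List.Relation.Unary.Any using (here; there)
open import Data.List.Relation.Unary.All
  using (All; []; _∷_; tabulate) renaming (lookup to lookupAll)
open import Data.List.Relation.Unary.AllPairs using (AllPairs; []; _∷_)
open import Data.Product using (∃; _×_; _,_; proj₁; proj₂)
open import Data.Sum using (_⊎_; inj₁; inj₂)
open import Data.Empty using (⊥-elim; ⊥)
open import Function using (id; _∘_)
open import Relation.Nullary using (yes; no; ¬_; Dec; does; contradiction; ¬?)
open import Data.Bool using (Bool; true; false; if_then_else_)
open import Data.List.Membership.Propositional.Properties using (∈-lookup; ∈-filter⁺; ∈-filter⁻)
open import Relation.Nullary.Decidable using (dec-true; dec-false; does-⇔; _⊎-dec_; _×-dec_)
open import Relation.Binary.Definitions using (tri<; tri≈; tri>)
open import Function.Bundles using (mk⇔; Bijection; Equivalence)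
open import Data.Unit using (⊤; tt)
open import Data.Fin.Permutation
  using (Permutation′; _⟨$⟩ʳ_; _⟨$⟩ˡ_; inverseʳ; inverseˡ; _∘ₚ_; lift₀; remove; transpose;
    punchIn-permute) renaming (id to idₚ)
open import Relation.Binary.PropositionalEquality
open import Data.Nat.Properties
open import Data.Fin.Patterns
import Data.Fin as Fin
import Data.Maybe as Maybe
import Data.Bool.Properties as Bool
import Data.List.Relation.Unary.AllPairs as AllPairs
import Data.List.Relation.Unary.AllPairs.Properties as AllPairs
import Data.Fin.Properties as Fin
import Data.List.Relation.Unary.All as All
import Data.Maybe.Properties as Maybe

-- The generating tree

-- The bits of a site p, for the points above p in increasing order, are false
-- or true as the point is right or left of the arc rising from p.
-- E: no bits; LM, RM: constantly false, constantly true; LX: true … true false … false;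
-- RX: false … false true … true.  A site with two changes is dropped for good.
data Tag : Set where
  E LM LX RM RX : Tag

-- it lft c u: the rectangle u touches the top side and its left neighbour is c
-- (nothing = the side of the square).  it btm c u: u touches the right side
-- and c is below it.
data Side : Set where
  lft btm : Side

opp : Side → Side
opp lft = btm
opp btm = lft

record Item (n : ℕ) : Set where
  constructor it
  field
    side : Side
    nbr  : Maybe (Fin n)
    rect : Fin n
open Item public

record Entry (n : ℕ) : Set where
  constructor ent
  field
    site : ℕ
    item : Item n
    tag  : Tag
open Entry public

-- The bit of the new point is appended: `false` by `tagR`, for a site standing before the place of
-- insertion, and `true` by `tagL`. The value `nothing` is a second change.
tagR tagL : Tag → Maybe Tag
tagR E  = just LM
tagR LM = just LM
tagR LX = just LX
tagR RM = just LX
tagR RX = nothing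
tagL E  = just RM
tagL LM = just RX
tagL LX = nothing
tagL RM = just RM
tagL RX = just RX

ren : ∀ {n} → Fin n → Fin n → Fin (suc n)
ren t u with u Fin.≟ t
... | yes _ = zero
... | no  _ = suc u

ren-refl : ∀ {n} (t : Fin n) → ren t t ≡ zero
ren-refl t with t Fin.≟ t
... | yes _ = refl
... | no ¬p = ⊥-elim (¬p refl)

ren-≢ : ∀ {n} {t u : Fin n} → u ≢ t → ren t u ≡ suc u
ren-≢ {t = t} {u} u≢t with u Fin.≟ t
... | yes p = ⊥-elim (u≢t p)
... | no _ = refl

up : ∀ {n} → Maybe (Fin n) → Maybe (Fin (suc n))
up = Maybe.map suc

shiftRect : ∀ {n} → Item n → Side → Fin n → Fin (suc n)
shiftRect (it lft _ t) lft u = ren t u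
shiftRect (it lft _ t) btm u = suc u
shiftRect (it btm _ t) lft u = suc u
shiftRect (it btm _ t) btm u = ren t u

-- The new rectangle is zero.  It takes over the items of the rectangle of the
-- chosen item z on the near side of z, and covers the rectangles on the far side.
itemR itemL : ∀ {n} → Item n → Item n → Item (suc n)
itemR z (it lft c u) = it lft (up c) (shiftRect z lft u)
itemR z (it btm c u) = it lft (just (suc u)) zero
itemL z (it btm c u) = it btm (up c) (shiftRect z btm u)
itemL z (it lft c u) = it btm (just (suc u)) zero

stepR stepL : ∀ {n} → Item n → Entry n → Maybe (Entry (suc n))
stepR z (ent p x τ) = Maybe.map (ent p (itemR z x)) (tagR τ)
stepL z (ent p x τ) = Maybe.map (ent p (itemL z x)) (tagL τ)

-- The chosen contact is used twice: its `itemR` goes to the new letter, its `itemL` to the old site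
-- if that survives. They are the two contacts of the new rectangle at its lower left vertex.
insertAt : ∀ {n} → ℕ → Item n → (es : List (Entry n)) → Fin (length es) → List (Entry (suc n))
insertAt m z (e ∷ es) zero    = ent m (itemR z (item e)) E ∷ mapMaybe (stepL z) (e ∷ es)
insertAt m z (e ∷ es) (suc k) = maybe′ _∷_ id (stepR z e) (insertAt m z es k)

-- A path of length m builds at the same time a 2-clumped permutation of
-- 1, …, m + 1 and a generic rectangulation with m + 1 rectangles.
mutual
  data Path : ℕ → Set where
    start : Path 0
    _▸_   : ∀ {m} (π : Path m) → Fin (length (entries π)) → Path (suc m)

  entries : ∀ {m} → Path m → List (Entry (suc m))
  entries start = ent 1 (it lft nothing zero) E ∷ ent 0 (it btm nothing zero) RM ∷ []
  entries {suc m} (π ▸ k) = insertAt (suc (suc m)) (item (lookup (entries π) k)) (entries π) k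

-- Lists split at an index

module _ {a} {A : Set a} where

  before prefix suffix : (xs : List A) → Fin (length xs) → List A
  before (x ∷ xs) zero    = []
  before (x ∷ xs) (suc k) = x ∷ before xs k
  prefix (x ∷ xs) zero    = x ∷ []
  prefix (x ∷ xs) (suc k) = x ∷ prefix xs k
  suffix (x ∷ xs) zero    = x ∷ xs
  suffix (x ∷ xs) (suc k) = suffix xs k

  before⊆prefix : ∀ xs k {y} → y ∈ before xs k → y ∈ prefix xs k
  before⊆prefix (x ∷ xs) (suc k) (here p)  = here p
  before⊆prefix (x ∷ xs) (suc k) (there p) = there (before⊆prefix xs k p)

  lookup∈prefix : ∀ xs k → lookup xs k ∈ prefix xs k
  lookup∈prefix (x ∷ xs) zero    = here refl
  lookup∈prefix (x ∷ xs) (suc k) = there (lookup∈prefix xs k)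

  lookup∈suffix : ∀ xs k → lookup xs k ∈ suffix xs k
  lookup∈suffix (x ∷ xs) zero    = here refl
  lookup∈suffix (x ∷ xs) (suc k) = lookup∈suffix xs k

  before-or-suffix : ∀ xs k {y} → y ∈ xs → y ∈ before xs k ⊎ y ∈ suffix xs k
  before-or-suffix (x ∷ xs) zero    p = inj₂ p
  before-or-suffix (x ∷ xs) (suc k) (here p)  = inj₁ (here p)
  before-or-suffix (x ∷ xs) (suc k) (there p) with before-or-suffix xs k p
  ... | inj₁ q = inj₁ (there q)
  ... | inj₂ q = inj₂ q

  before⊆ : ∀ xs k {y} → y ∈ before xs k → y ∈ xs
  before⊆ (x ∷ xs) (suc k) (here p)  = here p
  before⊆ (x ∷ xs) (suc k) (there p) = there (before⊆ xs k p)

  prefix⁻ : ∀ xs k {y} → y ∈ prefix xs k → y ∈ before xs k ⊎ y ≡ lookup xs k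
  prefix⁻ (x ∷ xs) zero    (here p) = inj₂ p
  prefix⁻ (x ∷ xs) (suc k) (here p) = inj₁ (here p)
  prefix⁻ (x ∷ xs) (suc k) (there p) with prefix⁻ xs k p
  ... | inj₁ q = inj₁ (there q)
  ... | inj₂ q = inj₂ q

  suffix⊆ : ∀ xs k {y} → y ∈ suffix xs k → y ∈ xs
  suffix⊆ (x ∷ xs) zero    p = p
  suffix⊆ (x ∷ xs) (suc k) p = there (suffix⊆ xs k p)

  ∈⇒lookup : ∀ {xs} {y : A} → y ∈ xs → ∃ λ k → lookup xs k ≡ y
  ∈⇒lookup (here p) = zero , sym p
  ∈⇒lookup (there p) with ∈⇒lookup p
  ... | k , q = suc k , q

module _ {a b} {A : Set a} {B : Set b} (f : A → Maybe B) where

  ∈-mapMaybe⁺ : ∀ {xs x y} → x ∈ xs → f x ≡ just y → y ∈ mapMaybe f xs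
  ∈-mapMaybe⁺ {x ∷ xs} (here refl) eq with f x
  ∈-mapMaybe⁺ {x ∷ xs} (here refl) refl | just _ = here refl
  ∈-mapMaybe⁺ {x ∷ xs} (there p) eq with f x
  ... | just _  = there (∈-mapMaybe⁺ p eq)
  ... | nothing = ∈-mapMaybe⁺ p eq

  ∈-mapMaybe⁻ : ∀ {xs y} → y ∈ mapMaybe f xs → ∃ λ x → x ∈ xs × f x ≡ just y
  ∈-mapMaybe⁻ {x ∷ xs} p with f x in eq
  ∈-mapMaybe⁻ {x ∷ xs} (here refl) | just _ = x , here refl , eq
  ∈-mapMaybe⁻ {x ∷ xs} (there p)   | just _ with ∈-mapMaybe⁻ p
  ... | w , q , r = w , there q , r
  ∈-mapMaybe⁻ {x ∷ xs} p | nothing with ∈-mapMaybe⁻ p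
  ... | w , q , r = w , there q , r

module _ {n} (m : ℕ) (z : Item n) where

  ∈-insertAt⁻ : ∀ es k {f} → f ∈ insertAt m z es k →
    f ≡ ent m (itemR z (item (lookup es k))) E
    ⊎ (∃ λ e → e ∈ before es k × stepR z e ≡ just f)
    ⊎ (∃ λ e → e ∈ suffix es k × stepL z e ≡ just f)
  ∈-insertAt⁻ (e ∷ es) zero (here p)  = inj₁ p
  ∈-insertAt⁻ (e ∷ es) zero (there p) = inj₂ (inj₂ (∈-mapMaybe⁻ (stepL z) p))
  ∈-insertAt⁻ (e ∷ es) (suc k) p with stepR z e in eq
  ∈-insertAt⁻ (e ∷ es) (suc k) (here refl) | just g = inj₂ (inj₁ (e , here refl , eq))
  ∈-insertAt⁻ (e ∷ es) (suc k) (there p) | just g with ∈-insertAt⁻ es k p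
  ... | inj₁ q = inj₁ q
  ... | inj₂ (inj₁ (w , q , r)) = inj₂ (inj₁ (w , there q , r))
  ... | inj₂ (inj₂ q) = inj₂ (inj₂ q)
  ∈-insertAt⁻ (e ∷ es) (suc k) p | nothing with ∈-insertAt⁻ es k p
  ... | inj₁ q = inj₁ q
  ... | inj₂ (inj₁ (w , q , r)) = inj₂ (inj₁ (w , there q , r))
  ... | inj₂ (inj₂ q) = inj₂ (inj₂ q)

  ∈-skip : ∀ (e : Maybe (Entry (suc n))) {es f} → f ∈ es → f ∈ maybe′ _∷_ id e es
  ∈-skip (just _) p = there p
  ∈-skip nothing  p = p

  new∈ : ∀ es k → ent m (itemR z (item (lookup es k))) E ∈ insertAt m z es k
  new∈ (e ∷ es) zero    = here refl
  new∈ (e ∷ es) (suc k) = ∈-skip (stepR z e) (new∈ es k)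

  before∈ : ∀ es k {e f} → e ∈ before es k → stepR z e ≡ just f → f ∈ insertAt m z es k
  before∈ (e ∷ es) (suc k) (here refl) eq with stepR z e
  before∈ (e ∷ es) (suc k) (here refl) refl | just _ = here refl
  before∈ (e ∷ es) (suc k) (there p) eq = ∈-skip (stepR z e) (before∈ es k p eq)

  suffix∈ : ∀ es k {e f} → e ∈ suffix es k → stepL z e ≡ just f → f ∈ insertAt m z es k
  suffix∈ (e ∷ es) zero p eq = there (∈-mapMaybe⁺ (stepL z) p eq)
  suffix∈ (e ∷ es) (suc k) p eq = ∈-skip (stepR z e) (suffix∈ es k p eq)

  module _ {S : Entry n → Entry n → Set} {S′ : Entry (suc n) → Entry (suc n) → Set} where
    AllPairs-mapMaybe : ∀ {f : Entry n → Maybe (Entry (suc n))} {es} →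
      (∀ {a b a′ b′} → a ∈ es → b ∈ es → S a b → f a ≡ just a′ → f b ≡ just b′ → S′ a′ b′) →
      AllPairs S es → AllPairs S′ (mapMaybe f es)
    AllPairs-mapMaybe h [] = []
    AllPairs-mapMaybe {f} {e ∷ es} h (p ∷ ps) with f e in eq
    ... | nothing = AllPairs-mapMaybe (λ a b → h (there a) (there b)) ps
    ... | just e′ = tabulate (λ q → let (w , w∈ , r) = ∈-mapMaybe⁻ f q in
                                    h (here refl) (there w∈) (lookupAll p w∈) eq r)
                    ∷ AllPairs-mapMaybe (λ a b → h (there a) (there b)) ps

-- Permutations

bump : ℕ → ℕ → ℕ
bump q v = if does (v <? q) then v else suc v

bump-< : ∀ {q v} → v < q → bump q v ≡ v
bump-< {q} {v} v<q rewrite dec-true (v <? q) v<q = refl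

bump-≥ : ∀ {q v} → q ≤ v → bump q v ≡ suc v
bump-≥ {q} {v} q≤v rewrite dec-false (v <? q) (≤⇒≯ q≤v) = refl

bump-mono : ∀ q {u v} → u < v → bump q u < bump q v
bump-mono q {u} {v} u<v with <-≤-connex u q | <-≤-connex v q
... | inj₁ a | inj₁ b rewrite bump-< a | bump-< b = u<v
... | inj₁ a | inj₂ b rewrite bump-< a | bump-≥ b = m<n⇒m<1+n u<v
... | inj₂ a | inj₁ b = contradiction (<-trans u<v b) (≤⇒≯ a)
... | inj₂ a | inj₂ b rewrite bump-≥ a | bump-≥ b = s≤s u<v

bump-cancel-< : ∀ q {u v} → bump q u < bump q v → u < v
bump-cancel-< q {u} {v} h with <-cmp u v
... | tri< a _ _ = a
... | tri≈ _ refl _ = contradiction h (<-irrefl refl)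
... | tri> _ _ c = contradiction (bump-mono q c) (<-asym h)

bump≢ : ∀ q v → bump q v ≢ q
bump≢ q v eq with <-≤-connex v q
... | inj₁ a rewrite bump-< a = <⇒≢ a eq
... | inj₂ b rewrite bump-≥ b = <⇒≢ (s≤s b) (sym eq)

chosen : ∀ {m} (π : Path m) → Fin (length (entries π)) → ℕ
chosen π k = site (lookup (entries π) k)

-- Position in the permutation; the end of the permutation is the letter 0.
opaque
  position : ∀ {m} → Path m → ℕ → ℕ
  position start zero    = 1
  position start (suc _) = 0
  position {suc m} (π ▸ k) j =
    if does (j ≟ suc (suc m)) then position π (chosen π k)
    else bump (position π (chosen π k)) (position π j)

  position-start-0 : position start 0 ≡ 1
  position-start-0 = refl

  position-start-1 : position start 1 ≡ 0
  position-start-1 = refl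

Before : ∀ {m} → Path m → ℕ → ℕ → Set
Before π i j = position π i < position π j

bit : ∀ {m} → Path m → ℕ → ℕ → Bool
bit π h p = does (position π h <? position π p)

bit-true : ∀ {m} (π : Path m) {h p} → Before π h p → bit π h p ≡ true
bit-true π {h} {p} = dec-true (position π h <? position π p)

bit-false : ∀ {m} (π : Path m) {h p} → ¬ Before π h p → bit π h p ≡ false
bit-false π {h} {p} = dec-false (position π h <? position π p)

bit-true⁻ : ∀ {m} (π : Path m) {h p} → bit π h p ≡ true → Before π h p
bit-true⁻ π {h} {p} eq with <-≤-connex (position π h) (position π p)
... | inj₁ b = b
... | inj₂ b with () ← trans (sym eq) (bit-false π (≤⇒≯ b))

bit-false⁻ : ∀ {m} (π : Path m) {h p} → bit π h p ≡ false → ¬ Before π h p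
bit-false⁻ π eq b with () ← trans (sym eq) (bit-true π b)

module _ {m} (π : Path m) (k : Fin (length (entries π))) where
  private
    new P : ℕ
    new = suc (suc m)
    P = chosen π k

  opaque
    unfolding position

    position-new : position (π ▸ k) new ≡ position π P
    position-new rewrite dec-true (new ≟ new) refl = refl

    position-old : ∀ {j} → j ≤ suc m → position (π ▸ k) j ≡ bump (position π P) (position π j)
    position-old {j} j≤ rewrite dec-false (j ≟ new) (<⇒≢ (s≤s j≤)) = refl

  old⁺ : ∀ {i j} → i ≤ suc m → j ≤ suc m → Before π i j → Before (π ▸ k) i j
  old⁺ i≤ j≤ b rewrite position-old i≤ | position-old j≤ = bump-mono (position π P) b

  old⁻ : ∀ {i j} → i ≤ suc m → j ≤ suc m → Before (π ▸ k) i j → Before π i j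
  old⁻ i≤ j≤ b rewrite position-old i≤ | position-old j≤ = bump-cancel-< (position π P) b

  bit-old : ∀ {i j} → i ≤ suc m → j ≤ suc m → bit (π ▸ k) i j ≡ bit π i j
  bit-old {i} {j} i≤ j≤ = does-⇔ (mk⇔ (old⁻ i≤ j≤) (old⁺ i≤ j≤))
    (position (π ▸ k) i <? position (π ▸ k) j) (position π i <? position π j)

  new⁺ : ∀ {j} → j ≤ suc m → position π P ≤ position π j → Before (π ▸ k) new j
  new⁺ j≤ b rewrite position-new | position-old j≤ | bump-≥ b = s≤s b

  new⁻ : ∀ {j} → j ≤ suc m → Before (π ▸ k) new j → position π P ≤ position π j
  new⁻ {j} j≤ b with <-≤-connex (position π j) (position π P)
  ... | inj₂ p = p
  ... | inj₁ p rewrite position-new | position-old j≤ | bump-< p = contradiction p (<-asym b)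

  new-after⁺ : ∀ {j} → j ≤ suc m → Before π j P → Before (π ▸ k) j new
  new-after⁺ j≤ b rewrite position-new | position-old j≤ | bump-< b = b

  new-after⁻ : ∀ {j} → j ≤ suc m → Before (π ▸ k) j new → Before π j P
  new-after⁻ {j} j≤ b with <-≤-connex (position π j) (position π P)
  ... | inj₁ p = p
  ... | inj₂ p rewrite position-new | position-old j≤ | bump-≥ p = contradiction (≤-trans (n≤1+n _) b) (≤⇒≯ p)

≤suc-cases : ∀ {h n} → h ≤ suc n → h ≤ n ⊎ h ≡ suc n
≤suc-cases h≤ with m≤n⇒m<n∨m≡n h≤
... | inj₁ (s≤s p) = inj₁ p
... | inj₂ p = inj₂ p

position-injective : ∀ {m} (π : Path m) {i j} → i ≤ suc m → j ≤ suc m →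
  position π i ≡ position π j → i ≡ j
position-injective start {zero}  {zero}  _ _ _ = refl
position-injective start {zero}  {suc zero} _ _ eq
  with () ← trans (sym position-start-0) (trans eq position-start-1)
position-injective start {suc zero} {zero} _ _ eq
  with () ← trans (sym position-start-0) (trans (sym eq) position-start-1)
position-injective start {suc zero} {suc zero} _ _ _ = refl
position-injective start {suc (suc _)} (s≤s ()) _ _
position-injective start {_} {suc (suc _)} _ (s≤s ()) _
position-injective (π ▸ k) {i} {j} i≤ j≤ eq with ≤suc-cases i≤ | ≤suc-cases j≤
... | inj₂ refl | inj₂ refl = refl
... | inj₂ refl | inj₁ q = contradiction
        (trans (sym (position-old π k q)) (trans (sym eq) (position-new π k))) (bump≢ (position π (chosen π k)) _)
... | inj₁ p | inj₂ refl = contradiction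
        (trans (sym (position-old π k p)) (trans eq (position-new π k))) (bump≢ (position π (chosen π k)) _)
... | inj₁ p | inj₁ q with <-cmp (position π i) (position π j)
...   | tri≈ _ b _ = position-injective π p q b
...   | tri< a _ _ = contradiction eq (<⇒≢ (old⁺ π k p q a))
...   | tri> _ _ c = contradiction (sym eq) (<⇒≢ (old⁺ π k q p c))

Before-or : ∀ {m} (π : Path m) {i j} → i ≤ suc m → j ≤ suc m → i ≢ j → Before π i j ⊎ Before π j i
Before-or π {i} {j} i≤ j≤ i≢j with <-cmp (position π i) (position π j)
... | tri< a _ _ = inj₁ a
... | tri≈ _ b _ = contradiction (position-injective π i≤ j≤ b) i≢j
... | tri> _ _ c = inj₂ c

-- The bits of a site and the invariant of the list of sites

AllBefore AllAfter : ∀ {m} → Path m → ℕ → ℕ → ℕ → Set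
AllBefore π p a b = ∀ {h} → a < h → h ≤ b → Before π h p
AllAfter  π p a b = ∀ {h} → a < h → h ≤ b → Before π p h

-- In the X cases the arc rising from `p` has its inflection between `c` and `suc c`.
Shape : ∀ {m} → Path m → ℕ → Tag → Set
Shape {m} π p E  = p ≡ suc m
Shape {m} π p LM = p < suc m × AllAfter π p p (suc m)
Shape {m} π p RM = p < suc m × AllBefore π p p (suc m)
Shape {m} π p LX = ∃ λ c → p < c × c < suc m × AllBefore π p p c × AllAfter π p c (suc m)
Shape {m} π p RX = ∃ λ c → p < c × c < suc m × AllAfter π p p c × AllBefore π p c (suc m)

Shape⇒≤ : ∀ {m} (π : Path m) {p} τ → Shape π p τ → p ≤ suc m
Shape⇒≤ π E  s = ≤-reflexive s
Shape⇒≤ π LM s = <⇒≤ (proj₁ s)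
Shape⇒≤ π RM s = <⇒≤ (proj₁ s)
Shape⇒≤ π LX (c , a , b , _) = <⇒≤ (<-trans a b)
Shape⇒≤ π RX (c , a , b , _) = <⇒≤ (<-trans a b)

Turn : ∀ {m} → Path m → ℕ → ℕ → Set
Turn π p i = (Before π i p × Before π p (suc i)) ⊎ (Before π p i × Before π (suc i) p)

-- The dead sites: an arc rising from `p` past all the points so far would have two inflections.
TwoTurns : ∀ {m} → Path m → ℕ → Set
TwoTurns {m} π p = ∃ λ i → ∃ λ j → p < i × i < j × suc j ≤ suc m × Turn π p i × Turn π p j

Shape⇒¬TwoTurns : ∀ {m} (π : Path m) {p} τ → Shape π p τ →
  ∃ λ c → ∀ {i} → p < i → suc i ≤ suc m → Turn π p i → i ≡ c
-- No turn occurs for this tag and the next two, so the constant is arbitrary.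
Shape⇒¬TwoTurns π E refl = 0 , λ p<i i< _ → contradiction (<-trans p<i i<) (<-irrefl refl)
Shape⇒¬TwoTurns π LM (_ , a) = 0 , λ where
  p<i i< (inj₁ (b , _)) → contradiction b (<-asym (a p<i (<⇒≤ i<)))
  p<i i< (inj₂ (_ , b)) → contradiction b (<-asym (a (m<n⇒m<1+n p<i) i<))
Shape⇒¬TwoTurns π RM (_ , a) = 0 , λ where
  p<i i< (inj₁ (_ , b)) → contradiction b (<-asym (a (m<n⇒m<1+n p<i) i<))
  p<i i< (inj₂ (b , _)) → contradiction b (<-asym (a p<i (<⇒≤ i<)))
Shape⇒¬TwoTurns {m} π {p} LX (c , _ , _ , x , y) = c , turn
  where
  turn : ∀ {i} → p < i → suc i ≤ suc m → Turn π p i → i ≡ c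
  turn {i} p<i i< t with <-cmp i c | t
  ... | tri≈ _ e _ | _ = e
  ... | tri< a _ _ | inj₁ (_ , b) = contradiction b (<-asym (x (m<n⇒m<1+n p<i) a))
  ... | tri< a _ _ | inj₂ (b , _) = contradiction b (<-asym (x p<i (<⇒≤ a)))
  ... | tri> _ _ d | inj₁ (b , _) = contradiction b (<-asym (y d (<⇒≤ i<)))
  ... | tri> _ _ d | inj₂ (_ , b) = contradiction b (<-asym (y (m<n⇒m<1+n d) i<))
Shape⇒¬TwoTurns {m} π {p} RX (c , _ , _ , x , y) = c , turn
  where
  turn : ∀ {i} → p < i → suc i ≤ suc m → Turn π p i → i ≡ c
  turn {i} p<i i< t with <-cmp i c | t
  ... | tri≈ _ e _ | _ = e
  ... | tri< a _ _ | inj₁ (b , _) = contradiction b (<-asym (x p<i (<⇒≤ a)))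
  ... | tri< a _ _ | inj₂ (_ , b) = contradiction b (<-asym (x (m<n⇒m<1+n p<i) a))
  ... | tri> _ _ d | inj₁ (_ , b) = contradiction b (<-asym (y (m<n⇒m<1+n d) i<))
  ... | tri> _ _ d | inj₂ (b , _) = contradiction b (<-asym (y d (<⇒≤ i<)))

step-site : ∀ {n p} {x : Item (suc n)} (τ : Maybe Tag) {f} →
  Data.Maybe.map (ent p x) τ ≡ just f → site f ≡ p × τ ≡ just (tag f)
step-site (just τ) refl = refl , refl

SiteOrder : ∀ {m} → Path m → Entry (suc m) → Entry (suc m) → Set
SiteOrder π e f = Before π (site e) (site f)

-- `complete` guarantees that a site needed by a diagram is still available, since a missing one
-- already has two turns. `shape` bounds the turns of a listed site by one.
record SitesOK {m} (π : Path m) : Set where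
  field
    shape    : ∀ {e} → e ∈ entries π → Shape π (site e) (tag e)
    sorted   : AllPairs (SiteOrder π) (entries π)
    complete : ∀ {p} → p ≤ suc m → (∃ λ e → e ∈ entries π × site e ≡ p) ⊎ TwoTurns π p
    end-last : ∀ {h} → 1 ≤ h → h ≤ suc m → Before π h 0

module _ {m} (π : Path m) (ok : SitesOK π) (k : Fin (length (entries π))) where
  open SitesOK ok
  private
    n new P : ℕ
    n = suc m
    new = suc (suc m)
    P = chosen π k
    es : List (Entry (suc m))
    es = entries π
    z : Item (suc m)
    z = item (lookup es k)

  site≤ : ∀ {e} → e ∈ entries π → site e ≤ suc m
  site≤ {e} e∈ = Shape⇒≤ π (tag e) (shape e∈)

  chosen≤ : P ≤ n
  chosen≤ = site≤ (∈-lookup k)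

  private
    Before-before : ∀ {xs} → AllPairs (SiteOrder π) xs → ∀ l {e} → e ∈ before xs l →
                    Before π (site e) (site (lookup xs l))
    Before-before (q ∷ qs) (suc l) (here refl) = lookupAll q (∈-lookup l)
    Before-before (q ∷ qs) (suc l) (there e∈)  = Before-before qs l e∈

    Before-suffix : ∀ {xs} → AllPairs (SiteOrder π) xs → ∀ l {e} → e ∈ suffix xs l →
                    position π (site (lookup xs l)) ≤ position π (site e)
    Before-suffix (q ∷ qs) zero (here refl) = ≤-refl
    Before-suffix (q ∷ qs) zero (there e∈)  = <⇒≤ (lookupAll q e∈)
    Before-suffix (q ∷ qs) (suc l) e∈       = Before-suffix qs l e∈

    afterExt : ∀ {p a} → p ≤ n → Before (π ▸ k) p new → AllAfter π p a n → AllAfter (π ▸ k) p a new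
    afterExt p≤ b x a<h h≤ with ≤suc-cases h≤
    ... | inj₁ q = old⁺ π k p≤ q (x a<h q)
    ... | inj₂ refl = b

    beforeExt : ∀ {p a} → p ≤ n → Before (π ▸ k) new p → AllBefore π p a n → AllBefore (π ▸ k) p a new
    beforeExt p≤ b x a<h h≤ with ≤suc-cases h≤
    ... | inj₁ q = old⁺ π k q p≤ (x a<h q)
    ... | inj₂ refl = b

    afterOld : ∀ {p a c} → p ≤ n → c ≤ n → AllAfter π p a c → AllAfter (π ▸ k) p a c
    afterOld p≤ c≤ x a<h h≤ = old⁺ π k p≤ (≤-trans h≤ c≤) (x a<h h≤)

    beforeOld : ∀ {p a c} → p ≤ n → c ≤ n → AllBefore π p a c → AllBefore (π ▸ k) p a c
    beforeOld p≤ c≤ x a<h h≤ = old⁺ π k (≤-trans h≤ c≤) p≤ (x a<h h≤)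

    onlyNew : ∀ {h} → n < h → h ≤ new → h ≡ new
    onlyNew a b = ≤-antisym b a

    shapeR : ∀ {p} τ {τ′} → p ≤ n → Before (π ▸ k) p new → Shape π p τ → tagR τ ≡ just τ′ →
             Shape (π ▸ k) p τ′
    shapeR {p} E  p≤ b refl refl = ≤-refl , λ a c → subst (Before (π ▸ k) p) (sym (onlyNew a c)) b
    shapeR {p} LM p≤ b (lt , x) refl = m<n⇒m<1+n lt , afterExt p≤ b x
    shapeR LX p≤ b (c , lt , ls , x , y) refl =
      c , lt , m<n⇒m<1+n ls , beforeOld p≤ (<⇒≤ ls) x , afterExt p≤ b y
    -- The change falls between the last old point `n` and the new one.
    shapeR {p} RM p≤ b (lt , x) refl =
      n , lt , ≤-refl , beforeOld p≤ ≤-refl x , λ a c → subst (Before (π ▸ k) p) (sym (onlyNew a c)) b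

    shapeL : ∀ {p} τ {τ′} → p ≤ n → Before (π ▸ k) new p → Shape π p τ → tagL τ ≡ just τ′ →
             Shape (π ▸ k) p τ′
    shapeL {p} E  p≤ b refl refl = ≤-refl , λ a c → subst (λ h → Before (π ▸ k) h p) (sym (onlyNew a c)) b
    shapeL {p} RM p≤ b (lt , x) refl = m<n⇒m<1+n lt , beforeExt p≤ b x
    shapeL RX p≤ b (c , lt , ls , x , y) refl =
      c , lt , m<n⇒m<1+n ls , afterOld p≤ (<⇒≤ ls) x , beforeExt p≤ b y
    shapeL {p} LM p≤ b (lt , x) refl =
      n , lt , ≤-refl , afterOld p≤ ≤-refl x , λ a c → subst (λ h → Before (π ▸ k) h p) (sym (onlyNew a c)) b

    shape′ : ∀ {f} → f ∈ entries (π ▸ k) → Shape (π ▸ k) (site f) (tag f)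
    shape′ f∈ with ∈-insertAt⁻ new z es k f∈
    ... | inj₁ refl = refl
    ... | inj₂ (inj₁ (e , e∈ , eq)) with step-site (tagR (tag e)) eq
    ...   | refl , τeq = shapeR (tag e) p≤ (new-after⁺ π k p≤ (Before-before sorted k e∈)) (shape e∈′) τeq
      where
      e∈′ = before⊆ es k e∈
      p≤ = site≤ e∈′
    shape′ f∈ | inj₂ (inj₂ (e , e∈ , eq)) with step-site (tagL (tag e)) eq
    ...   | refl , τeq = shapeL (tag e) p≤ (new⁺ π k p≤ (Before-suffix sorted k e∈)) (shape e∈′) τeq
      where
      e∈′ = suffix⊆ es k e∈
      p≤ = site≤ e∈′

    site-stepR : ∀ e {f} → stepR z e ≡ just f → site f ≡ site e
    site-stepR e eq = proj₁ (step-site (tagR (tag e)) eq)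

    site-stepL : ∀ e {f} → stepL z e ≡ just f → site f ≡ site e
    site-stepL e eq = proj₁ (step-site (tagL (tag e)) eq)

    sorted-insert : ∀ xs l → site (lookup xs l) ≡ P → (∀ {e} → e ∈ xs → site e ≤ n) →
      AllPairs (SiteOrder π) xs → AllPairs (SiteOrder (π ▸ k)) (insertAt new z xs l)
    sorted-insert (e ∷ xs) zero refl le (q ∷ qs) =
      tabulate (λ f∈ → let (w , w∈ , r) = ∈-mapMaybe⁻ (stepL z) f∈ in
        subst (Before (π ▸ k) new) (sym (site-stepL w r))
          (new⁺ π k (le w∈) (Before-suffix (q ∷ qs) zero w∈)))
      ∷ AllPairs-mapMaybe new z
          (λ {a} {b} a∈ b∈ s r t → subst₂ (Before (π ▸ k)) (sym (site-stepL a r)) (sym (site-stepL b t))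
             (old⁺ π k (le a∈) (le b∈) s))
          (q ∷ qs)
    sorted-insert (e ∷ xs) (suc l) eq le (q ∷ qs) with stepR z e in r
    ... | nothing = sorted-insert xs l eq (λ x → le (there x)) qs
    ... | just f  = tabulate below ∷ sorted-insert xs l eq (λ x → le (there x)) qs
      where
      below : ∀ {g} → g ∈ insertAt new z xs l → Before (π ▸ k) (site f) (site g)
      below g∈ rewrite site-stepR e r with ∈-insertAt⁻ new z xs l g∈
      ... | inj₁ refl = new-after⁺ π k (le (here refl)) (subst (Before π (site e)) eq (lookupAll q (∈-lookup l)))
      ... | inj₂ (inj₁ (w , w∈ , s)) rewrite site-stepR w s =
        let w∈′ = before⊆ xs l w∈ in old⁺ π k (le (here refl)) (le (there w∈′)) (lookupAll q w∈′)
      ... | inj₂ (inj₂ (w , w∈ , s)) rewrite site-stepL w s =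
        let w∈′ = suffix⊆ xs l w∈ in old⁺ π k (le (here refl)) (le (there w∈′)) (lookupAll q w∈′)

    turnOld : ∀ {p i} → p ≤ n → suc i ≤ n → Turn π p i → Turn (π ▸ k) p i
    turnOld p≤ i< (inj₁ (a , b)) = inj₁ (old⁺ π k (<⇒≤ i<) p≤ a , old⁺ π k p≤ i< b)
    turnOld p≤ i< (inj₂ (a , b)) = inj₂ (old⁺ π k p≤ (<⇒≤ i<) a , old⁺ π k i< p≤ b)

    complete′ : ∀ {p} → p ≤ new → (∃ λ f → f ∈ entries (π ▸ k) × site f ≡ p) ⊎ TwoTurns (π ▸ k) p
    complete′ {p} p≤new with ≤suc-cases p≤new
    ... | inj₂ refl = inj₁ (_ , new∈ new z es k , refl)
    ... | inj₁ p≤ with complete p≤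
    ...   | inj₂ (i , j , a , b , c , t , u) =
            inj₂ (i , j , a , b , m≤n⇒m≤1+n c , turnOld p≤ (≤-trans (s≤s (<⇒≤ b)) c) t , turnOld p≤ c u)
    ...   | inj₁ (ent _ x τ , e∈ , refl) with before-or-suffix es k e∈
    ...     | inj₁ e∈b = alive τ refl
      where
      q = new-after⁺ π k p≤ (Before-before sorted k e∈b)
      alive : ∀ τ′ → τ ≡ τ′ → (∃ λ f → f ∈ entries (π ▸ k) × site f ≡ p) ⊎ TwoTurns (π ▸ k) p
      alive E  refl = inj₁ (_ , before∈ new z es k e∈b refl , refl)
      alive LM refl = inj₁ (_ , before∈ new z es k e∈b refl , refl)
      alive LX refl = inj₁ (_ , before∈ new z es k e∈b refl , refl)
      alive RM refl = inj₁ (_ , before∈ new z es k e∈b refl , refl)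
      -- The only tag dropped before the insertion place: its change at `c` and the one just made at
      -- `n` are the two turns.
      alive RX refl with shape e∈
      ... | c , lt , ls , a , b = inj₂ (c , n , lt , ls , ≤-refl
              , turnOld p≤ ls (inj₂ (a lt ≤-refl , b ≤-refl ls))
              , inj₁ (old⁺ π k ≤-refl p≤ (b ls ≤-refl) , q))
    complete′ {p} p≤new | inj₁ p≤ | inj₁ (ent _ x τ , e∈ , refl) | inj₂ e∈s = alive τ refl
      where
      q = new⁺ π k p≤ (Before-suffix sorted k e∈s)
      alive : ∀ τ′ → τ ≡ τ′ → (∃ λ f → f ∈ entries (π ▸ k) × site f ≡ p) ⊎ TwoTurns (π ▸ k) p
      alive E  refl = inj₁ (_ , suffix∈ new z es k e∈s refl , refl)
      alive LM refl = inj₁ (_ , suffix∈ new z es k e∈s refl , refl)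
      alive RM refl = inj₁ (_ , suffix∈ new z es k e∈s refl , refl)
      alive RX refl = inj₁ (_ , suffix∈ new z es k e∈s refl , refl)
      alive LX refl with shape e∈
      ... | c , lt , ls , a , b = inj₂ (c , n , lt , ls , ≤-refl
              , turnOld p≤ ls (inj₁ (a lt ≤-refl , b ≤-refl ls))
              , inj₂ (old⁺ π k p≤ ≤-refl (b ls ≤-refl) , q))

    end-last′ : ∀ {h} → 1 ≤ h → h ≤ new → Before (π ▸ k) h 0
    end-last′ {h} 1≤ h≤ with ≤suc-cases h≤
    ... | inj₁ q = old⁺ π k q z≤n (end-last 1≤ q)
    ... | inj₂ refl = new⁺ π k z≤n (P≤0 P refl)
      where
      P≤0 : ∀ q → q ≡ P → position π q ≤ position π 0
      P≤0 zero    _ = ≤-refl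
      P≤0 (suc q) e = <⇒≤ (end-last (s≤s z≤n) (subst (_≤ n) (sym e) chosen≤))

  sitesOK-▸ : SitesOK (π ▸ k)
  sitesOK-▸ = record
    { shape    = shape′
    ; sorted   = sorted-insert es k refl site≤ sorted
    ; complete = complete′
    ; end-last = end-last′ }

start-order : Before start 1 0
start-order rewrite position-start-0 | position-start-1 = s≤s z≤n

sitesOK : ∀ {m} (π : Path m) → SitesOK π
sitesOK start = record
  { shape = λ { (here refl) → refl
              ; (there (here refl)) → s≤s z≤n , λ { {suc zero} _ _ → start-order ; {suc (suc _)} _ (s≤s ()) } }
  ; sorted = (start-order ∷ []) ∷ [] ∷ []
  ; complete = λ { {zero} _ → inj₁ (_ , there (here refl) , refl)
                 ; {suc zero} _ → inj₁ (_ , here refl , refl)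
                 ; {suc (suc _)} (s≤s ()) }
  ; end-last = λ { {suc zero} _ _ → start-order ; {suc (suc _)} _ (s≤s ()) } }
sitesOK (π ▸ k) = sitesOK-▸ π (sitesOK π) k

sites-injective : ∀ {m} (π : Path m) k l → chosen π k ≡ chosen π l → k ≡ l
sites-injective π = go (SitesOK.sorted (sitesOK π))
  where
  go : ∀ {xs} → AllPairs (SiteOrder π) xs → ∀ k l → site (lookup xs k) ≡ site (lookup xs l) → k ≡ l
  go (q ∷ qs) zero    zero    _  = refl
  go (q ∷ qs) zero    (suc l) eq = contradiction (lookupAll q (∈-lookup l)) (<-irrefl (cong (position π) eq))
  go (q ∷ qs) (suc k) zero    eq = contradiction (lookupAll q (∈-lookup k)) (<-irrefl (cong (position π) (sym eq)))
  go (q ∷ qs) (suc k) (suc l) eq = cong suc (go qs k l eq)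

-- Arc diagrams

-- The new letter separates `p` from its former predecessor, so an older arc from `p` disappears.
-- Insertion at the end, `p` = 0, makes no descent.
addArc : ℕ → ℕ → (ℕ → Bool) → List Arc → List Arc
addArc zero    t l as = as
addArc (suc p) t l as = arc (suc p) t l ∷ filter (λ a → ¬? (bot a ≟ suc p)) as

-- A letter q > p immediately precedes p iff q is the last one inserted just before p.
arcs : ∀ {m} → Path m → List Arc
arcs start = []
arcs {suc m} (π ▸ k) = addArc (chosen π k) (suc (suc m)) (λ h → bit π h (chosen π k)) (arcs π)

addArc⁻ : ∀ p {t l as b} → b ∈ addArc p t l as →
  (1 ≤ p × b ≡ arc p t l) ⊎ (b ∈ as × (1 ≤ p → bot b ≢ p))
addArc⁻ zero    b∈ = inj₂ (b∈ , λ ())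
addArc⁻ (suc p) (here eq)  = inj₁ (s≤s z≤n , eq)
addArc⁻ (suc p) (there b∈) with ∈-filter⁻ (λ a → ¬? (bot a ≟ suc p)) b∈
... | b∈as , b≢ = inj₂ (b∈as , λ _ → b≢)

addArc-new : ∀ p {t l as} → 1 ≤ p → arc p t l ∈ addArc p t l as
addArc-new (suc p) _ = here refl

addArc-old : ∀ p {t l as b} → b ∈ as → bot b ≢ p → b ∈ addArc p t l as
addArc-old zero    b∈ _  = b∈
addArc-old (suc p) b∈ b≢ = there (∈-filter⁺ (λ a → ¬? (bot a ≟ suc p)) b∈ b≢)

bit≢⇒Turn : ∀ {m} (π : Path m) {p i} → p < i → suc i ≤ suc m →
  bit π i p ≢ bit π (suc i) p → Turn π p i
bit≢⇒Turn π {p} {i} p<i i< neq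
  with Before-or π (<⇒≤ i<) (≤-trans (<⇒≤ p<i) (<⇒≤ i<)) (λ e → <⇒≢ p<i (sym e))
     | Before-or π i< (≤-trans (<⇒≤ p<i) (<⇒≤ i<)) (λ e → <⇒≢ (m<n⇒m<1+n p<i) (sym e))
... | inj₁ a | inj₁ b = contradiction (trans (bit-true π a) (sym (bit-true π b))) neq
... | inj₁ a | inj₂ b = inj₁ (a , b)
... | inj₂ a | inj₁ b = inj₂ (a , b)
... | inj₂ a | inj₂ b = contradiction (trans (bit-false π (<-asym a)) (sym (bit-false π (<-asym b)))) neq

-- `descent` and `adjacent` together say that `top a` stands immediately before `bot a` in the
-- permutation.
record ArcOK {m} (π : Path m) (a : Arc) : Set where
  field
    valid    : ValidArc (suc m) a
    bits     : ∀ {h} → Inside a h → left a h ≡ bit π h (bot a)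
    descent  : Before π (top a) (bot a)
    adjacent : ∀ {j} → j ≤ suc m → Before π (top a) j → position π (bot a) ≤ position π j
    turns    : AtMostOneInflection a
open ArcOK

1≤⇒≢0 : ∀ {n} → 1 ≤ n → n ≢ 0
1≤⇒≢0 (s≤s _) ()

module _ {m} (π : Path m) (k : Fin (length (entries π))) where
  private
    n new P : ℕ
    n = suc m
    new = suc (suc m)
    P = chosen π k
    P≤ : P ≤ n
    P≤ = chosen≤ π (sitesOK π) k
    e∈ : lookup (entries π) k ∈ entries π
    e∈ = ∈-lookup k

  old-≤ : ∀ {i j} → i ≤ n → j ≤ n → position π i ≤ position π j → position (π ▸ k) i ≤ position (π ▸ k) j
  old-≤ i≤ j≤ b = ≮⇒≥ λ c → contradiction (old⁻ π k j≤ i≤ c) (≤⇒≯ b)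

  arcOK-new : 1 ≤ P → ArcOK (π ▸ k) (arc P new (λ h → bit π h P))
  arcOK-new 1≤P .valid = 1≤P , s≤s P≤ , ≤-refl
  arcOK-new 1≤P .bits (a , s≤s b) = sym (bit-old π k b P≤)
  arcOK-new 1≤P .descent = new⁺ π k P≤ ≤-refl
  arcOK-new 1≤P .adjacent {j} j≤ b with ≤suc-cases j≤
  ... | inj₁ q = old-≤ P≤ q (new⁻ π k q b)
  ... | inj₂ refl = contradiction b (<-irrefl refl)
  -- The chosen site is listed, so its bits change at one place at most.
  arcOK-new 1≤P .turns i j u v = trans (at-c u) (sym (at-c v))
    where
    c = Shape⇒¬TwoTurns π (tag (lookup (entries π) k)) (SitesOK.shape (sitesOK π) e∈)
    at-c : ∀ {i} → Inflection (arc P new (λ h → bit π h P)) i → i ≡ proj₁ c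
    at-c ((a , _) , (_ , s≤s b) , neq) = proj₂ c a b (bit≢⇒Turn π a b neq)

  arcOK-old : ∀ {a} → ArcOK π a → bot a ≢ P → ArcOK (π ▸ k) a
  arcOK-old {a} ok b≢ = λ where
      .valid → let (x , y , z) = ok .valid in x , y , m≤n⇒m≤1+n z
      .bits {h} i → trans (ok .bits i) (sym (bit-old π k (≤-trans (<⇒≤ (proj₂ i)) t≤) b≤))
      .descent → old⁺ π k t≤ b≤ (ok .descent)
      .adjacent → adj
      .turns → ok .turns
    where
    t≤ : top a ≤ n
    t≤ = proj₂ (proj₂ (ok .valid))
    b≤ : bot a ≤ n
    b≤ = ≤-trans (<⇒≤ (proj₁ (proj₂ (ok .valid)))) t≤
    adj : ∀ {j} → j ≤ new → Before (π ▸ k) (top a) j → position (π ▸ k) (bot a) ≤ position (π ▸ k) j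
    adj j≤ b with ≤suc-cases j≤
    ... | inj₁ q = old-≤ b≤ q (ok .adjacent q (old⁻ π k t≤ q b))
    ... | inj₂ refl = <⇒≤ (new-after⁺ π k b≤
            (≤∧≢⇒< (ok .adjacent P≤ (new-after⁻ π k t≤ b)) (λ e → b≢ (position-injective π b≤ P≤ e))))

arcOK : ∀ {m} (π : Path m) {a} → a ∈ arcs π → ArcOK π a
arcOK (π ▸ k) a∈ with addArc⁻ (chosen π k) a∈
... | inj₁ (1≤ , refl) = arcOK-new π k 1≤
... | inj₂ (a∈′ , b≢) = arcOK-old π k ok λ e → b≢ (subst (1 ≤_) e (proj₁ (ok .valid))) e
  where ok = arcOK π a∈′

DistinctEnds : Arc → Arc → Set
DistinctEnds a b = (bot a ≢ bot b) × (top a ≢ top b)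

arcs-distinct : ∀ {m} (π : Path m) → AllPairs DistinctEnds (arcs π)
arcs-distinct start = []
arcs-distinct {suc m} (π ▸ k) = go (chosen π k) (arcs-distinct π) λ a∈ → arcOK π a∈ .valid
  where
  go : ∀ p {l as} → AllPairs DistinctEnds as → (∀ {a} → a ∈ as → ValidArc (suc m) a) →
       AllPairs DistinctEnds (addArc p (suc (suc m)) l as)
  go zero    ps v = ps
  go (suc p) ps v = tabulate (λ b∈ → let (b∈as , b≢) = ∈-filter⁻ (λ a → ¬? (bot a ≟ suc p)) b∈ in
                      (λ e → b≢ (sym e)) , λ e → <⇒≢ (s≤s (proj₂ (proj₂ (v b∈as)))) (sym e))
                    ∷ AllPairs.filter⁺ (λ a → ¬? (bot a ≟ suc p)) ps

module _ {m} (π : Path m) {a b} (oka : ArcOK π a) (okb : ArcOK π b) where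
  private
    a≤ : bot a ≤ suc m
    a≤ = ≤-trans (<⇒≤ (proj₁ (proj₂ (oka .valid)))) (proj₂ (proj₂ (oka .valid)))
    b≤ : bot b ≤ suc m
    b≤ = ≤-trans (<⇒≤ (proj₁ (proj₂ (okb .valid)))) (proj₂ (proj₂ (okb .valid)))

  -- Points right of an arc stand after its bottom in the permutation, points left of it before; as
  -- `top a` and `bot a` are neighbours there, the two ends count as one place. So arcs lie side by
  -- side in the order of their bottoms, and a crossing would give both orders.
  LeftAt⇒Before : bot a ≢ bot b → ∀ {h} → LeftAt a b h → Before π (bot a) (bot b)
  LeftAt⇒Before neq = λ where
      (inj₁ (i , j , la , lb)) → <-trans (right i la) (bit-true⁻ π (trans (sym (okb .bits j)) lb))
      (inj₂ (inj₁ (i , inj₁ refl , la))) → right i la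
      (inj₂ (inj₁ (i , inj₂ refl , la))) → <-trans (right i la) (okb .descent)
      (inj₂ (inj₂ (inj₁ refl , j , lb))) → bit-true⁻ π (trans (sym (okb .bits j)) lb)
      (inj₂ (inj₂ (inj₂ refl , j , lb))) →
        ≤∧≢⇒< (oka .adjacent b≤ (bit-true⁻ π (trans (sym (okb .bits j)) lb)))
              (λ e → neq (position-injective π a≤ b≤ e))
    where
    right : ∀ {h} → Inside a h → left a h ≡ false → Before π (bot a) h
    right {h} i la with Before-or π (≤-trans (<⇒≤ (proj₂ i)) (proj₂ (proj₂ (oka .valid)))) a≤ (λ e → <⇒≢ (proj₁ i) (sym e))
    ... | inj₂ q = q
    ... | inj₁ q = contradiction q (bit-false⁻ π (trans (sym (oka .bits i)) la))

arcs-noncrossing : ∀ {m} (π : Path m) → IsNCDiagram≤1 (suc m) (arcs π)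
arcs-noncrossing π =
    tabulate (λ a∈ → arcOK π a∈ .valid)
  , compat (λ a∈ → arcOK π a∈) (arcs-distinct π)
  , tabulate (λ a∈ → arcOK π a∈ .turns)
  where
  compat : ∀ {as} → (∀ {a} → a ∈ as → ArcOK π a) → AllPairs DistinctEnds as → AllPairs Compatible as
  compat ok [] = []
  compat ok (q ∷ qs) =
    tabulate (λ b∈ → let (x , y) = lookupAll q b∈ in x , y , λ (h , h′ , u , v) →
      <-asym (LeftAt⇒Before π (ok (here refl)) (ok (there b∈)) x u)
             (LeftAt⇒Before π (ok (there b∈)) (ok (here refl)) (λ e → x (sym e)) v))
    ∷ compat (λ a∈ → ok (there a∈)) qs

-- The points inserted before p are those lying on, or to the left of, the
-- part of the arc rising from p; among the arcs with this property the new
-- point sees the leftmost one first.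
Sees : List Arc → ℕ → Arc → Set
Sees D n a = a ∈ D × bot a ≤ n × (top a ≡ suc n ⊎ (suc n < top a × left a (suc n) ≡ true))

-- Determines where the next point is inserted. For `p` = 0 the first clause means that no arc is
-- seen, because 0 has the last position.
Choice : ∀ {m} → List Arc → Path m → ℕ → Set
Choice {m} D π p =
    (∀ {a} → Sees D (suc m) a → position π p ≤ position π (bot a))
  × (p ≡ 0 ⊎ ∃ λ a → Sees D (suc m) a × bot a ≡ p)

Follows : ∀ {m} → List Arc → Path m → Set
Follows D start   = ⊤
Follows D (π ▸ k) = Follows D π × Choice D π (chosen π k)

Bottoms : List Arc → Set
Bottoms D = ∀ {a} → a ∈ D → 1 ≤ bot a

Sees-≈ : ∀ {D F n a} → D ≈ᴰ F → Sees D n a → ∃ λ b → Sees F n b × bot a ≡ bot b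
Sees-≈ (f , _) (a∈ , le , s) with f a∈
... | b , b∈ , refl , refl , lf = b , (b∈ , le , s′ s) , refl
  where
  s′ : _ ⊎ _ → _ ⊎ _
  s′ (inj₁ x) = inj₁ x
  s′ (inj₂ (x , y)) = inj₂ (x , trans (sym (lf _ (s≤s le , x))) y)

Choice-unique : ∀ {m D F} (π : Path m) {p q} → D ≈ᴰ F → Bottoms D → Bottoms F →
  p ≤ suc m → q ≤ suc m → Choice D π p → Choice F π q → p ≡ q
Choice-unique π D≈F vD vF p≤ q≤ (_ , inj₁ refl) (_ , inj₁ refl) = refl
Choice-unique {D = D} {F} π D≈F vD vF p≤ q≤ (f , inj₁ refl) (_ , inj₂ (b , s , refl))
  with Sees-≈ {F} {D} (≈ᴰ-sym {D} {F} D≈F) s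
... | a , s′ , eq = contradiction (subst (λ v → position π 0 ≤ position π v) (sym eq) (f s′))
                      (<⇒≱ (SitesOK.end-last (sitesOK π) (vF (proj₁ s)) q≤))
Choice-unique {D = D} {F} π D≈F vD vF p≤ q≤ (_ , inj₂ (a , s , refl)) (g , inj₁ refl)
  with Sees-≈ {D} {F} D≈F s
... | b , s′ , eq = contradiction (subst (λ v → position π 0 ≤ position π v) (sym eq) (g s′))
                      (<⇒≱ (SitesOK.end-last (sitesOK π) (vD (proj₁ s)) p≤))
Choice-unique {D = D} {F} π D≈F vD vF p≤ q≤ (f , inj₂ (a , s , refl)) (g , inj₂ (b , t , refl))
  with Sees-≈ {D} {F} D≈F s | Sees-≈ {F} {D} (≈ᴰ-sym {D} {F} D≈F) t
... | b′ , s′ , eq | a′ , t′ , eq′ = position-injective π p≤ q≤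
      (≤-antisym (subst (λ v → position π (bot a) ≤ position π v) (sym eq′) (f t′))
                 (subst (λ v → position π (bot b) ≤ position π v) (sym eq) (g s′)))

-- Every insertion place is dictated by the diagram up to equivalence. This makes the path
-- independent of the representative, and it also shows that a path is recovered from its own arcs.
Follows-unique : ∀ {m D F} (π ρ : Path m) → D ≈ᴰ F → Bottoms D → Bottoms F →
  Follows D π → Follows F ρ → π ≡ ρ
Follows-unique start start _ _ _ _ _ = refl
Follows-unique {D = D} {F} (π ▸ k) (ρ ▸ l) D≈F vD vF (u , c) (v , d)
  with Follows-unique {D = D} {F} π ρ D≈F vD vF u v
... | refl = cong (π ▸_) (sites-injective π k l
      (Choice-unique {D = D} {F} π D≈F vD vF (chosen≤ π (sitesOK π) k) (chosen≤ π (sitesOK π) l) c d))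

-- Agreement of diagram and path up to height `suc m`. By `below` an arc of `arcs π` may be
-- provisional: the arc of `D` from its bottom can still be on its way up, and a later insertion
-- before that bottom replaces it.
record Traced {m} (D : List Arc) (π : Path m) : Set where
  field
    agree : ∀ {a h} → a ∈ D → bot a < h → h ≤ suc m → h < top a → left a h ≡ bit π h (bot a)
    ends  : ∀ {a} → a ∈ D → top a ≤ suc m → Before π (top a) (bot a)
    below : ∀ {b} → b ∈ arcs π → ∃ λ a → a ∈ D × bot a ≡ bot b × (top a ≡ top b ⊎ suc m < top a)
open Traced

Traced-arcs : ∀ {m} (π : Path m) → Traced (arcs π) π
Traced-arcs π .agree a∈ x _ z = arcOK π a∈ .bits (x , z)
Traced-arcs π .ends a∈ _ = arcOK π a∈ .descent
Traced-arcs π .below {b} b∈ = b , b∈ , refl , inj₁ refl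

-- Agreement at one stage restricts to the stage before it, and the place of the last point then
-- yields both clauses of `Choice`.
Traced⇒Follows : ∀ {m} (D : List Arc) (π : Path m) → (∀ {a} → a ∈ D → bot a < top a) →
  Traced D π → Follows D π
Traced⇒Follows D start v t = tt
Traced⇒Follows {suc m} D (π ▸ k) v t = Traced⇒Follows D π v tr , least , attained
  where
  n = suc m
  new = suc (suc m)
  P = chosen π k
  P≤ = chosen≤ π (sitesOK π) k
  tr : Traced D π
  tr .agree {a} {h} a∈ x y z =
    trans (t .agree a∈ x (m≤n⇒m≤1+n y) z) (bit-old π k y (≤-trans (<⇒≤ x) y))
  tr .ends a∈ le = old⁻ π k le (≤-trans (<⇒≤ (v a∈)) le) (t .ends a∈ (m≤n⇒m≤1+n le))
  tr .below {b} b∈ with bot b ≟ P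
  ... | no b≢ with t .below (addArc-old P b∈ b≢)
  ...   | a , a∈ , e , inj₁ u = a , a∈ , e , inj₁ u
  ...   | a , a∈ , e , inj₂ u = a , a∈ , e , inj₂ (<-trans ≤-refl u)
  -- The last insertion discarded this arc; by the arc that replaced it, the arc of `D` from `P`
  -- ends at `new` or higher.
  tr .below {b} b∈ | yes e with t .below (addArc-new P {as = arcs π} (subst (1 ≤_) e (proj₁ (arcOK π b∈ .valid))))
  ...   | a , a∈ , e′ , inj₁ u = a , a∈ , trans e′ (sym e) , inj₂ (≤-reflexive (sym u))
  ...   | a , a∈ , e′ , inj₂ u = a , a∈ , trans e′ (sym e) , inj₂ (<-trans ≤-refl u)
  least : ∀ {a} → Sees D n a → position π P ≤ position π (bot a)
  least (a∈ , le , inj₁ u) = new⁻ π k le (subst (λ h → Before (π ▸ k) h _) u (t .ends a∈ (≤-reflexive u)))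
  least (a∈ , le , inj₂ (u , w)) =
    new⁻ π k le (bit-true⁻ (π ▸ k) (trans (sym (t .agree a∈ (s≤s le) ≤-refl u)) w))
  attained : P ≡ 0 ⊎ ∃ λ a → Sees D n a × bot a ≡ P
  attained with P ≟ 0
  ... | yes e = inj₁ e
  ... | no P≢0 with t .below (addArc-new P {as = arcs π} (n≢0⇒n>0 P≢0))
  ...   | a , a∈ , e , inj₁ u = inj₂ (a , (a∈ , subst (_≤ n) (sym e) P≤ , inj₁ u) , e)
  ...   | a , a∈ , e , inj₂ u = inj₂ (a , (a∈ , b≤ , inj₂ (u , l)) , e)
    where
    b≤ = subst (_≤ n) (sym e) P≤
    l : left a new ≡ true
    l = trans (t .agree a∈ (s≤s b≤) ≤-refl u)
              (bit-true (π ▸ k) (new⁺ π k b≤ (≤-reflexive (cong (position π) (sym e)))))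

-- Existence of a path for every diagram

open Traced
open ArcOK

least-or-none : ∀ {A : Set} {P : A → Set} → (∀ x → Dec (P x)) → (f : A → ℕ) → ∀ xs →
  (∀ {x} → x ∈ xs → ¬ P x) ⊎ ∃ λ x → x ∈ xs × P x × (∀ {y} → y ∈ xs → P y → f x ≤ f y)
least-or-none P? f [] = inj₁ λ ()
least-or-none P? f (x ∷ xs) with P? x | least-or-none P? f xs
... | no ¬p | inj₁ none = inj₁ λ { (here refl) → ¬p ; (there q) → none q }
... | no ¬p | inj₂ (y , y∈ , py , least) = inj₂ (y , there y∈ , py , λ where
        (here refl) q → contradiction q ¬p
        (there z∈) q → least z∈ q)
... | yes p | inj₁ none = inj₂ (x , here refl , p , λ where
        (here refl) _ → ≤-refl
        (there z∈) q → contradiction q (none z∈))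
... | yes p | inj₂ (y , y∈ , py , least) with ≤-total (f x) (f y)
...   | inj₁ le = inj₂ (x , here refl , p , λ where
        (here refl) _ → ≤-refl
        (there z∈) q → ≤-trans le (least z∈ q))
...   | inj₂ ge = inj₂ (y , there y∈ , py , λ where
        (here refl) _ → ge
        (there z∈) q → least z∈ q)

Compatible-sym : ∀ {a b} → Compatible a b → Compatible b a
Compatible-sym (x , y , z) = (λ e → x (sym e)) , (λ e → y (sym e)) , λ (h , h′ , u , v) → z (h′ , h , v , u)

≡-or-Compatible : ∀ {D a b} → AllPairs Compatible D → a ∈ D → b ∈ D → a ≡ b ⊎ Compatible a b
≡-or-Compatible (q ∷ qs) (here refl) (here refl) = inj₁ refl
≡-or-Compatible (q ∷ qs) (here refl) (there b∈)  = inj₂ (lookupAll q b∈)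
≡-or-Compatible {a = a} {b} (q ∷ qs) (there a∈)  (here refl) = inj₂ (Compatible-sym {b} {a} (lookupAll q a∈))
≡-or-Compatible (q ∷ qs) (there a∈)  (there b∈)  = ≡-or-Compatible qs a∈ b∈

module _ {N : ℕ} {D : List Arc} (D-ok : IsNCDiagram≤1 N D) where
  private
    valid-arc : ∀ {a} → a ∈ D → ValidArc N a
    valid-arc = lookupAll (proj₁ D-ok)

    same-bot : ∀ {a b} → a ∈ D → b ∈ D → bot a ≡ bot b → a ≡ b
    same-bot a∈ b∈ e with ≡-or-Compatible (proj₁ (proj₂ D-ok)) a∈ b∈
    ... | inj₁ r = r
    ... | inj₂ (x , _) = contradiction e x

  record Stage {m} (π : Path m) : Set where
    field
      traced  : Traced D π
      covered : ∀ {a} → a ∈ D → top a ≤ suc m → ∃ λ b → b ∈ arcs π × bot b ≡ bot a × top b ≡ top a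

  module _ {m} (π : Path m) (st : Stage π) where
    open Stage st
    private
      n new : ℕ
      n = suc m
      new = suc (suc m)

      -- The witness is the higher of the two bottoms: it lies inside the other arc, and its side
      -- there is the order of the bottoms in the permutation.
      leftAt : ∀ {a b} → a ∈ D → b ∈ D → bot a ≤ n → bot b ≤ n → n < top a → n < top b →
               bot a ≢ bot b → Before π (bot b) (bot a) → ∃ λ h → LeftAt b a h
      leftAt {a} {b} a∈ b∈ a≤ b≤ ta tb neq bf with <-≤-connex (bot a) (bot b)
      ... | inj₁ lt = bot b , inj₂ (inj₂ (inj₁ refl , (lt , ≤-<-trans b≤ ta)
            , trans (traced .agree a∈ lt b≤ (≤-<-trans b≤ ta)) (bit-true π bf)))
      ... | inj₂ ge = bot a , inj₂ (inj₁ ((lt , ≤-<-trans a≤ tb) , inj₁ refl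
            , trans (traced .agree b∈ lt a≤ (≤-<-trans a≤ tb)) (bit-false π (<-asym bf))))
        where lt = ≤∧≢⇒< ge (λ e → neq (sym e))

      open-top : ∀ {a} → Sees D n a → n < top a
      open-top (_ , _ , inj₁ e) = ≤-reflexive (sym e)
      open-top (_ , _ , inj₂ (lt , _)) = <-trans ≤-refl lt

      Sees? : ∀ a → Dec (bot a ≤ n × (top a ≡ new ⊎ (new < top a × left a new ≡ true)))
      Sees? a = (bot a ≤? n) ×-dec ((top a ≟ new) ⊎-dec ((new <? top a) ×-dec (left a new Bool.≟ true)))

    choice : ∃ λ p → p ≤ n × Choice D π p
    choice with least-or-none Sees? (λ a → position π (bot a)) D
    ... | inj₁ none = 0 , z≤n , (λ (a∈ , s) → contradiction s (none a∈)) , inj₁ refl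
    ... | inj₂ (a , a∈ , (le , s) , least) =
          bot a , le , (λ (b∈ , t) → least b∈ t) , inj₂ (a , (a∈ , le , s) , refl)

    private
      ¬TwoTurns-0 : ¬ TwoTurns π 0
      ¬TwoTurns-0 (i , j , a , b , c , t , _) = go t
        where
        last : ∀ {h} → 1 ≤ h → h ≤ n → Before π h 0
        last = SitesOK.end-last (sitesOK π)
        i< : suc i ≤ n
        i< = ≤-trans (s≤s (<⇒≤ b)) c
        go : ¬ Turn π 0 i
        go (inj₁ (_ , y)) = <-asym y (last (s≤s z≤n) i<)
        go (inj₂ (y , _)) = <-asym y (last a (<⇒≤ i<))

      ¬TwoTurns-bot : ∀ {a} → Sees D n a → ¬ TwoTurns π (bot a)
      ¬TwoTurns-bot {a} s (i , j , p<i , i<j , j< , t , u) =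
        <⇒≢ i<j (lookupAll (proj₂ (proj₂ D-ok)) a∈ i j
          (inflection p<i (≤-trans (s≤s (<⇒≤ i<j)) j<) t) (inflection (<-trans p<i i<j) j< u))
        where
        a∈ = proj₁ s
        inflection : ∀ {i} → bot a < i → suc i ≤ n → Turn π (bot a) i → Inflection a i
        inflection {i} p<i i< t = (p<i , i<top) , (m<n⇒m<1+n p<i , si<top) , neq t
          where
          si<top = ≤-<-trans i< (open-top s)
          i<top = <-trans ≤-refl si<top
          l₁ : left a i ≡ bit π i (bot a)
          l₁ = traced .agree a∈ p<i (<⇒≤ i<) i<top
          l₂ : left a (suc i) ≡ bit π (suc i) (bot a)
          l₂ = traced .agree a∈ (m<n⇒m<1+n p<i) i< si<top
          neq : Turn π (bot a) i → left a i ≢ left a (suc i)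
          neq (inj₁ (x , y)) e with () ← trans (sym (trans l₁ (bit-true π x))) (trans e (trans l₂ (bit-false π (<-asym y))))
          neq (inj₂ (x , y)) e with () ← trans (sym (trans l₁ (bit-false π (<-asym x)))) (trans e (trans l₂ (bit-true π y)))

    -- A site is missing only if it has two turns. For the bottom of an open arc of `D` these are
    -- two inflections, and 0 has no turn because every letter stands before it.
    choice-entry : ∀ {p} → p ≤ n → Choice D π p → ∃ λ k → chosen π k ≡ p
    choice-entry p≤ (_ , c) with SitesOK.complete (sitesOK π) p≤
    ... | inj₁ (e , e∈ , refl) = let (k , eq) = ∈⇒lookup e∈ in k , cong site eq
    choice-entry p≤ (_ , inj₁ refl) | inj₂ t = contradiction t ¬TwoTurns-0
    choice-entry p≤ (_ , inj₂ (a , s , refl)) | inj₂ t = contradiction t (¬TwoTurns-bot s)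

    module _ (k : Fin (length (entries π))) (c : Choice D π (chosen π k)) where
      private
        P : ℕ
        P = chosen π k
        P≤ : P ≤ n
        P≤ = chosen≤ π (sitesOK π) k

        seer : ∀ {a} → a ∈ D → bot a ≤ n → position π P ≤ position π (bot a) →
               ∃ λ b → Sees D n b × bot b ≡ P
        seer a∈ a≤ le with proj₂ c
        ... | inj₂ s = s
        ... | inj₁ e = contradiction (subst (λ v → position π v ≤ position π _) e le)
                (<⇒≱ (SitesOK.end-last (sitesOK π) (proj₁ (valid-arc a∈)) a≤))

        sees-new : ∀ {b} → Sees D n b → top b ≢ new → Inside b new × left b new ≡ true
        sees-new (_ , b≤ , inj₁ e) t≢ = contradiction e t≢
        sees-new (_ , b≤ , inj₂ (t , l)) _ = (s≤s b≤ , t) , l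

        -- `b` starts to the left of `a`, since its bottom comes first in the permutation; to be on
        -- the other side at height `new` it would have to cross `a`.
        cross : ∀ {a b} → a ∈ D → bot a ≤ n → n < top a → Sees D n b → bot b ≡ P → bot a ≢ P →
                position π P ≤ position π (bot a) → ¬ LeftAt a b new
        cross {a} {b} a∈ a≤ ta s@(b∈ , b≤ , _) refl neq le l with ≡-or-Compatible (proj₁ (proj₂ D-ok)) a∈ b∈
        ... | inj₁ refl = neq refl
        ... | inj₂ (_ , _ , nc) =
          let (h , l′) = leftAt a∈ b∈ a≤ b≤ ta (open-top s) neq
                           (≤∧≢⇒< le (λ e → neq (sym (position-injective π b≤ a≤ e))))
          in nc (new , h , l , l′)

        -- Another chosen arc would have a different upper end, hence would pass to the right of
        -- `new`, although its bottom stands before that of `a`.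
        closes : ∀ {a} → a ∈ D → bot a < top a → top a ≡ new → P ≡ bot a
        closes {a} a∈ lt t≡ with bot a ≟ P
        ... | yes e = sym e
        ... | no neq with seer a∈ a≤ (proj₁ c (a∈ , a≤ , inj₁ t≡))
          where
          a≤ : bot a ≤ n
          a≤ = ≤-pred (≤-trans lt (≤-reflexive t≡))
        ...   | b , s , e with ≡-or-Compatible (proj₁ (proj₂ D-ok)) a∈ (proj₁ s)
        ...     | inj₁ refl = contradiction e neq
        ...     | inj₂ (_ , t≢ , _) = contradiction
                    (inj₂ (inj₂ (inj₂ (sym t≡) , sees-new s (λ t → t≢ (trans t≡ (sym t))))))
                    (cross a∈ a≤ (≤-reflexive (sym t≡)) s e neq (proj₁ c (a∈ , a≤ , inj₁ t≡)))
          where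
          a≤ : bot a ≤ n
          a≤ = ≤-pred (≤-trans lt (≤-reflexive t≡))

        agree-new : ∀ {a} → a ∈ D → bot a < new → new < top a → left a new ≡ bit (π ▸ k) new (bot a)
        agree-new {a} a∈ (s≤s a≤) ta with left a new in eq
        ... | true = sym (bit-true (π ▸ k) (new⁺ π k a≤ (proj₁ c (a∈ , a≤ , inj₂ (ta , eq)))))
        -- `new` lies right of `a`, and on or to the left of the chosen arc; so `a` is left of the
        -- chosen arc, and its bottom cannot stand at or after `P`.
        ... | false = sym (bit-false (π ▸ k) λ bf → absurd (new⁻ π k a≤ bf))
          where
          absurd : ¬ (position π P ≤ position π (bot a))
          absurd le with seer a∈ a≤ le
          ... | b , s , e with bot a ≟ P
          ...   | yes e′ with same-bot a∈ (proj₁ s) (trans e′ (sym e))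
          ...     | refl with () ← trans (sym eq) (proj₂ (sees-new s (λ t → <⇒≢ ta (sym t))))
          absurd le | b , s , e | no neq = cross a∈ a≤ (<-trans ≤-refl ta) s e neq le leftat
            where
            inA : Inside a new
            inA = s≤s a≤ , ta
            leftat : LeftAt a b new
            leftat with top b ≟ new
            ... | yes t = inj₂ (inj₁ (inA , inj₂ (sym t) , eq))
            ... | no t = let (i , l) = sees-new s t in inj₁ (inA , i , eq , l)

      stage-▸ : Stage (π ▸ k)
      stage-▸ = record
        { traced = record { agree = agree′ ; ends = ends′ ; below = below′ }
        ; covered = covered′ }
        where
        agree′ : ∀ {a h} → a ∈ D → bot a < h → h ≤ new → h < top a → left a h ≡ bit (π ▸ k) h (bot a)
        agree′ a∈ x y z with ≤suc-cases y
        ... | inj₁ q = trans (traced .agree a∈ x q z) (sym (bit-old π k q (≤-trans (<⇒≤ x) q)))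
        ... | inj₂ refl = agree-new a∈ x z

        ends′ : ∀ {a} → a ∈ D → top a ≤ new → Before (π ▸ k) (top a) (bot a)
        ends′ {a} a∈ t≤ with ≤suc-cases t≤ | proj₁ (proj₂ (valid-arc a∈))
        ... | inj₁ q | lt = old⁺ π k q (≤-trans (<⇒≤ lt) q) (traced .ends a∈ q)
        ... | inj₂ e | lt = subst (λ h → Before (π ▸ k) h (bot a)) (sym e)
                              (new⁺ π k a≤ (proj₁ c (a∈ , a≤ , inj₁ e)))
          where
          a≤ : bot a ≤ n
          a≤ = ≤-pred (≤-trans lt (≤-reflexive e))

        below′ : ∀ {b} → b ∈ arcs (π ▸ k) → ∃ λ a → a ∈ D × bot a ≡ bot b × (top a ≡ top b ⊎ new < top a)
        below′ b∈ with addArc⁻ P b∈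
        below′ b∈ | inj₁ (1≤ , refl) with proj₂ c
        ... | inj₁ e = contradiction e (1≤⇒≢0 1≤)
        ... | inj₂ (a , (a∈ , _ , inj₁ t) , e) = a , a∈ , e , inj₁ t
        ... | inj₂ (a , (a∈ , _ , inj₂ (t , _)) , e) = a , a∈ , e , inj₂ t
        below′ {b} b∈ | inj₂ (b∈′ , b≢) with traced .below b∈′
        ... | a , a∈ , e , inj₁ t = a , a∈ , e , inj₁ t
        ... | a , a∈ , e , inj₂ t with m≤n⇒m<n∨m≡n t
        ...   | inj₁ u = a , a∈ , e , inj₂ u
        ...   | inj₂ u = contradiction (trans (sym e) (sym P≡)) (b≢ (subst (1 ≤_) (sym P≡) (proj₁ (valid-arc a∈))))
          where
          P≡ : P ≡ bot a
          P≡ = closes a∈ (proj₁ (proj₂ (valid-arc a∈))) (sym u)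

        covered′ : ∀ {a} → a ∈ D → top a ≤ new → ∃ λ b → b ∈ arcs (π ▸ k) × bot b ≡ bot a × top b ≡ top a
        covered′ {a} a∈ t≤ with ≤suc-cases t≤
        ... | inj₂ e with closes a∈ (proj₁ (proj₂ (valid-arc a∈))) e
        ...   | P≡ = _ , addArc-new P (subst (1 ≤_) (sym P≡) (proj₁ (valid-arc a∈))) , P≡ , sym e
        covered′ {a} a∈ t≤ | inj₁ q with covered a∈ q
        ... | b , b∈ , e , t = b , addArc-old P b∈ (λ b≡ → absurd (trans (sym e) b≡)) , e , t
          where
          -- A finished arc of `D` is not overwritten: the chosen arc still reaches above `n`, and
          -- no two arcs share a bottom.
          absurd : bot a ≢ P
          absurd a≡ with proj₂ c
          ... | inj₁ z = contradiction (trans a≡ z) (1≤⇒≢0 (proj₁ (valid-arc a∈)))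
          ... | inj₂ (b , s , b≡) with same-bot a∈ (proj₁ s) (trans a≡ (sym b≡))
          ...   | refl = contradiction (open-top s) (≤⇒≯ q)

  stages : ∀ m → suc m ≤ N → ∃ λ (π : Path m) → Stage π
  stages zero 1≤N = start , record
    { traced = record
        { agree = λ a∈ x y _ → contradiction (≤-trans x y) (≤⇒≯ (proj₁ (valid-arc a∈)))
        ; ends = λ a∈ t → contradiction (≤-trans (proj₁ (proj₂ (valid-arc a∈))) t) (≤⇒≯ (proj₁ (valid-arc a∈)))
        ; below = λ () }
    ; covered = λ a∈ t → contradiction (≤-trans (proj₁ (proj₂ (valid-arc a∈))) t) (≤⇒≯ (proj₁ (valid-arc a∈))) }
  stages (suc m) m<N with stages m (<⇒≤ m<N)
  ... | π , st with choice π st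
  ...   | p , p≤ , c with choice-entry π st p≤ c
  ...     | k , refl = π ▸ k , stage-▸ π st k c

diagram-path : ∀ {m D} → IsNCDiagram≤1 (suc m) D → ∃ λ (π : Path m) → Follows D π × D ≈ᴰ arcs π
diagram-path {m} {D} D-ok with stages D-ok m ≤-refl
... | π , st = π , Traced⇒Follows D π (λ a∈ → proj₁ (proj₂ (valid-arc a∈))) traced , to , fro
  where
  open Stage st
  valid-arc : ∀ {a} → a ∈ D → ValidArc (suc m) a
  valid-arc = lookupAll (proj₁ D-ok)
  same : ∀ {a b} → a ∈ D → b ∈ arcs π → bot b ≡ bot a → top b ≡ top a → a ≈ᴬ b
  same {a} {b} a∈ b∈ refl refl = refl , refl , λ h (x , y) →
    trans (traced .agree a∈ x (≤-trans (<⇒≤ y) (proj₂ (proj₂ (valid-arc a∈)))) y)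
          (sym (arcOK π b∈ .bits (x , y)))
  to : ∀ {a} → a ∈ D → ∃ λ b → b ∈ arcs π × a ≈ᴬ b
  to a∈ = let (b , b∈ , e , t) = covered a∈ (proj₂ (proj₂ (valid-arc a∈))) in b , b∈ , same a∈ b∈ e t
  fro : ∀ {b} → b ∈ arcs π → ∃ λ a → a ∈ D × b ≈ᴬ a
  fro {b} b∈ with traced .below b∈
  ... | a , a∈ , e , inj₁ t = a , a∈ , ≈ᴬ-sym {a} {b} (same a∈ b∈ (sym e) (sym t))
  ... | a , a∈ , e , inj₂ t = contradiction (proj₂ (proj₂ (valid-arc a∈))) (<⇒≱ t)

-- Tilings of the square

infixl 30 _ᵀ

_ᵀ : ∀ {n} → Rectangulation n → Rectangulation n
R ᵀ = rectangulation (N R) (y₁ R) (y₂ R) (x₁ R) (x₂ R)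

-- `noCross` names the corner that each of the four rectangles has at the common point. This is
-- easier to check and to use than a condition on four distinct rectangles, and transposition just
-- exchanges two of them.
record Tiling {n} (R : Rectangulation n) : Set where
  field
    x<      : ∀ i → x₁ R i < x₂ R i
    x≤      : ∀ i → x₂ R i ≤ N R
    y<      : ∀ i → y₁ R i < y₂ R i
    y≤      : ∀ i → y₂ R i ≤ N R
    cover   : ∀ {a b} → a < N R → b < N R → ∃ λ i → Covers R i a b
    unique  : ∀ {i j a b} → Covers R i a b → Covers R j a b → i ≡ j
    noCross : ∀ {x y} i j k l →
              x₁ R i ≡ x → y₁ R i ≡ y → x₂ R j ≡ x → y₁ R j ≡ y →
              x₁ R k ≡ x → y₂ R k ≡ y → x₂ R l ≡ x → y₂ R l ≡ y → ⊥

Tiling-ᵀ : ∀ {n} {R : Rectangulation n} → Tiling R → Tiling (R ᵀ)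
Tiling-ᵀ t = record
  { x< = y< ; x≤ = y≤ ; y< = x< ; y≤ = x≤
  ; cover = λ a b → let (i , p , q , r , s) = cover b a in i , r , s , p , q
  ; unique = λ (p , q , r , s) (p′ , q′ , r′ , s′) → unique (r , s , p , q) (r′ , s′ , p′ , q′)
  ; noCross = λ i j k l a b c d e f g h → noCross i k j l b a f e d c h g }
  where open Tiling t

Generic⇒Tiling : ∀ {n} {R : Rectangulation n} → IsGenericRectangulation R → Tiling R
Generic⇒Tiling {R = R} (bounds , cov , corners) = record
  { x< = x<
  ; x≤ = λ i → proj₁ (proj₂ (bounds i))
  ; y< = y<
  ; y≤ = λ i → proj₂ (proj₂ (proj₂ (bounds i)))
  ; cover = λ a b → proj₁ (cov _ _ a b)
  ; unique = λ {i} {j} p q → proj₂ (cov _ _ (≤-trans (proj₁ (proj₂ p)) (proj₁ (proj₂ (bounds i))))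
               (≤-trans (proj₂ (proj₂ (proj₂ p))) (proj₂ (proj₂ (proj₂ (bounds i)))))) i j p q
  ; noCross = λ {x} {y} i j k l a b c d e f g h → corners x y i j k l
      (λ { refl → <⇒≢ (x< i) (trans a (sym c)) })
      (λ { refl → <⇒≢ (y< i) (trans b (sym f)) })
      (λ { refl → <⇒≢ (x< i) (trans a (sym g)) })
      (λ { refl → <⇒≢ (x< j) (trans e (sym c)) })
      (λ { refl → <⇒≢ (y< j) (trans d (sym h)) })
      (λ { refl → <⇒≢ (x< k) (trans e (sym g)) })
      ( (inj₁ (sym a) , inj₁ (sym b)) , (inj₂ (sym c) , inj₁ (sym d))
      , (inj₁ (sym e) , inj₂ (sym f)) , (inj₂ (sym g) , inj₂ (sym h))) }
  where
  x< : ∀ i → x₁ R i < x₂ R i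
  x< i = proj₁ (bounds i)
  y< : ∀ i → y₁ R i < y₂ R i
  y< i = proj₁ (proj₂ (proj₂ (bounds i)))

suc-pred-< : ∀ {p q} → p < q → suc (pred q) ≡ q
suc-pred-< (s≤s _) = refl

pred<  : ∀ {p q} → p < q → pred q < q
pred< (s≤s _) = ≤-refl

injective⇒surjective : ∀ {n} (f : Fin n → Fin n) → (∀ {a b} → f a ≡ f b → a ≡ b) → ∀ v → ∃ λ a → f a ≡ v
injective⇒surjective {suc n} f inj v with Fin.any? (λ a → f a Fin.≟ v)
... | yes p = p
... | no ¬p with Fin.pigeonhole ≤-refl (λ a → Fin.punchOut {i = v} {f a} (λ e → ¬p (a , sym e)))
...   | a , b , a<b , e = contradiction (inj (Fin.punchOut-injective (λ q → ¬p (a , sym q)) (λ q → ¬p (b , sym q)) e)) (Fin.<⇒≢ a<b)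

module _ {n} {R : Rectangulation n} (t : Tiling R) where
  open Tiling t

  private
    Kind : Fin n → ℕ → ℕ → Fin 4 → Set
    Kind i x y 0F = x₁ R i ≡ x × y₁ R i ≡ y
    Kind i x y 1F = x₂ R i ≡ x × y₁ R i ≡ y
    Kind i x y 2F = x₁ R i ≡ x × y₂ R i ≡ y
    Kind i x y 3F = x₂ R i ≡ x × y₂ R i ≡ y

    kind : ∀ {i x y} → Corner R i x y → ∃ λ v → Kind i x y v
    kind (inj₁ a , inj₁ b) = 0F , sym a , sym b
    kind (inj₂ a , inj₁ b) = 1F , sym a , sym b
    kind (inj₁ a , inj₂ b) = 2F , sym a , sym b
    kind (inj₂ a , inj₂ b) = 3F , sym a , sym b

    low : ∀ {p q v} → p ≡ v → p < q → (p ≤ v) × (v < q)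
    low refl lt = ≤-refl , lt

    high : ∀ {p q v} → q ≡ v → p < q → (p ≤ pred v) × (pred v < q)
    high refl lt = <⇒≤pred lt , pred< lt

    cells : ∀ {i a b} → (x₁ R i ≤ a) × (a < x₂ R i) → (y₁ R i ≤ b) × (b < y₂ R i) → Covers R i a b
    cells (p , q) (r , s) = p , q , r , s

    kind-unique : ∀ {i j x y} v → Kind i x y v → Kind j x y v → i ≡ j
    kind-unique {i} {j} 0F (a , b) (c , d) = unique (cells (low a (x< i)) (low b (y< i))) (cells (low c (x< j)) (low d (y< j)))
    kind-unique {i} {j} 1F (a , b) (c , d) = unique (cells (high a (x< i)) (low b (y< i))) (cells (high c (x< j)) (low d (y< j)))
    kind-unique {i} {j} 2F (a , b) (c , d) = unique (cells (low a (x< i)) (high b (y< i))) (cells (low c (x< j)) (high d (y< j)))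
    kind-unique {i} {j} 3F (a , b) (c , d) = unique (cells (high a (x< i)) (high b (y< i))) (cells (high c (x< j)) (high d (y< j)))

    -- Two different rectangles cannot have the same kind of corner at a point, for they would
    -- contain the same cell. So four of them exhaust the four kinds.
    fourDistinct : ∀ {x y} (f : Fin 4 → Fin n) → (∀ {a b} → f a ≡ f b → a ≡ b) → ¬ (∀ a → Corner R (f a) x y)
    fourDistinct {x} {y} f f-inj c = noCross _ _ _ _
        (proj₁ (at 0F)) (proj₂ (at 0F)) (proj₁ (at 1F)) (proj₂ (at 1F))
        (proj₁ (at 2F)) (proj₂ (at 2F)) (proj₁ (at 3F)) (proj₂ (at 3F))
      where
      g : Fin 4 → Fin 4
      g a = proj₁ (kind (c a))
      g-inj : ∀ {a b} → g a ≡ g b → a ≡ b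
      g-inj {a} {b} e = f-inj (kind-unique (g b)
        (subst (Kind (f a) x y) e (proj₂ (kind (c a)))) (proj₂ (kind (c b))))
      at : ∀ v → Kind (f (proj₁ (injective⇒surjective g g-inj v))) x y v
      at v = let (a , e) = injective⇒surjective g g-inj v in subst (Kind (f a) x y) e (proj₂ (kind (c a)))

  Tiling⇒Generic : IsGenericRectangulation R
  Tiling⇒Generic =
      (λ i → x< i , x≤ i , y< i , y≤ i)
    , (λ a b p q → cover p q , λ i j → unique)
    , λ x y i j k l ij ik il jk jl kl (ci , cj , ck , cl) →
        let f : Fin 4 → Fin n
            f = λ { 0F → i ; 1F → j ; 2F → k ; 3F → l }
        in fourDistinct f
             (λ { {0F} {0F} _ → refl ; {0F} {1F} e → contradiction e ij ; {0F} {2F} e → contradiction e ik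
                ; {0F} {3F} e → contradiction e il ; {1F} {0F} e → contradiction (sym e) ij ; {1F} {1F} _ → refl
                ; {1F} {2F} e → contradiction e jk ; {1F} {3F} e → contradiction e jl
                ; {2F} {0F} e → contradiction (sym e) ik ; {2F} {1F} e → contradiction (sym e) jk
                ; {2F} {2F} _ → refl ; {2F} {3F} e → contradiction e kl
                ; {3F} {0F} e → contradiction (sym e) il ; {3F} {1F} e → contradiction (sym e) jl
                ; {3F} {2F} e → contradiction (sym e) kl ; {3F} {3F} _ → refl })
             (λ { 0F → ci ; 1F → cj ; 2F → ck ; 3F → cl })

-- nothing stands for the left side of the square, seen as a rectangle.
X₂ Y₁ Y₂ : ∀ {n} → Rectangulation n → Maybe (Fin n) → ℕ
X₂ R nothing  = 0
X₂ R (just i) = x₂ R i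
Y₁ R nothing  = 0
Y₁ R (just i) = y₁ R i
Y₂ R nothing  = N R
Y₂ R (just i) = y₂ R i

Touches : ∀ {n} → Rectangulation n → Maybe (Fin n) → Fin n → Set
Touches R c u = (X₂ R c ≡ x₁ R u) × (Y₁ R c < y₂ R u) × (y₁ R u < Y₂ R c)

orient : ∀ {n} → Side → Rectangulation n → Rectangulation n
orient lft R = R
orient btm R = R ᵀ

Tiling-orient : ∀ {n} {R : Rectangulation n} s → Tiling R → Tiling (orient s R)
Tiling-orient lft t = t
Tiling-orient btm t = Tiling-ᵀ t

adj : ∀ {n} → Rectangulation n → Side → Maybe (Fin n) → Fin n → Set
adj R s = Touches (orient s R)

module _ {n} {R : Rectangulation n} (t : Tiling R) where
  open Tiling t

  -- Found at the cell to the left of the lower left cell of `u`. The bound on `Y₁` makes it the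
  -- lowest left neighbour, which decides the type of the vertex in `corner-cases`.
  leftNeighbour : ∀ u → ∃ λ c → Touches R c u × Y₁ R c ≤ y₁ R u
  leftNeighbour u with x₁ R u in eq
  ... | zero  = nothing , (refl , ≤-<-trans z≤n (y< u) , ≤-trans (y< u) (y≤ u)) , z≤n
  ... | suc a with cover {a} {y₁ R u} a<N (≤-trans (y< u) (y≤ u))
    where
    a<N : a < N R
    a<N = ≤-trans (≤-reflexive (sym eq)) (≤-trans (<⇒≤ (x< u)) (x≤ u))
  ...   | i , p , q , r , s = just i , (x₂≡ (m≤n⇒m<n∨m≡n q) , ≤-<-trans r (y< u) , s) , r
    where
    x₂≡ : suc a < x₂ R i ⊎ suc a ≡ x₂ R i → x₂ R i ≡ suc a
    x₂≡ (inj₂ e) = sym e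
    x₂≡ (inj₁ lt) with unique {i} {u} {suc a} {y₁ R u} (m≤n⇒m≤1+n p , lt , r , s)
                        (≤-reflexive eq , subst (_< x₂ R u) eq (x< u) , ≤-refl , y< u)
    ... | refl = contradiction (≤-trans (≤-reflexive (sym eq)) p) (<-irrefl refl)

  noRightNeighbour : ∀ u → (∀ j → ¬ Touches R (just u) j) → x₂ R u ≡ N R
  noRightNeighbour u none with m≤n⇒m<n∨m≡n (x≤ u)
  ... | inj₂ e = e
  ... | inj₁ lt with cover lt (≤-trans (y< u) (y≤ u))
  ...   | j , p , q , r , s with m≤n⇒m<n∨m≡n p
  ...     | inj₂ e = contradiction (sym e , s , ≤-<-trans r (y< u)) (none j)
  ...     | inj₁ l with unique {j} {u} {pred (x₂ R u)} {y₁ R u}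
                          (<⇒≤pred l , <-trans (pred< (x< u)) q , r , s)
                          (<⇒≤pred (x< u) , pred< (x< u) , ≤-refl , y< u)
  ...       | refl = contradiction q (<-irrefl refl)

  atRight⇒noNeighbour : ∀ u → x₂ R u ≡ N R → ∀ j → ¬ Touches R (just u) j
  atRight⇒noNeighbour u e j (p , _) = <⇒≢ (≤-trans (x< j) (x≤ j)) (trans (sym p) e)

  corner-unique : ∀ {u v} → x₂ R u ≡ N R → y₂ R u ≡ N R → x₂ R v ≡ N R → y₂ R v ≡ N R → u ≡ v
  corner-unique {u} {v} a b c d = unique
    (subst (λ w → Covers R u w (pred (N R))) (cong pred a)
      (subst (Covers R u (pred (x₂ R u))) (cong pred b) (<⇒≤pred (x< u) , pred< (x< u) , <⇒≤pred (y< u) , pred< (y< u))))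
    (subst (λ w → Covers R v w (pred (N R))) (cong pred c)
      (subst (Covers R v (pred (x₂ R v))) (cong pred d) (<⇒≤pred (x< v) , pred< (x< v) , <⇒≤pred (y< v) , pred< (y< v))))

  X₂-unique : ∀ {c d h} → X₂ R c ≡ X₂ R d → Y₁ R c ≤ h → h < Y₂ R c → Y₁ R d ≤ h → h < Y₂ R d → c ≡ d
  X₂-unique {nothing} {nothing} _ _ _ _ _ = refl
  X₂-unique {nothing} {just j} e _ _ _ _ = contradiction (subst (x₁ R j <_) (sym e) (x< j)) λ ()
  X₂-unique {just i} {nothing} e _ _ _ _ = contradiction (subst (x₁ R i <_) e (x< i)) λ ()
  X₂-unique {just i} {just j} {h} e a b c d = cong just (unique
    (<⇒≤pred (x< i) , pred< (x< i) , a , b)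
    (subst (λ w → Covers R j w h) (cong pred (sym e)) (<⇒≤pred (x< j) , pred< (x< j) , c , d)))

  Touches-nothing⇒¬just : ∀ {u i} → Touches R nothing u → ¬ Touches R (just i) u
  Touches-nothing⇒¬just {i = i} (a , _) (b , _) = contradiction (x< i) (λ lt → contradiction (subst (x₁ R i <_) (trans b (sym a)) lt) λ ())

-- Adjacencies along a path

opp≢ : ∀ s → opp s ≢ s
opp≢ lft ()
opp≢ btm ()

opp-opp : ∀ s → opp (opp s) ≡ s
opp-opp lft = refl
opp-opp btm = refl

≡-or-opp : ∀ s s′ → s′ ≡ s ⊎ s′ ≡ opp s
≡-or-opp lft lft = inj₁ refl
≡-or-opp lft btm = inj₂ refl
≡-or-opp btm lft = inj₂ refl
≡-or-opp btm btm = inj₁ refl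

Adjacency : ℕ → Set₁
Adjacency n = Side → Maybe (Fin n) → Fin n → Set

-- Near: the items at t taken over by the new rectangle; Far: the others, whose
-- rectangles it covers.  The item it s d t is both near and far.
module _ {n} (A : Adjacency n) (s : Side) (t : Fin n) (Near Far : Item n → Set) where

  ExtUp : Side → Maybe (Fin n) → Fin (suc n) → Set
  ExtUp s′ c zero    = (s′ ≡ s × Near (it s c t)) ⊎
                       (s′ ≡ opp s × ∃ λ i → c ≡ just i × ∃ λ c′ → Far (it s c′ i))
  ExtUp s′ c (suc u) = (s′ ≡ s × u ≡ t × Far (it s c t)) ⊎ ((s′ ≡ s → u ≢ t) × A s′ c u)

  Ext : Adjacency (suc n)
  Ext s′ nothing        u = ExtUp s′ nothing u
  Ext s′ (just zero)    u = ⊥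
  Ext s′ (just (suc i)) u = ExtUp s′ (just i) u

  Ext-up⁺ : ∀ {s′} c {u} → ExtUp s′ c u → Ext s′ (up c) u
  Ext-up⁺ nothing  p = p
  Ext-up⁺ (just i) p = p

  Ext-up⁻ : ∀ {s′} c {u} → Ext s′ (up c) u → ExtUp s′ c u
  Ext-up⁻ nothing  p = p
  Ext-up⁻ (just i) p = p

-- For `s` = `lft` the second clause says that nothing lies above `u`, so `u` touches the top side;
-- for `btm` it is the right side. Items thus depend on the adjacency alone.
ItemOf : ∀ {n} → Adjacency n → Item n → Set
ItemOf A (it s c u) = A s c u × (∀ j → ¬ A (opp s) (just u) j)

Listed : ∀ {n} → List (Entry n) → Item n → Set
Listed es x = ∃ λ e → e ∈ es × item e ≡ x

module _ {n} (A : Adjacency n) (s : Side) (t : Fin n) (Near Far : Item n → Set) where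

  -- The contacts along the boundary after the insertion. `covered` forgets `c`: all contacts of a
  -- covered rectangle collapse to one, which is the counterpart of the loss of sites.
  data Stepped : Item (suc n) → Set where
    taken   : ∀ {c u} → Near (it s c u) → Stepped (it s (up c) (ren t u))
    covered : ∀ {c u} → Far (it s c u) → Stepped (it (opp s) (just (suc u)) zero)
    kept    : ∀ {c u} → Far (it (opp s) c u) → Stepped (it (opp s) (up c) (suc u))

  module _
    (near-side : ∀ {x} → Near x → side x ≡ s)
    (near-item : ∀ {x} → Near x → ItemOf A x)
    (far-item : ∀ {x} → Far x → ItemOf A x)
    (split : ∀ {x} → ItemOf A x → Near x ⊎ Far x)
    (disjoint : ∀ {c c′ u} → Near (it s c u) → Far (it s c′ u) → u ≡ t)
    (t-out : ∀ j → ¬ A (opp s) (just t) j)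
    where

    private
      A′ = Ext A s t Near Far

      no-out : ∀ {c u} → Far (it (opp s) c u) → ∀ j → ¬ A s (just u) j
      no-out f j a = proj₂ (far-item f) j (subst (λ v → A v _ _) (sym (opp-opp s)) a)

    Stepped⇒ItemOf : ∀ {x} → Stepped x → ItemOf A′ x
    Stepped⇒ItemOf (taken {c} {u} nr) with u Fin.≟ t
    ... | yes refl = Ext-up⁺ A s t Near Far c (inj₁ (refl , nr)) , λ _ ()
    ... | no u≢t = Ext-up⁺ A s t Near Far c (inj₂ ((λ _ → u≢t) , proj₁ (near-item nr))) , λ where
          zero (inj₁ (e , _)) → opp≢ s e
          zero (inj₂ (_ , _ , refl , _ , fr)) → u≢t (disjoint nr fr)
          (suc j) (inj₁ (e , _)) → opp≢ s e
          (suc j) (inj₂ (_ , a)) → proj₂ (near-item nr) j a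
    Stepped⇒ItemOf (covered fr) = inj₂ (refl , _ , refl , _ , fr) , λ _ ()
    Stepped⇒ItemOf (kept {c} {u} fr) =
      Ext-up⁺ A s t Near Far c (inj₂ ((λ e → contradiction e (opp≢ s)) , proj₁ (far-item fr))) , out
      where
      out : ∀ j → ¬ A′ (opp (opp s)) (just (suc u)) j
      out j a with subst (λ v → A′ v (just (suc u)) j) (opp-opp s) a
      out zero    a | inj₁ (_ , nr) = no-out fr t (proj₁ (near-item nr))
      out zero    a | inj₂ (e , _) = opp≢ s (sym e)
      out (suc j) a | inj₁ (_ , refl , f) = no-out fr t (proj₁ (far-item f))
      out (suc j) a | inj₂ (_ , b) = no-out fr j b

    private
      from-s : ∀ c u → A′ s (up c) u → (∀ j → ¬ A′ (opp s) (just u) j) → Stepped (it s (up c) u)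
      from-s c zero a out with Ext-up⁻ A s t Near Far c a
      ... | inj₁ (_ , nr) = subst (λ v → Stepped (it s (up c) v)) (ren-refl t) (taken nr)
      ... | inj₂ (e , _) = contradiction (sym e) (opp≢ s)
      from-s c (suc u) a out with Ext-up⁻ A s t Near Far c a
      ... | inj₁ (_ , refl , fr) = ⊥-elim (out zero (inj₂ (refl , _ , refl , _ , fr)))
      ... | inj₂ (u≢t , b) with split {it s c u} (b , λ j a′ →
                out (suc j) (inj₂ ((λ e → contradiction e (opp≢ s)) , a′)))
      ...   | inj₁ nr = subst (λ v → Stepped (it s (up c) v)) (ren-≢ (u≢t refl)) (taken nr)
      ...   | inj₂ fr = ⊥-elim (out zero (inj₂ (refl , _ , refl , _ , fr)))

      from-opp : ∀ c u → A′ (opp s) (up c) u → (∀ j → ¬ A′ s (just u) j) → Stepped (it (opp s) (up c) u)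
      from-opp c zero a out with Ext-up⁻ A s t Near Far c a
      ... | inj₁ (e , _) = contradiction e (opp≢ s)
      ... | inj₂ (_ , i , refl , _ , fr) = covered fr
      from-opp c (suc u) a out with Ext-up⁻ A s t Near Far c a
      ... | inj₁ (e , _) = contradiction e (opp≢ s)
      ... | inj₂ (_ , b) with split {it (opp s) c u} (b , λ j a′ → u-out j (subst (λ v → A v (just u) j) (opp-opp s) a′))
        where
        u-out : ∀ j → ¬ A s (just u) j
        u-out j a′ with j Fin.≟ t
        ... | no j≢t = out (suc j) (inj₂ ((λ _ → j≢t) , a′))
        ... | yes refl with split {it s (just u) t} (a′ , t-out)
        ...   | inj₁ nr = out zero (inj₁ (refl , nr))
        ...   | inj₂ fr = out (suc t) (inj₁ (refl , refl , fr))
      ...   | inj₁ nr = contradiction (near-side nr) (opp≢ s)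
      ...   | inj₂ fr = kept fr

      from-up : ∀ {s′} c u → A′ s′ (up c) u → (∀ j → ¬ A′ (opp s′) (just u) j) → Stepped (it s′ (up c) u)
      from-up {s′} c u a out with ≡-or-opp s s′
      ... | inj₁ refl = from-s c u a out
      ... | inj₂ refl = from-opp c u a (λ j a′ → out j (subst (λ v → A′ v (just u) j) (sym (opp-opp s)) a′))

    -- A far contact on the side `s` is not among the new ones: `zero` now lies beyond its
    -- rectangle, which no longer touches its side of the square.
    ItemOf⇒Stepped : ∀ {x} → ItemOf A′ x → Stepped x
    ItemOf⇒Stepped {it s′ nothing u} (a , out) = from-up nothing u a out
    ItemOf⇒Stepped {it s′ (just (suc i)) u} (a , out) = from-up (just i) u a out

-- The boundary is read from the upper left to the lower right, so the near part precedes a contact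
-- of the top side and follows a contact of the right side.
near far : ∀ {n} → Side → (es : List (Entry n)) → Fin (length es) → Item n → Set
near lft es k = Listed (prefix es k)
near btm es k = Listed (suffix es k)
far lft es k = Listed (suffix es k)
far btm es k = Listed (prefix es k)

ExtAt : ∀ {n} → Adjacency n → (es : List (Entry n)) → Fin (length es) → Adjacency (suc n)
ExtAt A es k = Ext A (side z) (rect z) (near (side z) es k) (far (side z) es k)
  where z = item (lookup es k)

Adj : ∀ {m} → Path m → Adjacency (suc m)
Adj start s c u = c ≡ nothing
Adj (π ▸ k) = ExtAt (Adj π) (entries π) k

-- Consecutive entries: the next left neighbour of u downwards; the next
-- rectangle on the top side; the corner; then symmetrically along the right side.
data Next {n} (A : Adjacency n) : Entry n → Entry n → Set where
  lx : ∀ {p q c c′ u τ} → A btm (just c′) c →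
       Next A (ent p (it lft (just c) u) LX) (ent q (it lft (just c′) u) τ)
  lm : ∀ {p q c u u′ τ} → A lft (just u) u′ →
       Next A (ent p (it lft c u) LM) (ent q (it lft (just u) u′) τ)
  co : ∀ {p q c c′ u τ} →
       Next A (ent p (it lft c u) E) (ent q (it btm c′ u) τ)
  rx : ∀ {p q c c′ u τ} → A lft (just c) c′ →
       Next A (ent p (it btm (just c) u) RX) (ent q (it btm (just c′) u) τ)
  rm : ∀ {p q c c′ u τ} → A btm (just c) u →
       Next A (ent p (it btm (just c) u) RM) (ent q (it btm c′ c) τ)

infixr 5 _∷_
data Chain {n} (A : Adjacency n) : List (Entry n) → Set where
  end : ∀ {p u} → Chain A (ent p (it btm nothing u) RM ∷ [])
  _∷_ : ∀ {e f es} → Next A e f → Chain A (f ∷ es) → Chain A (e ∷ f ∷ es)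

-- Only the item at the head is fixed, not its site. When an entry is dropped, the next one has the
-- same new item, so the chain can still be linked to what precedes.
data Headed {n} (A : Adjacency n) (x : Item n) : List (Entry n) → Set where
  headed : ∀ {f es} → item f ≡ x → Chain A (f ∷ es) → Headed A x (f ∷ es)

Headed⇒Chain : ∀ {n} {A : Adjacency n} {x es} → Headed A x es → Chain A es
Headed⇒Chain (headed _ ch) = ch

cons : ∀ {n} {A : Adjacency n} {e x es} → (∀ q τ → Next A e (ent q x τ)) → Headed A x es → Headed A (item e) (e ∷ es)
cons nx (headed {ent q x τ} refl ch) = headed refl (nx q τ ∷ ch)

module _ {n} (A : Adjacency n) (A′ : Adjacency (suc n)) (m : ℕ) (z : Item n) where

  record LinkedL (es : List (Entry n)) : Set where
    field
      l-lm : ∀ {p q c u u′ τ} → ent p (it lft c u) LM ∈ es → ent q (it lft (just u) u′) τ ∈ es →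
             A lft (just u) u′ → A′ lft (just (suc u)) (suc u′)
      l-co : ∀ {p c u} → ent p (it lft c u) E ∈ es → shiftRect z btm u ≡ suc u × A′ btm (just (suc u)) zero
      l-rx : ∀ {p q c c′ u τ} → ent p (it btm (just c) u) RX ∈ es → ent q (it btm (just c′) u) τ ∈ es →
             A lft (just c) c′ → A′ lft (just (suc c)) (suc c′)
      l-rm : ∀ {p c u} → ent p (it btm (just c) u) RM ∈ es → A btm (just c) u →
             shiftRect z btm c ≡ suc c × A′ btm (just (suc c)) (shiftRect z btm u)

  -- Links change their kind with the tags: `lm` becomes `rx` and `co` becomes `rm`, as top
  -- rectangles side by side end up side by side below the new one. `rx` and `rm` persist, and an
  -- `lx` entry is dropped.
  chainL : ∀ {e es} → Chain A (e ∷ es) → LinkedL (e ∷ es) →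
           Headed A′ (itemL z (item e)) (mapMaybe (stepL z) (e ∷ es))
  chainL end h = headed refl end
  chainL {e} {f ∷ es} (nx ∷ ch) h = go nx (chainL ch tailH)
    where
    open LinkedL h
    tailH : LinkedL (f ∷ es)
    tailH = record
      { l-lm = λ a b → l-lm (there a) (there b) ; l-co = λ a → l-co (there a)
      ; l-rx = λ a b → l-rx (there a) (there b) ; l-rm = λ a → l-rm (there a) }
    go : Next A e f → Headed A′ (itemL z (item f)) (mapMaybe (stepL z) (f ∷ es)) →
         Headed A′ (itemL z (item e)) (mapMaybe (stepL z) (e ∷ f ∷ es))
    go (lx a) ih = ih
    go (lm a) ih = cons (λ q τ → rx (l-lm (here refl) (there (here refl)) a)) ih
    go (co {p = p} {c′ = c′} {u} ) ih = cons (λ q τ →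
      subst (λ v → Next A′ (ent p (it btm (just (suc u)) zero) RM) (ent q (it btm (up c′) v) τ))
            (sym (proj₁ (l-co (here refl)))) (rm (proj₂ (l-co (here refl))))) ih
    go (rx a) ih = cons (λ q τ → rx (l-rx (here refl) (there (here refl)) a)) ih
    go (rm {p = p} {c = c} {c′} {u} a) ih = cons (λ q τ →
      subst (λ v → Next A′ (ent p (it btm (just (suc c)) (shiftRect z btm u)) RM) (ent q (it btm (up c′) v) τ))
            (sym (proj₁ (l-rm (here refl) a))) (rm (proj₂ (l-rm (here refl) a)))) ih

  record LinkedR (es : List (Entry n)) (k : Fin (length es)) : Set where
    field
      r-lx : ∀ {p c c′ u} → ent p (it lft (just c) u) LX ∈ before es k →
             A btm (just c′) c → A′ btm (just (suc c′)) (suc c)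
      r-lm : ∀ {p q c u u′ τ} → ent p (it lft c u) LM ∈ before es k →
             ent q (it lft (just u) u′) τ ∈ prefix es k → A lft (just u) u′ →
             shiftRect z lft u ≡ suc u × A′ lft (just (suc u)) (shiftRect z lft u′)
      r-co : ∀ {p q c c′ u τ} → ent p (it lft c u) E ∈ before es k →
             ent q (it btm c′ u) τ ∈ prefix es k →
             shiftRect z lft u ≡ suc u × A′ lft (just (suc u)) zero
      r-rm : ∀ {p c u} → ent p (it btm (just c) u) RM ∈ before es k →
             A btm (just c) u → A′ btm (just (suc c)) (suc u)

  private
    newNext : ∀ q τ → Next A′ (ent m (itemR z z) E) (ent q (itemL z z) τ)
    newNext q τ = go z
      where
      go : ∀ y → Next A′ (ent m (itemR y y) E) (ent q (itemL y y) τ)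
      go (it lft d t) rewrite ren-refl t = co
      go (it btm d t) rewrite ren-refl t = co

    head∈prefix : ∀ (e : Entry n) es k → e ∈ prefix (e ∷ es) k
    head∈prefix e es zero    = here refl
    head∈prefix e es (suc k) = here refl

  -- Here `co` becomes `lm`, `rm` becomes `lx`, and an `rx` entry is dropped. At the chosen entry
  -- its two new items are joined by `co`, so the corner moves there.
  chainR : ∀ {e es} k → item (lookup (e ∷ es) k) ≡ z → Chain A (e ∷ es) →
           LinkedR (e ∷ es) k → LinkedL (suffix (e ∷ es) k) →
           Headed A′ (itemR z (item e)) (insertAt m z (e ∷ es) k)
  chainR zero refl ch r l = cons newNext (chainL ch l)
  chainR {e} {f ∷ es} (suc k) eq (nx ∷ ch) r l = go nx (chainR k eq ch tailR l)
    where
    open LinkedR r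
    tailR : LinkedR (f ∷ es) k
    tailR = record
      { r-lx = λ a → r-lx (there a) ; r-lm = λ a b → r-lm (there a) (there b)
      ; r-co = λ a b → r-co (there a) (there b) ; r-rm = λ a → r-rm (there a) }
    f∈ : f ∈ prefix (e ∷ f ∷ es) (suc k)
    f∈ = there (head∈prefix f es k)
    go : Next A e f → Headed A′ (itemR z (item f)) (insertAt m z (f ∷ es) k) →
         Headed A′ (itemR z (item e)) (insertAt m z (e ∷ f ∷ es) (suc k))
    go (lx a) ih = cons (λ q τ → lx (r-lx (here refl) a)) ih
    go (lm {p = p} {c = c} {u} {u′} a) ih = cons (λ q τ →
      subst (λ v → Next A′ (ent p (it lft (up c) v) LM) (ent q (it lft (just (suc u)) (shiftRect z lft u′)) τ))
            (sym (proj₁ (r-lm (here refl) f∈ a))) (lm (proj₂ (r-lm (here refl) f∈ a)))) ih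
    go (co {p = p} {c = c} {u = u}) ih = cons (λ q τ →
      subst (λ v → Next A′ (ent p (it lft (up c) v) LM) (ent q (it lft (just (suc u)) zero) τ))
            (sym (proj₁ (r-co (here refl) f∈))) (lm (proj₂ (r-co (here refl) f∈)))) ih
    go (rx a) ih = ih
    go (rm a) ih = cons (λ q τ → lx (r-rm (here refl) a)) ih

  private
    Listed-there : ∀ {e : Entry (suc n)} {es x} → Listed es x → Listed (e ∷ es) x
    Listed-there (f , f∈ , eq) = f , there f∈ , eq

    Listed-skip : ∀ (e : Maybe (Entry (suc n))) {es x} → Listed es x → Listed (maybe′ _∷_ id e es) x
    Listed-skip (just _) = Listed-there
    Listed-skip nothing  = id

  -- A dropped entry leaves its new item to its successor.
  listedL : ∀ {es} → Chain A es → ∀ {f} → f ∈ es → Listed (mapMaybe (stepL z) es) (itemL z (item f))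
  listedL end (here refl) = _ , here refl , refl
  listedL (lx _ ∷ ch) (here refl) = listedL ch (here refl)
  listedL (lm _ ∷ ch) (here refl) = _ , here refl , refl
  listedL (co   ∷ ch) (here refl) = _ , here refl , refl
  listedL (rx _ ∷ ch) (here refl) = _ , here refl , refl
  listedL (rm _ ∷ ch) (here refl) = _ , here refl , refl
  listedL {e ∷ _} (_ ∷ ch) (there f∈) = Listed-skip (stepL z e) (listedL ch f∈)

  listed-suffix : ∀ {es} → Chain A es → ∀ k {f} → f ∈ suffix es k → Listed (insertAt m z es k) (itemL z (item f))
  listed-suffix {e ∷ es} ch zero f∈ = Listed-there (listedL ch f∈)
  listed-suffix {e ∷ _} (_ ∷ ch) (suc k) f∈ = Listed-skip (stepR z e) (listed-suffix ch k f∈)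

  listed-prefix : ∀ {es} → Chain A es → ∀ k {f} → f ∈ prefix es k → Listed (insertAt m z es k) (itemR z (item f))
  listed-prefix {e ∷ es} ch zero (here refl) = _ , here refl , refl
  listed-prefix (lx _ ∷ ch) (suc k) (here refl) = _ , here refl , refl
  listed-prefix (lm _ ∷ ch) (suc k) (here refl) = _ , here refl , refl
  listed-prefix (co   ∷ ch) (suc k) (here refl) = _ , here refl , refl
  listed-prefix (rm _ ∷ ch) (suc k) (here refl) = _ , here refl , refl
  listed-prefix (rx {q = q} {τ = τ} _ ∷ ch) (suc k) (here refl) = listed-prefix ch k (head∈prefix _ _ k)
  listed-prefix {e ∷ _} (_ ∷ ch) (suc k) (there f∈) = Listed-skip (stepR z e) (listed-prefix ch k f∈)

  private
    step-item : ∀ {p} {y : Item (suc n)} τ {g} → Maybe.map (ent p y) τ ≡ just g → item g ≡ y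
    step-item (just _) refl = refl

  listed⁻ : ∀ es k {x} → Listed (insertAt m z es k) x →
    (∃ λ f → f ∈ prefix es k × x ≡ itemR z (item f)) ⊎ (∃ λ f → f ∈ suffix es k × x ≡ itemL z (item f))
  listed⁻ es k (f , f∈ , refl) with ∈-insertAt⁻ m z es k f∈
  ... | inj₁ refl = inj₁ (_ , lookup∈prefix es k , refl)
  ... | inj₂ (inj₁ (e , e∈ , eq)) = inj₁ (e , before⊆prefix es k e∈ , step-item (tagR (tag e)) eq)
  ... | inj₂ (inj₂ (e , e∈ , eq)) = inj₂ (e , e∈ , step-item (tagL (tag e)) eq)

module _ {n} {A : Adjacency n} {es : List (Entry n)} (ch : Chain A es) (m : ℕ) where

  Listed⇒Stepped : ∀ s d t k → item (lookup es k) ≡ it s d t → (∀ {x} → near s es k x → side x ≡ s) →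
    ∀ {x} → Listed (insertAt m (it s d t) es k) x → Stepped A s t (near s es k) (far s es k) x
  Listed⇒Stepped lft d t k eq ns l with listed⁻ A (λ _ _ _ → ⊥) m (it lft d t) es k l
  ... | inj₁ (ent p (it lft c u) τ , f∈ , refl) = taken (_ , f∈ , refl)
  ... | inj₁ (ent p (it btm c u) τ , f∈ , refl) with () ← ns (_ , f∈ , refl)
  ... | inj₂ (ent p (it lft c u) τ , f∈ , refl) = covered {c = c} (_ , f∈ , refl)
  ... | inj₂ (ent p (it btm c u) τ , f∈ , refl) = kept (_ , f∈ , refl)
  Listed⇒Stepped btm d t k eq ns l with listed⁻ A (λ _ _ _ → ⊥) m (it btm d t) es k l
  ... | inj₁ (ent p (it lft c u) τ , f∈ , refl) = kept (_ , f∈ , refl)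
  ... | inj₁ (ent p (it btm c u) τ , f∈ , refl) = covered {c = c} (_ , f∈ , refl)
  ... | inj₂ (ent p (it lft c u) τ , f∈ , refl) with () ← ns (_ , f∈ , refl)
  ... | inj₂ (ent p (it btm c u) τ , f∈ , refl) = taken (_ , f∈ , refl)

  Stepped⇒Listed : ∀ s d t k → item (lookup es k) ≡ it s d t →
    ∀ {x} → Stepped A s t (near s es k) (far s es k) x → Listed (insertAt m (it s d t) es k) x
  Stepped⇒Listed lft d t k eq (taken (f , f∈ , refl)) = listed-prefix A (λ _ _ _ → ⊥) m (it lft d t) ch k f∈
  Stepped⇒Listed lft d t k eq (covered (f , f∈ , refl)) = listed-suffix A (λ _ _ _ → ⊥) m (it lft d t) ch k f∈
  Stepped⇒Listed lft d t k eq (kept (f , f∈ , refl)) = listed-suffix A (λ _ _ _ → ⊥) m (it lft d t) ch k f∈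
  Stepped⇒Listed btm d t k eq (taken (f , f∈ , refl)) = listed-suffix A (λ _ _ _ → ⊥) m (it btm d t) ch k f∈
  Stepped⇒Listed btm d t k eq (covered (f , f∈ , refl)) = listed-prefix A (λ _ _ _ → ⊥) m (it btm d t) ch k f∈
  Stepped⇒Listed btm d t k eq (kept (f , f∈ , refl)) = listed-prefix A (λ _ _ _ → ⊥) m (it btm d t) ch k f∈

-- Realisations and the order along the boundary

record Good {n} (A : Adjacency n) (es : List (Entry n)) : Set where
  field
    chain : Chain A es
    sound : ∀ {x} → Listed es x → ItemOf A x
    full  : ∀ {x} → ItemOf A x → Listed es x

record Realises {n} (R : Rectangulation n) (A : Adjacency n) : Set where
  field
    tiling : Tiling R
    to     : ∀ s c u → adj R s c u → A s c u
    from   : ∀ s c u → A s c u → adj R s c u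

-- The boundary order in coordinates; being transitive, it compares any two entries of a chain. The
-- equations on the tag record that an `LM` or `RM` contact is the last one of its rectangle.
OrdI : ∀ {n} → Rectangulation n → Item n → Tag → Item n → Set
OrdI R (it lft c u) τ (it lft c′ u′) = x₁ R u < x₁ R u′ ⊎ (τ ≡ LX × u ≡ u′ × Y₂ R c′ < Y₂ R c)
OrdI R (it lft c u) τ (it btm c′ u′) = ⊤
OrdI R (it btm c u) τ (it lft c′ u′) = ⊥
OrdI R (it btm c u) τ (it btm c′ u′) = y₁ R u′ < y₁ R u ⊎ (τ ≡ RX × u ≡ u′ × Y₂ (R ᵀ) c < Y₂ (R ᵀ) c′)

Ord : ∀ {n} → Rectangulation n → Entry n → Entry n → Set
Ord R e f = OrdI R (item e) (tag e) (item f)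

OrdI-trans : ∀ {n} (R : Rectangulation n) x {τ} y {τ′} w → OrdI R x τ y → OrdI R y τ′ w → OrdI R x τ w
OrdI-trans R (it lft _ _) (it lft _ _) (it lft _ _) (inj₁ p) (inj₁ q) = inj₁ (<-trans p q)
OrdI-trans R (it lft _ _) (it lft _ _) (it lft _ _) (inj₁ p) (inj₂ (_ , refl , _)) = inj₁ p
OrdI-trans R (it lft _ _) (it lft _ _) (it lft _ _) (inj₂ (_ , refl , _)) (inj₁ q) = inj₁ q
OrdI-trans R (it lft _ _) (it lft _ _) (it lft _ _) (inj₂ (e , refl , p)) (inj₂ (_ , refl , q)) =
  inj₂ (e , refl , <-trans q p)
OrdI-trans R (it lft _ _) _            (it btm _ _) _  _  = tt
OrdI-trans R (it lft _ _) (it btm _ _) (it lft _ _) _  ()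
OrdI-trans R (it btm _ _) (it lft _ _) _            () _
OrdI-trans R (it btm _ _) (it btm _ _) (it lft _ _) _  ()
OrdI-trans R (it btm _ _) (it btm _ _) (it btm _ _) (inj₁ p) (inj₁ q) = inj₁ (<-trans q p)
OrdI-trans R (it btm _ _) (it btm _ _) (it btm _ _) (inj₁ p) (inj₂ (_ , refl , _)) = inj₁ p
OrdI-trans R (it btm _ _) (it btm _ _) (it btm _ _) (inj₂ (_ , refl , _)) (inj₁ q) = inj₁ q
OrdI-trans R (it btm _ _) (it btm _ _) (it btm _ _) (inj₂ (e , refl , p)) (inj₂ (_ , refl , q)) =
  inj₂ (e , refl , <-trans p q)

OrdI-irrefl : ∀ {n} (R : Rectangulation n) {x τ} → ¬ OrdI R x τ x
OrdI-irrefl R {it lft c u} (inj₁ p) = <-irrefl refl p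
OrdI-irrefl R {it lft c u} (inj₂ (_ , _ , p)) = <-irrefl refl p
OrdI-irrefl R {it btm c u} (inj₁ p) = <-irrefl refl p
OrdI-irrefl R {it btm c u} (inj₂ (_ , _ , p)) = <-irrefl refl p

module _ {n} {R : Rectangulation n} {A : Adjacency n} (real : Realises R A) where
  open Realises real
  open Tiling tiling using (x<; y<)

  Next⇒Ord : ∀ {e f} → Next A e f → Ord R e f
  Next⇒Ord (lx {c = c} {c′} a) =
    inj₂ (refl , refl , ≤-<-trans (≤-reflexive (proj₁ (from btm (just c′) c a))) (y< c))
  Next⇒Ord (lm {u = u} {u′} a) = inj₁ (<-≤-trans (x< u) (≤-reflexive (proj₁ (from lft (just u) u′ a))))
  Next⇒Ord co = tt
  Next⇒Ord (rx {c = c} {c′} a) =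
    inj₂ (refl , refl , ≤-<-trans (≤-reflexive (proj₁ (from lft (just c) c′ a))) (x< c′))
  Next⇒Ord (rm {c = c} {u = u} a) = inj₁ (<-≤-trans (y< c) (≤-reflexive (proj₁ (from btm (just c) u a))))

  Chain⇒AllPairs : ∀ {es} → Chain A es → AllPairs (Ord R) es
  Chain⇒AllPairs end = [] ∷ []
  Chain⇒AllPairs {e ∷ f ∷ es} (nx ∷ ch) with Chain⇒AllPairs ch
  ... | q ∷ qs = (Next⇒Ord nx ∷ All.map (λ {g} → OrdI-trans R (item e) (item f) (item g) (Next⇒Ord nx)) q) ∷ q ∷ qs

  ItemOf⇒edge : ∀ {s c u} → ItemOf A (it s c u) → y₂ (orient s R) u ≡ N (orient s R)
  ItemOf⇒edge {lft} {u = u} (_ , out) = noRightNeighbour (Tiling-ᵀ tiling) u (λ j a → out j (to btm _ _ a))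
  ItemOf⇒edge {btm} {u = u} (_ , out) = noRightNeighbour tiling u (λ j a → out j (to lft _ _ a))

  edge⇒ItemOf : ∀ {s c u} → A s c u → y₂ (orient s R) u ≡ N (orient s R) → ItemOf A (it s c u)
  edge⇒ItemOf {lft} a e = a , λ j b → atRight⇒noNeighbour (Tiling-ᵀ tiling) _ e j (from btm _ _ b)
  edge⇒ItemOf {btm} a e = a , λ j b → atRight⇒noNeighbour tiling _ e j (from lft _ _ b)

module _ {n} {S : Entry n → Entry n → Set} where
  AllPairs-before : ∀ {xs} → AllPairs S xs → ∀ k {e} → e ∈ before xs k → S e (lookup xs k)
  AllPairs-before (q ∷ qs) (suc k) (here refl) = lookupAll q (∈-lookup k)
  AllPairs-before (q ∷ qs) (suc k) (there e∈)  = AllPairs-before qs k e∈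

  AllPairs-suffix : ∀ {xs} → AllPairs S xs → ∀ k {e} → e ∈ suffix xs k → e ≡ lookup xs k ⊎ S (lookup xs k) e
  AllPairs-suffix (q ∷ qs) zero    (here refl) = inj₁ refl
  AllPairs-suffix (q ∷ qs) zero    (there e∈)  = inj₂ (lookupAll q e∈)
  AllPairs-suffix (q ∷ qs) (suc k) e∈          = AllPairs-suffix qs k e∈

module _ {n} {R : Rectangulation n} {A : Adjacency n} {es : List (Entry n)}
         (real : Realises R A) (good : Good A es) (k : Fin (length es)) where
  open Realises real
  open Good good

  private
    sorted : AllPairs (Ord R) es
    sorted = Chain⇒AllPairs real chain

    prefix-ord : ∀ {s d t e} → item (lookup es k) ≡ it s d t → e ∈ prefix es k →
                 item e ≡ it s d t ⊎ OrdI R (item e) (tag e) (it s d t)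
    prefix-ord {e = e} eq e∈ with prefix⁻ es k e∈
    ... | inj₁ b = inj₂ (subst (OrdI R (item e) (tag e)) eq (AllPairs-before sorted k b))
    ... | inj₂ r = inj₁ (trans (cong item r) eq)

    suffix-ord : ∀ {s d t e} → item (lookup es k) ≡ it s d t → e ∈ suffix es k →
                 item e ≡ it s d t ⊎ ∃ λ τ → OrdI R (it s d t) τ (item e)
    suffix-ord {e = e} eq e∈ with AllPairs-suffix sorted k e∈
    ... | inj₁ r = inj₁ (trans (cong item r) eq)
    ... | inj₂ o = inj₂ (_ , subst (λ x → OrdI R x (tag (lookup es k)) (item e)) eq o)

  near-side : ∀ {s d t} → item (lookup es k) ≡ it s d t → ∀ {x} → near s es k x → side x ≡ s
  near-side {lft} eq {it lft c u} l = refl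
  near-side {btm} eq {it btm c u} l = refl
  near-side {lft} eq {it btm c u} (e , e∈ , r) with prefix-ord eq e∈
  ... | inj₁ q with () ← trans (sym r) q
  ... | inj₂ o rewrite r = ⊥-elim o
  near-side {btm} eq {it lft c u} (e , e∈ , r) with suffix-ord eq e∈
  ... | inj₁ q with () ← trans (sym r) q
  ... | inj₂ (_ , o) rewrite r = ⊥-elim o

  near-ord : ∀ {s d t} → item (lookup es k) ≡ it s d t → ∀ {c u} → near s es k (it s c u) →
             let S = orient s R in x₁ S u < x₁ S t ⊎ (u ≡ t × Y₂ S d ≤ Y₂ S c)
  near-ord {lft} eq (e , e∈ , r) with prefix-ord eq e∈
  ... | inj₁ q with refl ← trans (sym r) q = inj₂ (refl , ≤-refl)
  ... | inj₂ o rewrite r with o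
  ...   | inj₁ p = inj₁ p
  ...   | inj₂ (_ , refl , p) = inj₂ (refl , <⇒≤ p)
  near-ord {btm} eq (e , e∈ , r) with suffix-ord eq e∈
  ... | inj₁ q with refl ← trans (sym r) q = inj₂ (refl , ≤-refl)
  ... | inj₂ (_ , o) rewrite r with o
  ...   | inj₁ p = inj₁ p
  ...   | inj₂ (_ , refl , p) = inj₂ (refl , <⇒≤ p)

  far-ord : ∀ {s d t} → item (lookup es k) ≡ it s d t → ∀ {c u} → far s es k (it s c u) →
            let S = orient s R in x₁ S t < x₁ S u ⊎ (u ≡ t × Y₂ S c ≤ Y₂ S d)
  far-ord {lft} eq (e , e∈ , r) with suffix-ord eq e∈
  ... | inj₁ q with refl ← trans (sym r) q = inj₂ (refl , ≤-refl)
  ... | inj₂ (_ , o) rewrite r with o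
  ...   | inj₁ p = inj₁ p
  ...   | inj₂ (_ , refl , p) = inj₂ (refl , <⇒≤ p)
  far-ord {btm} eq (e , e∈ , r) with prefix-ord eq e∈
  ... | inj₁ q with refl ← trans (sym r) q = inj₂ (refl , ≤-refl)
  ... | inj₂ o rewrite r with o
  ...   | inj₁ p = inj₁ p
  ...   | inj₂ (_ , refl , p) = inj₂ (refl , <⇒≤ p)

  near⊆ : ∀ s {x} → near s es k x → Listed es x
  near⊆ lft (e , e∈ , r) with prefix⁻ es k e∈
  ... | inj₁ b = e , before⊆ es k b , r
  ... | inj₂ refl = e , ∈-lookup k , r
  near⊆ btm (e , e∈ , r) = e , suffix⊆ es k e∈ , r

  far⊆ : ∀ s {x} → far s es k x → Listed es x
  far⊆ lft = near⊆ btm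
  far⊆ btm = near⊆ lft

  near-or-far : ∀ s {x} → Listed es x → near s es k x ⊎ far s es k x
  near-or-far s (e , e∈ , r) with before-or-suffix es k e∈
  near-or-far lft (e , e∈ , r) | inj₁ b = inj₁ (e , before⊆prefix es k b , r)
  near-or-far lft (e , e∈ , r) | inj₂ b = inj₂ (e , b , r)
  near-or-far btm (e , e∈ , r) | inj₁ b = inj₂ (e , before⊆prefix es k b , r)
  near-or-far btm (e , e∈ , r) | inj₂ b = inj₁ (e , b , r)

  near-far-rect : ∀ {s d t} → item (lookup es k) ≡ it s d t →
                  ∀ {c c′ u} → near s es k (it s c u) → far s es k (it s c′ u) → u ≡ t
  near-far-rect eq nr fr with near-ord eq nr | far-ord eq fr
  ... | inj₂ (e , _) | _ = e
  ... | inj₁ _ | inj₂ (e , _) = e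
  ... | inj₁ p | inj₁ q = contradiction p (<-asym q)

  module _ {s d t} (eq : item (lookup es k) ≡ it s d t) (m : ℕ) where
    private
      z : Item n
      z = it s d t
      z-item : ItemOf A z
      z-item = sound (_ , ∈-lookup k , eq)
      t-out : ∀ j → ¬ A (opp s) (just t) j
      t-out = proj₂ z-item
      A′ : Adjacency (suc n)
      A′ = Ext A s t (near s es k) (far s es k)

      itemOf : ∀ {p x τ} → ent p x τ ∈ es → ItemOf A x
      itemOf e∈ = sound (_ , e∈ , refl)

      linkedR : ∀ s d t → item (lookup es k) ≡ it s d t → (∀ j → ¬ A (opp s) (just t) j) →
                LinkedR A (Ext A s t (near s es k) (far s es k)) m (it s d t) es k
      linkedR lft d t eq out = record
        { r-lx = λ _ a → inj₂ ((λ ()) , a)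
        ; r-lm = λ e∈ f∈ a → let u≢t = strict e∈ in ren-≢ u≢t , link f∈ a
        -- All entries up to a chosen top contact are on the top side, so the corner is not passed.
        ; r-co = λ _ f∈ → contradiction (near-side eq (_ , f∈ , refl)) λ ()
        ; r-rm = λ _ a → inj₂ ((λ ()) , a) }
        where
        strict : ∀ {p c u} → ent p (it lft c u) LM ∈ before es k → u ≢ t
        strict {p} {c} {u} e∈ refl with subst (OrdI R (it lft c u) LM) eq (AllPairs-before sorted k e∈)
        ... | inj₁ lt = <-irrefl refl lt
        ... | inj₂ (() , _)
        link : ∀ {q u u′ τ} → ent q (it lft (just u) u′) τ ∈ prefix es k → A lft (just u) u′ →
               ExtUp A lft t (near lft es k) (far lft es k) lft (just u) (ren t u′)
        link {u′ = u′} f∈ a with u′ Fin.≟ t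
        ... | yes refl = inj₁ (refl , _ , f∈ , refl)
        ... | no u′≢t = inj₂ ((λ _ → u′≢t) , a)
      linkedR btm d t eq out = record
        { r-lx = λ e∈ a → inj₂ ((λ _ → λ { refl → out _ (proj₁ (itemOf (before⊆ es k e∈))) }) , a)
        ; r-lm = λ _ _ a → refl , inj₂ ((λ ()) , a)
        ; r-co = λ _ f∈ → refl , inj₂ (refl , _ , refl , _ , _ , f∈ , refl)
        ; r-rm = link }
        where
        link : ∀ {p c u} → ent p (it btm (just c) u) RM ∈ before es k → A btm (just c) u →
               ExtUp A btm t (near btm es k) (far btm es k) btm (just c) (suc u)
        link {u = u} e∈ a with u Fin.≟ t
        ... | yes refl = inj₁ (refl , refl , _ , before⊆prefix es k e∈ , refl)
        ... | no u≢t = inj₂ ((λ _ → u≢t) , a)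

      linkedL : ∀ s d t → item (lookup es k) ≡ it s d t → (∀ j → ¬ A (opp s) (just t) j) →
                LinkedL A (Ext A s t (near s es k) (far s es k)) m (it s d t) (suffix es k)
      linkedL lft d t eq out = record
        { l-lm = λ _ f∈ a → link f∈ a
        ; l-co = λ e∈ → refl , inj₂ (refl , _ , refl , _ , _ , e∈ , refl)
        ; l-rx = λ _ f∈ a → inj₂ ((λ _ → λ { refl → out _ (proj₁ (itemOf (suffix⊆ es k f∈))) }) , a)
        ; l-rm = λ _ a → refl , inj₂ ((λ ()) , a) }
        where
        link : ∀ {q u u′ τ} → ent q (it lft (just u) u′) τ ∈ suffix es k → A lft (just u) u′ →
               ExtUp A lft t (near lft es k) (far lft es k) lft (just u) (suc u′)
        link {u′ = u′} f∈ a with u′ Fin.≟ t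
        ... | yes refl = inj₁ (refl , refl , _ , f∈ , refl)
        ... | no u′≢t = inj₂ ((λ _ → u′≢t) , a)
      linkedL btm d t eq out = record
        { l-lm = λ _ _ a → inj₂ ((λ ()) , a)
        ; l-co = λ e∈ → contradiction (near-side eq (_ , e∈ , refl)) λ ()
        ; l-rx = λ _ _ a → inj₂ ((λ ()) , a)
        ; l-rm = λ e∈ a → ren-≢ (lower e∈ a) , link e∈ a }
        where
        lower : ∀ {p c u} → ent p (it btm (just c) u) RM ∈ suffix es k → A btm (just c) u → c ≢ t
        lower {c = c} e∈ a refl with near-ord eq (_ , e∈ , refl) | subst (y₁ R c <_) (proj₁ (from btm _ _ a)) (Tiling.y< tiling c)
        ... | inj₁ lt | gt = <-asym lt gt
        ... | inj₂ (refl , _) | gt = <-irrefl refl gt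
        link : ∀ {p c u} → ent p (it btm (just c) u) RM ∈ suffix es k → A btm (just c) u →
               ExtUp A btm t (near btm es k) (far btm es k) btm (just c) (ren t u)
        link {u = u} e∈ a with u Fin.≟ t
        ... | yes refl = inj₁ (refl , _ , e∈ , refl)
        ... | no u≢t = inj₂ ((λ _ → u≢t) , a)

      chain′ : ∀ {xs} (l : Fin (length xs)) → item (lookup xs l) ≡ z → Chain A xs →
               LinkedR A A′ m z xs l → LinkedL A A′ m z (suffix xs l) → Chain A′ (insertAt m z xs l)
      chain′ {_ ∷ _} l e c lr ll = Headed⇒Chain (chainR A A′ m z l e c lr ll)

    good-▸ : Good A′ (insertAt m z es k)
    good-▸ = record
      { chain = chain′ k eq chain (linkedR s d t eq t-out) (linkedL s d t eq t-out)
      ; sound = λ l → Stepped⇒ItemOf A s t (near s es k) (far s es k) (near-side eq)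
          (λ nr → sound (near⊆ s nr)) (λ fr → sound (far⊆ s fr)) (λ i → near-or-far s (full i))
          (near-far-rect eq) t-out (Listed⇒Stepped chain m s d t k eq (near-side eq) l)
      ; full = λ i → Stepped⇒Listed chain m s d t k eq
          (ItemOf⇒Stepped A s t (near s es k) (far s es k) (near-side eq)
            (λ nr → sound (near⊆ s nr)) (λ fr → sound (far⊆ s fr)) (λ i → near-or-far s (full i))
            (near-far-rect eq) t-out i) }

good-start : Good (Adj start) (entries start)
good-start = record
  { chain = co ∷ end
  ; sound = λ { (_ , here refl , refl) → refl , λ _ () ; (_ , there (here refl) , refl) → refl , λ _ () }
  ; full = λ { {it lft nothing zero} _ → _ , here refl , refl
             ; {it btm nothing zero} _ → _ , there (here refl) , refl
             ; {it _ (just _) _} (() , _) } }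

-- Deletion and insertion of the corner rectangle

-- Rectangle zero is the upper right corner, its left side lies on a segment
-- going down further, d is its lowest left neighbour and t is the leftmost
-- rectangle below it.
record LeftCorner {n} (R : Rectangulation (suc n)) (d : Maybe (Fin n)) (t : Fin n) : Set where
  field
    x-end  : x₂ R zero ≡ N R
    y-end  : y₂ R zero ≡ N R
    d-x    : X₂ R (up d) ≡ x₁ R zero
    d-low  : Y₁ R (up d) < y₁ R zero
    d-high : y₁ R zero < Y₂ R (up d)
    t-x    : x₁ R (suc t) ≡ x₁ R zero
    t-y    : y₂ R (suc t) ≡ y₁ R zero

Raised : ∀ {n} → Rectangulation (suc n) → Fin n → Set
Raised R i = y₂ R (suc i) ≡ y₁ R zero × x₁ R zero < x₂ R (suc i)

raised? : ∀ {n} (R : Rectangulation (suc n)) i → Dec (Raised R i)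
raised? R i = (y₂ R (suc i) ≟ y₁ R zero) ×-dec (x₁ R zero <? x₂ R (suc i))

del : ∀ {n} → Rectangulation (suc n) → Rectangulation n
del R = rectangulation (N R) (x₁ R ∘ suc) (x₂ R ∘ suc) (y₁ R ∘ suc)
  (λ i → if does (raised? R i) then N R else y₂ R (suc i))

module _ {n} (R : Rectangulation (suc n)) {i : Fin n} where

  del-raised : Raised R i → y₂ (del R) i ≡ N R
  del-raised r rewrite dec-true (raised? R i) r = refl

  del-unraised : ¬ Raised R i → y₂ (del R) i ≡ y₂ R (suc i)
  del-unraised r rewrite dec-false (raised? R i) r = refl

module _ {n} {R : Rectangulation (suc n)} (T : Tiling R) {d : Maybe (Fin n)} {t : Fin n} (C : LeftCorner R d t) where
  open Tiling T
  open LeftCorner C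

  private
    X Y : ℕ
    X = x₁ R zero
    Y = y₁ R zero

    S : Rectangulation n
    S = del R

    raised : ∀ {i} → Raised R i → y₂ S i ≡ N R
    raised = del-raised R

    unraised : ∀ {i} → ¬ Raised R i → y₂ S i ≡ y₂ R (suc i)
    unraised = del-unraised R

    Y>0 : 0 < Y
    Y>0 = ≤-<-trans z≤n d-low

    Y<N : Y < N R
    Y<N = <-≤-trans (y< zero) (y≤ zero)

    X<N : X < N R
    X<N = <-≤-trans (x< zero) (x≤ zero)

    pY<Y : pred Y < Y
    pY<Y = pred< Y>0

    outside : ∀ {j a b} → Covers R (suc j) a b → X ≤ a → Y ≤ b → ⊥
    outside {j} c@(_ , p , _ , q) X≤a Y≤b with unique c
      (X≤a , <-≤-trans p (≤-trans (x≤ (suc j)) (≤-reflexive (sym x-end)))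
      , Y≤b , <-≤-trans q (≤-trans (y≤ (suc j)) (≤-reflexive (sym y-end))))
    ... | ()

    y₂≤ : ∀ i → y₂ R (suc i) ≤ y₂ S i
    y₂≤ i with raised? R i
    ... | yes r = ≤-trans (y≤ (suc i)) (≤-reflexive (sym (raised r)))
    ... | no ¬r = ≤-reflexive (sym (unraised ¬r))

    raised-pY : ∀ {i} → Raised R i → (y₁ R (suc i) ≤ pred Y) × (pred Y < y₂ R (suc i))
    raised-pY {i} (e , _) = <⇒≤pred (<-≤-trans (y< (suc i)) (≤-reflexive e)) , <-≤-trans pY<Y (≤-reflexive (sym e))

    -- `d` reaches past the lower left vertex along the line `X`: a rectangle under the corner one
    -- that crossed this line would share with `d` the cell to the lower left of the vertex.
    raised-x : ∀ {i} → Raised R i → X ≤ x₁ R (suc i)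
    raised-x {i} r@(e , lt) = ≮⇒≥ λ lt′ → go d d-x d-low d-high lt′
      where
      go : ∀ d → X₂ R (up d) ≡ X → Y₁ R (up d) < Y → Y < Y₂ R (up d) → ¬ (x₁ R (suc i) < X)
      go nothing 0≡X _ _ lt′ with () ← subst (x₁ R (suc i) <_) (sym 0≡X) lt′
      go (just d) dx dl dh lt′ with unique
        (<⇒≤pred lt′ , <-trans (pred< lt′) lt , proj₁ (raised-pY r) , proj₂ (raised-pY r))
        (<⇒≤pred (<-≤-trans (x< (suc d)) (≤-reflexive dx)) , <-≤-trans (pred< lt′) (≤-reflexive (sym dx))
        , <⇒≤pred dl , <-trans pY<Y dh)
      ... | refl = <-irrefl (sym e) dh

    cover⁻ : ∀ {i a b} → Covers S i a b →
      Covers R (suc i) a b ⊎ (Y ≤ b × X ≤ a × Covers R (suc i) a (pred Y))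
    cover⁻ {i} {a} {b} (p , q , r , s) with raised? R i
    ... | no ¬ra = inj₁ (p , q , r , subst (b <_) (unraised ¬ra) s)
    ... | yes ra with <-≤-connex b Y
    ...   | inj₁ b<Y = inj₁ (p , q , r , <-≤-trans b<Y (≤-reflexive (sym (proj₁ ra))))
    ...   | inj₂ Y≤b = inj₂ (Y≤b , ≤-trans (raised-x ra) p , p , q , raised-pY ra)

  Tiling-del : Tiling (del R)
  Tiling-del = record
    { x< = λ i → x< (suc i) ; x≤ = λ i → x≤ (suc i)
    ; y< = λ i → <-≤-trans (y< (suc i)) (y₂≤ i)
    ; y≤ = y≤′
    ; cover = cover′
    ; unique = unique′
    -- The common point lies below height `N R`, so the two rectangles under it are not raised and
    -- keep their upper sides.
    ; noCross = λ i j k l a b c e f g h o →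
        let y<N = subst (_< N R) b (<-≤-trans (y< (suc i)) (y≤ (suc i)))
        in noCross (suc i) (suc j) (suc k) (suc l) a b c e f (trans (same k (<-≤-trans (≤-reflexive (cong suc g)) y<N)) g)
             h (trans (same l (<-≤-trans (≤-reflexive (cong suc o)) y<N)) o) }
    where
    y≤′ : ∀ i → y₂ S i ≤ N R
    y≤′ i with raised? R i
    ... | yes ra = ≤-reflexive (raised ra)
    ... | no ¬ra = ≤-trans (≤-reflexive (unraised ¬ra)) (y≤ (suc i))
    same : ∀ i → y₂ S i < N R → y₂ R (suc i) ≡ y₂ S i
    same i lt with raised? R i
    ... | yes ra = contradiction lt (<-irrefl (raised ra))
    ... | no ¬ra = sym (unraised ¬ra)
    cover′ : ∀ {a b} → a < N R → b < N R → ∃ λ i → Covers S i a b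
    cover′ {a} {b} a< b< with cover a< b<
    ... | suc i , p , q , r , s = i , p , q , r , <-≤-trans s (y₂≤ i)
    ... | zero , X≤a , _ , Y≤b , _ with cover a< (<-trans pY<Y Y<N)
    ...   | zero , _ , _ , r , _ = contradiction pY<Y (≤⇒≯ r)
    ...   | suc i , p , q , r , s = i , p , q , ≤-trans r (≤-trans (<⇒≤ pY<Y) Y≤b)
              , <-≤-trans b< (≤-reflexive (sym (raised (y₂≡ (m≤n⇒m<n∨m≡n Y≤y₂) , ≤-<-trans X≤a q))))
      where
      Y≤y₂ : Y ≤ y₂ R (suc i)
      Y≤y₂ = ≤-trans (≤-reflexive (sym (suc-pred-< Y>0))) s
      y₂≡ : Y < y₂ R (suc i) ⊎ Y ≡ y₂ R (suc i) → y₂ R (suc i) ≡ Y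
      y₂≡ (inj₂ e) = sym e
      y₂≡ (inj₁ lt) = ⊥-elim (outside (p , q , ≤-trans r (<⇒≤ pY<Y) , lt) X≤a ≤-refl)
    unique′ : ∀ {i j a b} → Covers S i a b → Covers S j a b → i ≡ j
    unique′ p q with cover⁻ p | cover⁻ q
    ... | inj₁ u | inj₁ v = Fin.suc-injective (unique u v)
    ... | inj₁ u | inj₂ (Y≤ , X≤ , v) = ⊥-elim (outside u X≤ Y≤)
    ... | inj₂ (Y≤ , X≤ , u) | inj₁ v = ⊥-elim (outside v X≤ Y≤)
    ... | inj₂ (_ , _ , u) | inj₂ (_ , _ , v) = Fin.suc-injective (unique u v)

  private
    X₂-up : ∀ c → X₂ R (up c) ≡ X₂ S c
    X₂-up nothing  = refl
    X₂-up (just _) = refl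

    Y₁-up : ∀ c → Y₁ R (up c) ≡ Y₁ S c
    Y₁-up nothing  = refl
    Y₁-up (just _) = refl

    Y₂-up≤ : ∀ c → Y₂ R (up c) ≤ Y₂ S c
    Y₂-up≤ nothing  = ≤-refl
    Y₂-up≤ (just i) = y₂≤ i

    Y₂-up : ∀ c → X₂ R (up c) ≡ X → Y₂ R (up c) ≡ Y₂ S c
    Y₂-up nothing  _ = refl
    Y₂-up (just i) e = sym (unraised λ r → <-irrefl (sym e) (proj₂ r))

    Y₁<Y₂ : ∀ c → Y₁ R c < Y₂ R c
    Y₁<Y₂ nothing  = ≤-<-trans z≤n Y<N
    Y₁<Y₂ (just i) = y< i

    t-raised : Raised R t
    t-raised = t-y , subst (_< x₂ R (suc t)) t-x (x< (suc t))

    raised-t : ∀ {j} → Raised R j → x₁ R (suc j) ≡ X → j ≡ t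
    raised-t r e = Fin.suc-injective (unique
      (≤-reflexive e , proj₂ r , raised-pY r)
      (≤-reflexive t-x , proj₂ t-raised , raised-pY t-raised))

  touch-other⁺ : ∀ c j → Touches R (up c) (suc j) → Touches S c j
  touch-other⁺ c j (p , q , r) =
      trans (sym (X₂-up c)) p
    , <-≤-trans (subst (_< _) (Y₁-up c) q) (y₂≤ j)
    , <-≤-trans r (Y₂-up≤ c)

  -- Raising creates no new contact here, because it would need another rectangle in the region that
  -- the corner rectangle occupies in `R`.
  touch-other⁻ : ∀ c {j} → j ≢ t → Touches S c j → Touches R (up c) (suc j)
  touch-other⁻ c {j} j≢t (p , q , r) = trans (X₂-up c) p , low (raised? R j) , high c p r
    where
    beyond : ∀ c → X₂ S c ≡ x₁ R (suc j) → X < x₁ R (suc j) → Y ≤ Y₁ R (up c) → ⊥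
    beyond nothing e lt _ with () ← subst (X <_) (sym e) lt
    beyond (just i) e lt Y≤ = outside
      (<⇒≤pred (x< (suc i)) , pred< (x< (suc i)) , ≤-refl , y< (suc i))
      (<⇒≤pred (subst (X <_) (sym e) lt)) Y≤
    low : Dec (Raised R j) → Y₁ R (up c) < y₂ R (suc j)
    low (no ¬r) = subst₂ _<_ (sym (Y₁-up c)) (unraised ¬r) q
    low (yes ra) with <-≤-connex (Y₁ R (up c)) Y
    ... | inj₁ lt = <-≤-trans lt (≤-reflexive (sym (proj₁ ra)))
    ... | inj₂ ge with m≤n⇒m<n∨m≡n (raised-x ra)
    ...   | inj₂ e = contradiction (raised-t ra (sym e)) j≢t
    ...   | inj₁ lt = ⊥-elim (beyond c p lt ge)
    high : ∀ c → X₂ S c ≡ x₁ R (suc j) → y₁ R (suc j) < Y₂ S c → y₁ R (suc j) < Y₂ R (up c)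
    high nothing e lt = lt
    high (just i) e lt with raised? R i
    ... | no ¬r = <-≤-trans lt (≤-reflexive (unraised ¬r))
    ... | yes ra with <-≤-connex (y₁ R (suc j)) Y
    ...   | inj₁ lt′ = <-≤-trans lt′ (≤-reflexive (sym (proj₁ ra)))
    ...   | inj₂ ge = ⊥-elim (outside (≤-refl , x< (suc j) , ≤-refl , y< (suc j))
                        (<⇒≤ (subst (X <_) e (proj₂ ra))) ge)

  private
    same-column : ∀ c → Touches S c t → X₂ R (up c) ≡ X
    same-column c (p , _) = trans (X₂-up c) (trans p t-x)

  -- The left neighbours of `t` after deletion are divided at `d`: those at or below `d` touched `t`
  -- before, those at or above it touched the corner rectangle, and `d` touched both. The four
  -- inclusions are this lemma and the next three.
  touch-t⁺ : ∀ c → Touches R (up c) (suc t) → Y₂ S c ≤ Y₂ S d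
  touch-t⁺ c (p , q , r) = subst₂ _≤_ (Y₂-up c cx) (Y₂-up d d-x) (≮⇒≥ λ lt →
      <-irrefl (sym (cong (Y₂ R) (X₂-unique T {up c} {up d} {Y} (trans cx (sym d-x))
        (<⇒≤ (<-≤-trans q (≤-reflexive t-y))) (<-trans d-high lt) (<⇒≤ d-low) d-high))) lt)
    where
    cx : X₂ R (up c) ≡ X
    cx = trans p t-x

  touch-t⁻ : ∀ c → Touches S c t → Y₂ S c ≤ Y₂ S d → Touches R (up c) (suc t)
  touch-t⁻ c T′@(p , q , r) le = trans (X₂-up c) p , low , subst (_ <_) (sym (Y₂-up c cx)) r
    where
    cx : X₂ R (up c) ≡ X
    cx = same-column c T′
    le′ : Y₂ R (up c) ≤ Y₂ R (up d)
    le′ = subst₂ _≤_ (sym (Y₂-up c cx)) (sym (Y₂-up d d-x)) le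
    low : Y₁ R (up c) < y₂ R (suc t)
    low with <-≤-connex (Y₁ R (up c)) Y
    ... | inj₁ lt = <-≤-trans lt (≤-reflexive (sym t-y))
    ... | inj₂ ge = contradiction (<-≤-trans d-low ge) (<-irrefl (sym (cong (Y₁ R)
            (X₂-unique T {up c} {up d} {Y₁ R (up c)} (trans cx (sym d-x)) ≤-refl (Y₁<Y₂ (up c))
              (<⇒≤ (<-≤-trans d-low ge)) (<-≤-trans (Y₁<Y₂ (up c)) le′)))))

  touch-zero⁺ : ∀ c → Touches R (up c) zero → Touches S c t × Y₂ S d ≤ Y₂ S c
  touch-zero⁺ c (p , q , r) =
      ( trans (sym (X₂-up c)) (trans p (sym t-x))
      , <-≤-trans (subst (_< y₂ R zero) (Y₁-up c) q) (≤-reflexive (trans y-end (sym (raised t-raised))))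
      , <-≤-trans (<-trans (<-≤-trans (y< (suc t)) (≤-reflexive t-y)) r) (Y₂-up≤ c) )
    , subst₂ _≤_ (Y₂-up d d-x) (Y₂-up c p) (≮⇒≥ λ lt →
        <-irrefl (cong (Y₂ R) (X₂-unique T {up c} {up d} {pred (Y₂ R (up c))} (trans p (sym d-x))
          (<⇒≤pred (Y₁<Y₂ (up c))) (pred< (Y₁<Y₂ (up c)))
          (<⇒≤ (<-≤-trans d-low (<⇒≤pred r))) (<-trans (pred< (Y₁<Y₂ (up c))) lt))) lt)

  touch-zero⁻ : ∀ c → Touches S c t → Y₂ S d ≤ Y₂ S c → Touches R (up c) zero
  touch-zero⁻ c T′@(p , q , r) le =
      same-column c T′
    , <-≤-trans (subst (_< y₂ S t) (sym (Y₁-up c)) q) (≤-reflexive (trans (raised t-raised) (sym y-end)))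
    , <-≤-trans d-high (subst₂ _≤_ (sym (Y₂-up d d-x)) (sym (Y₂-up c (same-column c T′))) le)

  above⁺ : ∀ c j → Touches (R ᵀ) (up c) (suc j) → Touches (S ᵀ) c j
  above⁺ nothing  j p = p
  above⁺ (just i) j (p , q , r) = trans (unraised ¬ra) p , q , r
    where
    ¬ra : ¬ Raised R i
    ¬ra ra = outside {j} {x₁ R (suc i) ⊔ x₁ R (suc j)} {Y}
      ( m≤n⊔m (x₁ R (suc i)) _ , ⊔-lub q (x< (suc j))
      , ≤-reflexive (trans (sym p) (proj₁ ra)) , <-≤-trans (s≤s (≤-reflexive (trans (sym (proj₁ ra)) p))) (y< (suc j)))
      (≤-trans (raised-x ra) (m≤m⊔n _ _)) ≤-refl

  above⁻ : ∀ c j → Touches (S ᵀ) c j → Touches (R ᵀ) (up c) (suc j)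
  above⁻ nothing  j p = p
  above⁻ (just i) j (p , q , r) = trans (sym (unraised ¬ra)) p , q , r
    where
    ¬ra : ¬ Raised R i
    ¬ra ra = <-irrefl (trans (sym p) (raised ra)) (<-≤-trans (y< (suc j)) (y≤ (suc j)))

  above-zero⁺ : ∀ c → Touches (R ᵀ) (up c) zero → ∃ λ i → c ≡ just i × y₂ S i ≡ N S × x₁ S t ≤ x₁ S i
  above-zero⁺ nothing  (p , _) = contradiction Y>0 (<-irrefl p)
  above-zero⁺ (just i) (p , _ , r) = i , refl , raised (p , r) , ≤-trans (≤-reflexive t-x) (raised-x (p , r))

  above-zero⁻ : ∀ i → y₂ S i ≡ N S → x₁ S t ≤ x₁ S i → Touches (R ᵀ) (just (suc i)) zero
  above-zero⁻ i e le with raised? R i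
  ... | yes ra = proj₁ ra , <-≤-trans (x< (suc i)) (≤-trans (x≤ (suc i)) (≤-reflexive (sym x-end))) , proj₂ ra
  ... | no ¬ra = ⊥-elim (outside {i} {x₁ R (suc i)} {pred (y₂ R (suc i))}
      (≤-refl , x< (suc i) , <⇒≤pred (y< (suc i)) , pred< (y< (suc i)))
      (≤-trans (≤-reflexive (sym t-x)) le) (<⇒≤pred (subst (Y <_) (trans (sym e) (unraised ¬ra)) Y<N)))

  private
    noRight : ∀ j → ¬ Touches R (just zero) j
    noRight = atRight⇒noNeighbour T zero x-end

    noAbove : ∀ j → ¬ Touches (R ᵀ) (just zero) j
    noAbove = atRight⇒noNeighbour (Tiling-ᵀ T) zero y-end

    same-top : ∀ {c} → Touches S c t → Touches S d t → Y₂ S c ≡ Y₂ S d → c ≡ d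
    same-top {c} p q e = X₂-unique Tiling-del {c} {d} {pred (Y₂ S c)} (trans (proj₁ p) (sym (proj₁ q)))
        (<⇒≤pred (lt c p)) (pred< (lt c p))
        (subst (λ v → Y₁ S d ≤ pred v) (sym e) (<⇒≤pred (lt d q)))
        (subst (λ v → pred v < Y₂ S d) (sym e) (pred< (lt d q)))
      where
      lt : ∀ c → Touches S c t → Y₁ S c < Y₂ S c
      lt nothing  (_ , _ , r) = ≤-<-trans z≤n r
      lt (just i) _ = Tiling.y< Tiling-del i

  -- Horizontal and vertical adjacencies enter separately, so the same argument serves for `R` with
  -- `lft` and for its transpose with `btm`.
  module Extend (A : Adjacency n) (s : Side)
    (hto : ∀ c u → Touches S c u → A s c u) (hfrom : ∀ c u → A s c u → Touches S c u)
    (vto : ∀ c u → Touches (S ᵀ) c u → A (opp s) c u) (vfrom : ∀ c u → A (opp s) c u → Touches (S ᵀ) c u)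
    (Near Far : Item n → Set)
    (near-item : ∀ {x} → Near x → ItemOf A x) (far-item : ∀ {x} → Far x → ItemOf A x)
    (edge : ∀ {c u} → ItemOf A (it s c u) → y₂ S u ≡ N S)
    (split : ∀ {c u} → A s c u → y₂ S u ≡ N S → Near (it s c u) ⊎ Far (it s c u))
    (near-ord : ∀ {c u} → Near (it s c u) → x₁ S u < x₁ S t ⊎ (u ≡ t × Y₂ S d ≤ Y₂ S c))
    (far-ord : ∀ {c u} → Far (it s c u) → x₁ S t < x₁ S u ⊎ (u ≡ t × Y₂ S c ≤ Y₂ S d))
    (near-z : Near (it s d t)) (far-z : Far (it s d t))
    where

    private
      d-touch : Touches S d t
      d-touch = hfrom d t (proj₁ (near-item near-z))

      A′ : Adjacency (suc n)
      A′ = Ext A s t Near Far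

      near⁺ : ∀ {c} → Touches S c t → Y₂ S d ≤ Y₂ S c → Near (it s c t)
      near⁺ {c} T′ le with split (hto _ _ T′) (raised t-raised)
      ... | inj₁ nr = nr
      ... | inj₂ fr with far-ord fr
      ...   | inj₁ lt = contradiction lt (<-irrefl refl)
      ...   | inj₂ (_ , ge) = subst (λ v → Near (it s v t)) (sym (same-top {c} T′ d-touch (≤-antisym ge le))) near-z

      far⁺ : ∀ {c} → Touches S c t → Y₂ S c ≤ Y₂ S d → Far (it s c t)
      far⁺ {c} T′ le with split (hto _ _ T′) (raised t-raised)
      ... | inj₂ fr = fr
      ... | inj₁ nr with near-ord nr
      ...   | inj₁ lt = contradiction lt (<-irrefl refl)
      ...   | inj₂ (_ , ge) = subst (λ v → Far (it s v t)) (sym (same-top {c} T′ d-touch (≤-antisym le ge))) far-z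

      far-rect : ∀ {i} → y₂ S i ≡ N S → x₁ S t ≤ x₁ S i → ∃ λ c → Far (it s c i)
      far-rect {i} e le with leftNeighbour Tiling-del i
      ... | c , T′ , _ with split (hto _ _ T′) e
      ...   | inj₂ fr = c , fr
      ...   | inj₁ nr with near-ord nr
      ...     | inj₁ lt = contradiction lt (≤⇒≯ le)
      ...     | inj₂ (refl , _) = d , far-z

      h⁺ : ∀ c u → Touches R (up c) u → ExtUp A s t Near Far s c u
      h⁺ c zero T′ = let (T″ , le) = touch-zero⁺ c T′ in inj₁ (refl , near⁺ T″ le)
      h⁺ c (suc u) T′ with u Fin.≟ t
      ... | yes refl = inj₁ (refl , refl , far⁺ (touch-other⁺ c t T′) (touch-t⁺ c T′))
      ... | no u≢t = inj₂ ((λ _ → u≢t) , hto _ _ (touch-other⁺ c u T′))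

      h⁻ : ∀ c u → ExtUp A s t Near Far s c u → Touches R (up c) u
      h⁻ c zero (inj₁ (_ , nr)) with near-ord nr
      ... | inj₁ lt = contradiction lt (<-irrefl refl)
      ... | inj₂ (_ , le) = touch-zero⁻ c (hfrom _ _ (proj₁ (near-item nr))) le
      h⁻ c zero (inj₂ (e , _)) = contradiction (sym e) (opp≢ s)
      h⁻ c (suc u) (inj₁ (_ , refl , fr)) with far-ord fr
      ... | inj₁ lt = contradiction lt (<-irrefl refl)
      ... | inj₂ (_ , le) = touch-t⁻ c (hfrom _ _ (proj₁ (far-item fr))) le
      h⁻ c (suc u) (inj₂ (u≢t , a)) = touch-other⁻ c (u≢t refl) (hfrom _ _ a)

      v⁺ : ∀ c u → Touches (R ᵀ) (up c) u → ExtUp A s t Near Far (opp s) c u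
      v⁺ c zero T′ with above-zero⁺ c T′
      ... | i , refl , e , le = inj₂ (refl , i , refl , far-rect e le)
      v⁺ c (suc u) T′ = inj₂ ((λ e → contradiction e (opp≢ s)) , vto _ _ (above⁺ c u T′))

      v⁻ : ∀ c u → ExtUp A s t Near Far (opp s) c u → Touches (R ᵀ) (up c) u
      v⁻ c zero (inj₁ (e , _)) = contradiction e (opp≢ s)
      v⁻ c zero (inj₂ (_ , i , refl , c′ , fr)) = above-zero⁻ i (edge (far-item fr)) (le (far-ord fr))
        where
        le : _ ⊎ _ → x₁ S t ≤ x₁ S i
        le (inj₁ lt) = <⇒≤ lt
        le (inj₂ (refl , _)) = ≤-refl
      v⁻ c (suc u) (inj₁ (e , _)) = contradiction e (opp≢ s)
      v⁻ c (suc u) (inj₂ (_ , a)) = above⁻ c u (vfrom _ _ a)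

    h-to : ∀ c u → Touches R c u → A′ s c u
    h-to nothing        u T′ = h⁺ nothing u T′
    h-to (just zero)    u T′ = noRight u T′
    h-to (just (suc i)) u T′ = h⁺ (just i) u T′

    h-from : ∀ c u → A′ s c u → Touches R c u
    h-from nothing        u a = h⁻ nothing u a
    h-from (just zero)    u ()
    h-from (just (suc i)) u a = h⁻ (just i) u a

    v-to : ∀ c u → Touches (R ᵀ) c u → A′ (opp s) c u
    v-to nothing        u T′ = v⁺ nothing u T′
    v-to (just zero)    u T′ = noAbove u T′
    v-to (just (suc i)) u T′ = v⁺ (just i) u T′

    v-from : ∀ c u → A′ (opp s) c u → Touches (R ᵀ) c u
    v-from nothing        u a = v⁻ nothing u a
    v-from (just zero)    u ()
    v-from (just (suc i)) u a = v⁻ (just i) u a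

del-orient : ∀ {n} → Side → Rectangulation (suc n) → Rectangulation n
del-orient s R = orient s (del (orient s R))

-- Serves both directions. For a given `R` it extends the path found after deleting the corner; for
-- an insertion it reduces the adjacencies of the new rectangulation to those left when its corner
-- is deleted again.
Realises-▸ : ∀ {n} {R : Rectangulation (suc n)} {A : Adjacency n} {es} s {d t} →
  Tiling R → LeftCorner (orient s R) d t → Realises (del-orient s R) A → (good : Good A es) →
  ∀ k → item (lookup es k) ≡ it s d t → Realises R (ExtAt A es k)
Realises-▸ {R = R} {A} {es} s {d} {t} T C real good k eq = go s C real eq
  where
  open Good good
  go : ∀ s → LeftCorner (orient s R) d t → Realises (del-orient s R) A → item (lookup es k) ≡ it s d t →
       Realises R (ExtAt A es k)
  go lft C real eq rewrite eq = record
    { tiling = T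
    ; to = λ { lft → M.h-to ; btm → M.v-to }
    ; from = λ { lft → M.h-from ; btm → M.v-from } }
    where
    open Realises real
    module M = Extend T C A lft (to lft) (from lft) (to btm) (from btm) (near lft es k) (far lft es k)
      (λ {x} nr → sound (near⊆ real good k lft {x} nr)) (λ {x} fr → sound (far⊆ real good k lft {x} fr))
      (λ {c} {u} → ItemOf⇒edge real {lft} {c} {u})
      (λ {c} {u} a e → near-or-far real good k lft (full (edge⇒ItemOf real {lft} {c} {u} a e)))
      (λ {c} {u} → near-ord real good k {lft} eq {c} {u}) (λ {c} {u} → far-ord real good k {lft} eq {c} {u})
      (_ , lookup∈prefix es k , eq) (_ , lookup∈suffix es k , eq)
  go btm C real eq rewrite eq = record
    { tiling = T
    ; to = λ { btm → M.h-to ; lft → M.v-to }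
    ; from = λ { btm → M.h-from ; lft → M.v-from } }
    where
    open Realises real
    module M = Extend (Tiling-ᵀ T) C A btm (to btm) (from btm) (to lft) (from lft) (near btm es k) (far btm es k)
      (λ {x} nr → sound (near⊆ real good k btm {x} nr)) (λ {x} fr → sound (far⊆ real good k btm {x} fr))
      (λ {c} {u} → ItemOf⇒edge real {btm} {c} {u})
      (λ {c} {u} a e → near-or-far real good k btm (full (edge⇒ItemOf real {btm} {c} {u} a e)))
      (λ {c} {u} → near-ord real good k {btm} eq {c} {u}) (λ {c} {u} → far-ord real good k {btm} eq {c} {u})
      (_ , lookup∈suffix es k , eq) (_ , lookup∈prefix es k , eq)

-- Stretching of coordinates

module Shift (M T : ℕ) where

  shift : ℕ → ℕ
  shift y = if does (y <? T) then y else y + M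

  shift-< : ∀ {y} → y < T → shift y ≡ y
  shift-< {y} lt rewrite dec-true (y <? T) lt = refl

  shift-≥ : ∀ {y} → T ≤ y → shift y ≡ y + M
  shift-≥ {y} ge rewrite dec-false (y <? T) (≤⇒≯ ge) = refl

  shift-mono : ∀ {y z} → y < z → shift y < shift z
  shift-mono {y} {z} lt with <-≤-connex y T | <-≤-connex z T
  ... | inj₁ a | inj₁ b rewrite shift-< a | shift-< b = lt
  ... | inj₁ a | inj₂ b rewrite shift-< a | shift-≥ b = ≤-trans lt (m≤m+n z M)
  ... | inj₂ a | inj₁ b = contradiction (<-trans lt b) (≤⇒≯ a)
  ... | inj₂ a | inj₂ b rewrite shift-≥ a | shift-≥ b = +-monoˡ-< M lt

  shift-cancel : ∀ {y z} → shift y < shift z → y < z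
  shift-cancel {y} {z} lt with <-cmp y z
  ... | tri< a _ _ = a
  ... | tri≈ _ refl _ = contradiction lt (<-irrefl refl)
  ... | tri> _ _ c = contradiction lt (<-asym (shift-mono c))

  shift-injective : ∀ {y z} → shift y ≡ shift z → y ≡ z
  shift-injective {y} {z} e with <-cmp y z
  ... | tri< a _ _ = contradiction (shift-mono a) (<-irrefl e)
  ... | tri≈ _ b _ = b
  ... | tri> _ _ c = contradiction (shift-mono c) (<-irrefl (sym e))

  shift-bound : ∀ {y} → y ≤ M → shift y ≤ M + M
  shift-bound {y} y≤ with <-≤-connex y T
  ... | inj₁ a rewrite shift-< a = ≤-trans y≤ (m≤m+n M M)
  ... | inj₂ a rewrite shift-≥ a = +-monoˡ-≤ M y≤

  -- The upper adjoint of shift.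
  pull : ℕ → ℕ
  pull b = (b ∸ M) ⊔ (b ⊓ pred T)

  module _ (T>0 : 0 < T) where

    ≤-pull⁺ : ∀ {y b} → shift y ≤ b → y ≤ pull b
    ≤-pull⁺ {y} {b} le with <-≤-connex y T
    ... | inj₁ a rewrite shift-< a = ≤-trans (⊓-glb le (<⇒≤pred a)) (m≤n⊔m (b ∸ M) _)
    ... | inj₂ a rewrite shift-≥ a = ≤-trans (m+n≤o⇒m≤o∸n y le) (m≤m⊔n (b ∸ M) _)

    ≤-pull⁻ : ∀ {y b} → y ≤ pull b → shift y ≤ b
    ≤-pull⁻ {y} {b} le with <-≤-connex y T
    ... | inj₁ a rewrite shift-< a = ≤-trans le (⊔-lub (m∸n≤m b M) (m⊓n≤m b (pred T)))
    ... | inj₂ a rewrite shift-≥ a with ⊔-sel (b ∸ M) (b ⊓ pred T)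
    ...   | inj₂ e = contradiction (≤-<-trans (≤-trans (≤-trans le (≤-reflexive e)) (m⊓n≤n b (pred T))) (pred< T>0)) (≤⇒≯ a)
    ...   | inj₁ e = ≤-trans (+-monoˡ-≤ M le′) (≤-reflexive (m∸n+n≡m M≤b))
      where
      le′ : y ≤ b ∸ M
      le′ = ≤-trans le (≤-reflexive e)
      M≤b : M ≤ b
      M≤b = <⇒≤ (≰⇒> λ q → <-irrefl (sym (m≤n⇒m∸n≡0 q)) (<-≤-trans T>0 (≤-trans a le′)))

    <-pull⁺ : ∀ {y b} → b < shift y → pull b < y
    <-pull⁺ lt = ≰⇒> λ le → contradiction (≤-pull⁻ le) (<⇒≱ lt)

    <-pull⁻ : ∀ {y b} → pull b < y → b < shift y
    <-pull⁻ lt = ≰⇒> λ le → contradiction (≤-pull⁺ le) (<⇒≱ lt)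

    pull-bound : ∀ {b} → T ≤ M → b < M + M → pull b < M
    pull-bound {b} T≤ b< = ⊔-lub
      (≰⇒> λ le → contradiction
        (≤-trans (+-monoˡ-≤ M le) (≤-reflexive (m∸n+n≡m (≤-trans le (m∸n≤m b M))))) (<⇒≱ b<))
      (≤-<-trans (m⊓n≤n b (pred T)) (<-≤-trans (pred< T>0) T≤))

    -- `M` falls into the gap opened at `T`. So no stretched side lies at the height of the new
    -- bottom side, which keeps the rectangulation generic at its left end.
    shift≢ : T ≤ M → ∀ y → shift y ≢ M
    shift≢ T≤ y e with <-≤-connex y T
    ... | inj₁ a = <-irrefl (trans (sym (shift-< a)) e) (<-≤-trans a T≤)
    ... | inj₂ a = <-irrefl (trans (sym e) (shift-≥ a)) (+-monoˡ-≤ M (<-≤-trans T>0 a))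

-- Insertion: the rectangles left of t are stretched upwards so that the left
-- neighbours of t above d end up above the old square.
module Insert {n} {S : Rectangulation n} (T : Tiling S) (d : Maybe (Fin n)) (t : Fin n)
              (dt : Touches S d t) (t-top : y₂ S t ≡ N S) where
  open Tiling T

  private
    M X V : ℕ
    M = N S
    X = x₁ S t
    V = Y₂ S d

    V≤M : V ≤ M
    V≤M = go d
      where
      go : ∀ d → Y₂ S d ≤ M
      go nothing  = ≤-refl
      go (just i) = y≤ i

    t<V : y₁ S t < V
    t<V = proj₂ (proj₂ dt)

    V>0 : 0 < V
    V>0 = ≤-<-trans z≤n t<V

    M>0 : 0 < M
    M>0 = <-≤-trans V>0 V≤M

    X<M : X < M
    X<M = <-≤-trans (x< t) (x≤ t)

    -- Coordinates of `S` never exceed `M`, so `H.shift` only sends `M` to `M + M`: the right side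
    -- is pushed out to keep the figure square.
    module H = Shift M M
    module V′ = Shift M V

  lift : Fin n → ℕ → ℕ
  lift i y = if does (x₂ S i ≤? X) then V′.shift y else y

  inserted : Rectangulation (suc n)
  inserted = rectangulation (M + M)
    (λ { zero → H.shift X ; (suc i) → H.shift (x₁ S i) })
    (λ { zero → M + M     ; (suc i) → H.shift (x₂ S i) })
    (λ { zero → M         ; (suc i) → lift i (y₁ S i) })
    (λ { zero → M + M     ; (suc i) → lift i (y₂ S i) })

  private
    R : Rectangulation (suc n)
    R = inserted

    lift-left : ∀ {i y} → x₂ S i ≤ X → lift i y ≡ V′.shift y
    lift-left {i} le rewrite dec-true (x₂ S i ≤? X) le = refl

    lift-right : ∀ {i y} → X < x₂ S i → lift i y ≡ y
    lift-right {i} lt rewrite dec-false (x₂ S i ≤? X) (<⇒≱ lt) = refl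

    -- `t` reaches the top side, so nothing crosses the line `X` from the bottom of `t` upwards.
    -- Hence the part left of the line can be stretched above `V` without moving the part right of
    -- it.
    wall : ∀ {j} → x₁ S j ≤ X → X < x₂ S j → j ≡ t ⊎ y₂ S j < V
    wall {j} le lt with ≤-<-connex (y₂ S j) (y₁ S t)
    ... | inj₁ below = inj₂ (≤-<-trans below t<V)
    ... | inj₂ above = inj₁ (unique {a = X} {b = y₁ S t ⊔ y₁ S j}
            (le , lt , m≤n⊔m (y₁ S t) _ , ⊔-lub above (y< j))
            (≤-refl , x< t , m≤m⊔n (y₁ S t) _ , ⊔-lub (y< t) (<-≤-trans (y< j) (≤-trans (y≤ j) (≤-reflexive (sym t-top))))))

    wall-y₁ : ∀ {j} → x₁ S j ≤ X → X < x₂ S j → y₁ S j < V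
    wall-y₁ le lt with wall le lt
    ... | inj₁ refl = t<V
    ... | inj₂ p = <-trans (y< _) p

    straddle : ∀ {j} → x₁ S j < X → X < x₂ S j → y₂ S j < V
    straddle lt lt′ with wall (<⇒≤ lt) lt′
    ... | inj₁ refl = contradiction lt (<-irrefl refl)
    ... | inj₂ p = p

    -- `pull` takes a cell of the stretched figure to the cell of `S` that it comes from. A
    -- rectangle crossing the line `X` ends below `V`, where `V′.shift` is the identity, so leaving
    -- it unstretched is consistent.
    left⁺ : ∀ {i a b} → H.pull a < X → Covers R (suc i) a b → Covers S i (H.pull a) (V′.pull b)
    left⁺ {i} {a} {b} lt (p , q , r , s) =
        H.≤-pull⁺ M>0 p , a<x₂ , ys (≤-<-connex (x₂ S i) X)
      where
      a<x₂ = H.<-pull⁺ M>0 q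
      ys : x₂ S i ≤ X ⊎ X < x₂ S i → (y₁ S i ≤ V′.pull b) × (V′.pull b < y₂ S i)
      ys (inj₁ le) = V′.≤-pull⁺ V>0 (subst (_≤ b) (lift-left le) r) , V′.<-pull⁺ V>0 (subst (b <_) (lift-left le) s)
      ys (inj₂ gt) = V′.≤-pull⁺ V>0 (subst (_≤ b) (trans (lift-right gt) (sym (V′.shift-< (<-trans (y< i) st)))) r)
                   , V′.<-pull⁺ V>0 (subst (b <_) (trans (lift-right gt) (sym (V′.shift-< st))) s)
        where st = straddle (≤-<-trans (H.≤-pull⁺ M>0 p) lt) gt

    left⁻ : ∀ {i a b} → H.pull a < X → Covers S i (H.pull a) (V′.pull b) → Covers R (suc i) a b
    left⁻ {i} {a} {b} lt (p , q , r , s) with ≤-<-connex (x₂ S i) X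
    ... | inj₁ le = H.≤-pull⁻ M>0 p , H.<-pull⁻ M>0 q
          , subst (_≤ b) (sym (lift-left le)) (V′.≤-pull⁻ V>0 r) , subst (b <_) (sym (lift-left le)) (V′.<-pull⁻ V>0 s)
    ... | inj₂ gt = H.≤-pull⁻ M>0 p , H.<-pull⁻ M>0 q
          , subst (_≤ b) (trans (V′.shift-< (<-trans (y< i) st)) (sym (lift-right gt))) (V′.≤-pull⁻ V>0 r)
          , subst (b <_) (trans (V′.shift-< st) (sym (lift-right gt))) (V′.<-pull⁻ V>0 s)
      where st = straddle (≤-<-trans p lt) gt

    right⁺ : ∀ {i a b} → X ≤ H.pull a → Covers R (suc i) a b → Covers S i (H.pull a) b
    right⁺ {i} {a} {b} ge (p , q , r , s) = H.≤-pull⁺ M>0 p , a<x₂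
        , subst (_≤ b) (lift-right gt) r , subst (b <_) (lift-right gt) s
      where
      a<x₂ = H.<-pull⁺ M>0 q
      gt = ≤-<-trans ge a<x₂

    right⁻ : ∀ {i a b} → X ≤ H.pull a → Covers S i (H.pull a) b → Covers R (suc i) a b
    right⁻ {i} {a} {b} ge (p , q , r , s) = H.≤-pull⁻ M>0 p , H.<-pull⁻ M>0 q
        , subst (_≤ b) (sym (lift-right gt)) r , subst (b <_) (sym (lift-right gt)) s
      where
      gt = ≤-<-trans ge q

    Rx< : ∀ i → x₁ R i < x₂ R i
    Rx< zero    = <-≤-trans (subst (_< M) (sym (H.shift-< X<M)) X<M) (m≤m+n M M)
    Rx< (suc i) = H.shift-mono (x< i)

    Rx≤ : ∀ i → x₂ R i ≤ M + M
    Rx≤ zero    = ≤-refl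
    Rx≤ (suc i) = H.shift-bound (x≤ i)

    Ry< : ∀ i → y₁ R i < y₂ R i
    Ry< zero    = +-monoˡ-≤ M M>0
    Ry< (suc i) with ≤-<-connex (x₂ S i) X
    ... | inj₁ le = subst₂ _<_ (sym (lift-left le)) (sym (lift-left le)) (V′.shift-mono (y< i))
    ... | inj₂ gt = subst₂ _<_ (sym (lift-right gt)) (sym (lift-right gt)) (y< i)

    Ry≤ : ∀ i → y₂ R i ≤ M + M
    Ry≤ zero    = ≤-refl
    Ry≤ (suc i) with ≤-<-connex (x₂ S i) X
    ... | inj₁ le = subst (_≤ M + M) (sym (lift-left le)) (V′.shift-bound (y≤ i))
    ... | inj₂ gt = subst (_≤ M + M) (sym (lift-right gt)) (≤-trans (y≤ i) (m≤m+n M M))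

    Rcover : ∀ {a b} → a < M + M → b < M + M → ∃ λ i → Covers R i a b
    Rcover {a} {b} a< b< with <-≤-connex (H.pull a) X
    ... | inj₁ lt = let (i , c) = cover (H.pull-bound M>0 ≤-refl a<) (V′.pull-bound V>0 V≤M b<)
                    in suc i , left⁻ lt c
    ... | inj₂ ge with <-≤-connex b M
    ...   | inj₁ b<M = let (i , c) = cover (H.pull-bound M>0 ≤-refl a<) b<M in suc i , right⁻ ge c
    ...   | inj₂ M≤b = zero , H.≤-pull⁻ M>0 ge , a< , M≤b , b<

    Runique : ∀ {i j a b} → Covers R i a b → Covers R j a b → i ≡ j
    Runique {zero} {zero} _ _ = refl
    Runique {zero} {suc j} (p , _ , q , _) c =
      contradiction q (<⇒≱ (<-≤-trans (proj₂ (proj₂ (proj₂ (right⁺ (H.≤-pull⁺ M>0 p) c)))) (y≤ j)))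
    Runique {suc i} {zero} c (p , _ , q , _) =
      contradiction q (<⇒≱ (<-≤-trans (proj₂ (proj₂ (proj₂ (right⁺ (H.≤-pull⁺ M>0 p) c)))) (y≤ i)))
    Runique {suc i} {suc j} {a} c c′ with <-≤-connex (H.pull a) X
    ... | inj₁ lt = cong suc (unique (left⁺ lt c) (left⁺ lt c′))
    ... | inj₂ ge = cong suc (unique (right⁺ ge c) (right⁺ ge c′))

    lift-y₁ : ∀ {i} → x₁ S i ≤ X → lift i (y₁ S i) ≡ V′.shift (y₁ S i)
    lift-y₁ {i} le with ≤-<-connex (x₂ S i) X
    ... | inj₁ le′ = lift-left le′
    ... | inj₂ gt = trans (lift-right gt) (sym (V′.shift-< (wall-y₁ le gt)))

    lift-y₂ : ∀ {i} → x₁ S i ≤ X → lift i (y₂ S i) ≡ V′.shift (y₂ S i) ⊎ lift i (y₂ S i) ≡ M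
    lift-y₂ {i} le with ≤-<-connex (x₂ S i) X
    ... | inj₁ le′ = inj₁ (lift-left le′)
    ... | inj₂ gt with wall le gt
    ...   | inj₁ refl = inj₂ (trans (lift-right gt) t-top)
    ...   | inj₂ lt = inj₁ (trans (lift-right gt) (sym (V′.shift-< lt)))

    RnoCross : ∀ {x y} i j k l →
              x₁ R i ≡ x → y₁ R i ≡ y → x₂ R j ≡ x → y₁ R j ≡ y →
              x₁ R k ≡ x → y₂ R k ≡ y → x₂ R l ≡ x → y₂ R l ≡ y → ⊥
    RnoCross i zero k l a b c e f g h o = <-irrefl (trans a (sym c)) (<-≤-trans (Rx< i) (Rx≤ i))
    RnoCross i (suc j) k zero a b c e f g h o = <-irrefl (trans a (sym h)) (<-≤-trans (Rx< i) (Rx≤ i))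
    RnoCross i (suc j) zero (suc l) a b c e f g h o = <-irrefl (trans b (sym g)) (<-≤-trans (Ry< i) (Ry≤ i))
    -- The point is the lower left vertex of the new rectangle, at height `M`; the bottom of the
    -- rectangle to its left is a stretched coordinate, never `M`.
    RnoCross zero (suc j) (suc k) (suc l) a b c e f g h o =
      V′.shift≢ V>0 V≤M (y₁ S j) (trans (sym (lift-left (≤-reflexive (H.shift-injective (trans c (sym a)))))) (trans e (sym b)))
    RnoCross (suc i) (suc j) (suc k) (suc l) a refl c e f g h o with ≤-<-connex (x₁ S i) X
    ... | inj₂ gt = noCross i j k l refl refl xj
            (trans (sym (lift-right (subst (X <_) (sym xj) gt))) (trans e li)) xk
            (trans (sym (lift-right (<-trans (subst (X <_) (sym xk) gt) (x< k)))) (trans g li)) xl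
            (trans (sym (lift-right (subst (X <_) (sym xl) gt))) (trans o li))
      where
      xj = H.shift-injective (trans c (sym a))
      xk = H.shift-injective (trans f (sym a))
      xl = H.shift-injective (trans h (sym a))
      li = lift-right (<-trans gt (x< i))
    ... | inj₁ le = noCross i j k l refl refl xj (V′.shift-injective sj) xk
            (V′.shift-injective sk) xl
            (V′.shift-injective (trans (sym (lift-left (≤-trans (≤-reflexive xl) le))) (trans o li)))
      where
      xj = H.shift-injective (trans c (sym a))
      xk = H.shift-injective (trans f (sym a))
      xl = H.shift-injective (trans h (sym a))
      li = lift-y₁ le
      sj = trans (sym (lift-left (≤-trans (≤-reflexive xj) le))) (trans e li)
      sk : V′.shift (y₂ S k) ≡ V′.shift (y₁ S i)
      sk with lift-y₂ (≤-trans (≤-reflexive xk) le)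
      ... | inj₁ u = trans (sym u) (trans g li)
      ... | inj₂ u = contradiction (trans (sym li) (trans (sym g) u)) (V′.shift≢ V>0 V≤M (y₁ S i))

  Tiling-inserted : Tiling inserted
  Tiling-inserted = record
    { x< = Rx< ; x≤ = Rx≤ ; y< = Ry< ; y≤ = Ry≤
    ; cover = Rcover ; unique = Runique ; noCross = RnoCross }

  leftCorner : LeftCorner inserted d t
  leftCorner = record
    { x-end = refl ; y-end = refl
    ; d-x = d-x d dt ; d-low = d-low d dt refl ; d-high = d-high d dt refl
    ; t-x = refl ; t-y = trans (lift-right (x< t)) t-top }
    where
    d-x : ∀ d → Touches S d t → X₂ R (up d) ≡ H.shift X
    d-x nothing  (e , _) = trans (sym (H.shift-< M>0)) (cong H.shift e)
    d-x (just i) (e , _) = cong H.shift e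
    d-low : ∀ d → Touches S d t → Y₂ S d ≡ V → Y₁ R (up d) < M
    d-low nothing  _ _ = M>0
    d-low (just i) (e , _) v = subst (_< M) (sym (trans (lift-left (≤-reflexive e)) (V′.shift-< lt))) (<-≤-trans lt V≤M)
      where lt = <-≤-trans (y< i) (≤-reflexive v)
    d-high : ∀ d → Touches S d t → Y₂ S d ≡ V → M < Y₂ R (up d)
    d-high nothing  _ _ = +-monoˡ-≤ M M>0
    d-high (just i) (e , _) v = subst (M <_) (sym (trans (lift-left (≤-reflexive e)) (V′.shift-≥ (≤-reflexive (sym v)))))
      (+-monoˡ-≤ M (≤-<-trans z≤n (y< i)))

  private
    S′ : Rectangulation n
    S′ = del inserted

    sV-M : V′.shift M ≡ M + M
    sV-M = V′.shift-≥ V≤M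

    y₁-left : ∀ {i} → x₁ S i ≤ X → y₁ S′ i ≡ V′.shift (y₁ S i)
    y₁-left = lift-y₁

    y₁-right : ∀ {i} → X < x₂ S i → y₁ S′ i ≡ H.shift (y₁ S i)
    y₁-right {i} gt = trans (lift-right gt) (sym (H.shift-< (<-≤-trans (y< i) (y≤ i))))

    raised-right : ∀ {i} → X < x₂ S i → y₂ S i ≡ M → y₂ S′ i ≡ M + M
    raised-right {i} gt e = del-raised R {i} (trans (lift-right gt) e , H.shift-mono gt)

    unraised-right : ∀ {i} → X < x₂ S i → y₂ S i < M → y₂ S′ i ≡ y₂ S i
    unraised-right {i} gt lt = trans (del-unraised R {i} λ r → <-irrefl (trans (sym (lift-right gt)) (proj₁ r)) lt)
                                     (lift-right gt)

    y₂-left : ∀ {i} → x₁ S i ≤ X → y₂ S′ i ≡ V′.shift (y₂ S i)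
    y₂-left {i} le with ≤-<-connex (x₂ S i) X
    ... | inj₁ le′ = trans (del-unraised R {i} λ r → <⇒≱ (H.shift-cancel (proj₂ r)) le′) (lift-left le′)
    ... | inj₂ gt with wall le gt
    ...   | inj₁ refl = trans (raised-right gt t-top) (trans (sym sV-M) (cong V′.shift (sym t-top)))
    ...   | inj₂ lt = trans (unraised-right gt (<-≤-trans lt V≤M)) (sym (V′.shift-< lt))

    y₂-right : ∀ {i} → X < x₂ S i → y₂ S′ i ≡ H.shift (y₂ S i)
    y₂-right {i} gt with m≤n⇒m<n∨m≡n (y≤ i)
    ... | inj₁ lt = trans (unraised-right gt lt) (sym (H.shift-< lt))
    ... | inj₂ e = trans (raised-right gt e) (trans (sym (H.shift-≥ ≤-refl)) (cong H.shift (sym e)))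

    Y₁-left : ∀ c → X₂ S c ≤ X → Y₁ S′ c ≡ V′.shift (Y₁ S c)
    Y₁-left nothing  _ = sym (V′.shift-< V>0)
    Y₁-left (just i) le = y₁-left (<⇒≤ (<-≤-trans (x< i) le))

    Y₂-left : ∀ c → X₂ S c ≤ X → Y₂ S′ c ≡ V′.shift (Y₂ S c)
    Y₂-left nothing  _ = sym sV-M
    Y₂-left (just i) le = y₂-left (<⇒≤ (<-≤-trans (x< i) le))

    Y₁-right : ∀ c → X < X₂ S c → Y₁ S′ c ≡ H.shift (Y₁ S c)
    Y₁-right (just i) lt = y₁-right lt

    Y₂-right : ∀ c → X < X₂ S c → Y₂ S′ c ≡ H.shift (Y₂ S c)
    Y₂-right (just i) lt = y₂-right lt

    X₂-shift : ∀ c → X₂ S′ c ≡ H.shift (X₂ S c)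
    X₂-shift nothing  = sym (H.shift-< M>0)
    X₂-shift (just i) = refl

  -- Deleting the inserted rectangle gives a stretched copy of `S`, by `V′.shift` left of the line
  -- `X` and by `H.shift` right of it. Rectangles side by side are compared through one of these
  -- maps, which are strictly monotone.
  touches⁺ : ∀ c u → Touches S c u → Touches S′ c u
  touches⁺ c u (p , q , r) with ≤-<-connex (X₂ S c) X
  ... | inj₁ le = trans (X₂-shift c) (cong H.shift p)
        , subst₂ _<_ (sym (Y₁-left c le)) (sym (y₂-left u≤)) (V′.shift-mono q)
        , subst₂ _<_ (sym (y₁-left u≤)) (sym (Y₂-left c le)) (V′.shift-mono r)
    where u≤ = ≤-trans (≤-reflexive (sym p)) le
  ... | inj₂ gt = trans (X₂-shift c) (cong H.shift p)
        , subst₂ _<_ (sym (Y₁-right c gt)) (sym (y₂-right u>)) (H.shift-mono q)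
        , subst₂ _<_ (sym (y₁-right u>)) (sym (Y₂-right c gt)) (H.shift-mono r)
    where u> = <-trans (<-≤-trans gt (≤-reflexive p)) (x< u)

  touches⁻ : ∀ c u → Touches S′ c u → Touches S c u
  touches⁻ c u (p′ , q , r) with ≤-<-connex (X₂ S c) X
  ... | inj₁ le = p
        , V′.shift-cancel (subst₂ _<_ (Y₁-left c le) (y₂-left u≤) q)
        , V′.shift-cancel (subst₂ _<_ (y₁-left u≤) (Y₂-left c le) r)
    where p = H.shift-injective (trans (sym (X₂-shift c)) p′)
          u≤ = ≤-trans (≤-reflexive (sym p)) le
  ... | inj₂ gt = p
        , H.shift-cancel (subst₂ _<_ (Y₁-right c gt) (y₂-right u>) q)
        , H.shift-cancel (subst₂ _<_ (y₁-right u>) (Y₂-right c gt) r)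
    where p = H.shift-injective (trans (sym (X₂-shift c)) p′)
          u> = <-trans (<-≤-trans gt (≤-reflexive p)) (x< u)

  private
    -- Rectangles on top of one another are stretched by the same map.
    Common : Fin n → Fin n → Set
    Common i u = (y₂ S′ i ≡ V′.shift (y₂ S i) × y₁ S′ u ≡ V′.shift (y₁ S u))
               ⊎ (y₂ S′ i ≡ H.shift (y₂ S i) × y₁ S′ u ≡ H.shift (y₁ S u))

    common : ∀ i u → x₁ S i < x₂ S u → x₁ S u < x₂ S i → Common i u
    common i u p q with ≤-<-connex (x₁ S i) X | ≤-<-connex (x₁ S u) X
    ... | inj₁ a | inj₁ b = inj₁ (y₂-left a , y₁-left b)
    ... | inj₁ a | inj₂ b = inj₂ (y₂-right (<-trans b q) , y₁-right (<-trans b (x< u)))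
    ... | inj₂ a | _ = inj₂ (y₂-right (<-trans a (x< i)) , y₁-right (<-trans a p))

    y₁-zero : ∀ u → y₁ S u ≡ 0 → y₁ S′ u ≡ 0
    y₁-zero u e with ≤-<-connex (x₁ S u) X
    ... | inj₁ a = trans (y₁-left a) (trans (cong V′.shift e) (V′.shift-< V>0))
    ... | inj₂ b = trans (y₁-right (<-trans b (x< u))) (trans (cong H.shift e) (H.shift-< M>0))

    y₁-zero⁻ : ∀ u → y₁ S′ u ≡ 0 → y₁ S u ≡ 0
    y₁-zero⁻ u e with ≤-<-connex (x₁ S u) X
    ... | inj₁ a = V′.shift-injective (trans (trans (sym (y₁-left a)) e) (sym (V′.shift-< V>0)))
    ... | inj₂ b = H.shift-injective (trans (trans (sym (y₁-right (<-trans b (x< u)))) e) (sym (H.shift-< M>0)))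

  touchesᵀ⁺ : ∀ c u → Touches (S ᵀ) c u → Touches (S′ ᵀ) c u
  touchesᵀ⁺ nothing u (p , q , r) = sym (y₁-zero u (sym p)) , ≤-<-trans z≤n (H.shift-mono (x< u))
    , <-≤-trans (H.shift-mono (x< u)) (H.shift-bound (x≤ u))
  touchesᵀ⁺ (just i) u (p , q , r) = y (common i u q r) , H.shift-mono q , H.shift-mono r
    where
    y : Common i u → y₂ S′ i ≡ y₁ S′ u
    y (inj₁ (a , b)) = trans a (trans (cong V′.shift p) (sym b))
    y (inj₂ (a , b)) = trans a (trans (cong H.shift p) (sym b))

  touchesᵀ⁻ : ∀ c u → Touches (S′ ᵀ) c u → Touches (S ᵀ) c u
  touchesᵀ⁻ nothing u (p , q , r) = sym (y₁-zero⁻ u (sym p)) , ≤-<-trans z≤n (x< u) , <-≤-trans (x< u) (x≤ u)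
  touchesᵀ⁻ (just i) u (p , q , r) = y (common i u q′ r′) , q′ , r′
    where
    q′ = H.shift-cancel q
    r′ = H.shift-cancel r
    y : Common i u → y₂ S i ≡ y₁ S u
    y (inj₁ (a , b)) = V′.shift-injective (trans (sym a) (trans p b))
    y (inj₂ (a , b)) = H.shift-injective (trans (sym a) (trans p b))

insertion : ∀ {n} {R : Rectangulation n} {A : Adjacency n} {es} → Realises R A → Good A es →
  ∀ k → ∃ λ R′ → Realises R′ (ExtAt A es k)
insertion {R = R} {A} {es} real good k = go (item z) refl
  where
  open Realises real
  z = lookup es k
  go : ∀ x → item z ≡ x → ∃ λ R′ → Realises R′ (ExtAt A es k)
  go (it lft d t) eq = I.inserted , Realises-▸ lft I.Tiling-inserted I.leftCorner (record
      { tiling = Tiling-del I.Tiling-inserted I.leftCorner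
      ; to = λ { lft c u h → to lft c u (I.touches⁻ c u h) ; btm c u h → to btm c u (I.touchesᵀ⁻ c u h) }
      ; from = λ { lft c u a → I.touches⁺ c u (from lft c u a) ; btm c u a → I.touchesᵀ⁺ c u (from btm c u a) } })
      good k eq
    where
    x = Good.sound good (_ , ∈-lookup k , eq)
    module I = Insert tiling d t (from lft d t (proj₁ x)) (ItemOf⇒edge real {lft} x)
  go (it btm d t) eq = I.inserted ᵀ , Realises-▸ btm (Tiling-ᵀ I.Tiling-inserted) I.leftCorner (record
      { tiling = Tiling-ᵀ (Tiling-del I.Tiling-inserted I.leftCorner)
      ; to = λ { btm c u h → to btm c u (I.touches⁻ c u h) ; lft c u h → to lft c u (I.touchesᵀ⁻ c u h) }
      ; from = λ { btm c u a → I.touches⁺ c u (from btm c u a) ; lft c u a → I.touchesᵀ⁺ c u (from lft c u a) } })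
      good k eq
    where
    x = Good.sound good (_ , ∈-lookup k , eq)
    module I = Insert (Tiling-ᵀ tiling) d t (from btm d t (proj₁ x)) (ItemOf⇒edge real {btm} x)

-- Realisation of every path

realises-start : ∀ {R : Rectangulation 1} → Tiling R → Realises R (Adj start)
realises-start {R} T = record { tiling = T ; to = to ; from = from }
  where
  only : ∀ {R : Rectangulation 1} → Tiling R → ∀ c u → Touches R c u → c ≡ nothing
  only T nothing u h = refl
  only T (just zero) zero (e , _) = contradiction (Tiling.x< T zero) (<-irrefl (sym e))
  touches : ∀ {R : Rectangulation 1} → Tiling R → ∀ u → Touches R nothing u
  touches {R} T u with leftNeighbour T u
  ... | c , h , _ = subst (λ c → Touches R c u) (only T c u h) h
  to : ∀ s c u → adj R s c u → c ≡ nothing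
  to lft = only T
  to btm = only (Tiling-ᵀ T)
  from : ∀ s c u → c ≡ nothing → adj R s c u
  from lft c u refl = touches T u
  from btm c u refl = touches (Tiling-ᵀ T) u

unitSquare : Rectangulation 1
unitSquare = rectangulation 1 (λ _ → 0) (λ _ → 1) (λ _ → 0) (λ _ → 1)

Tiling-unitSquare : Tiling unitSquare
Tiling-unitSquare = record
  { x< = λ _ → s≤s z≤n ; x≤ = λ _ → ≤-refl ; y< = λ _ → s≤s z≤n ; y≤ = λ _ → ≤-refl
  ; cover = λ p q → zero , z≤n , p , z≤n , q
  ; unique = λ { {zero} {zero} _ _ → refl }
  ; noCross = λ { _ _ _ _ refl _ () } }

-- One induction for both facts: the insertion needs a correct list of contacts, and the correctness
-- of the next list uses the order of contacts in the present realisation.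
realise : ∀ {m} (π : Path m) → ∃ λ R → Realises R (Adj π) × Good (Adj π) (entries π)
realise start = unitSquare , realises-start Tiling-unitSquare , good-start
realise (π ▸ k) with realise π
... | R , real , good with insertion real good k
...   | R′ , real′ = R′ , real′ , good-▸ real good k refl _

good : ∀ {m} (π : Path m) → Good (Adj π) (entries π)
good π = proj₂ (proj₂ (realise π))

-- Existence of a path for every rectangulation

relabel : ∀ {n} → Permutation′ n → Rectangulation n → Rectangulation n
relabel σ R = rectangulation (N R) (λ i → x₁ R (σ ⟨$⟩ʳ i)) (λ i → x₂ R (σ ⟨$⟩ʳ i))
                             (λ i → y₁ R (σ ⟨$⟩ʳ i)) (λ i → y₂ R (σ ⟨$⟩ʳ i))

σ-injective : ∀ {n} (σ : Permutation′ n) {i j} → σ ⟨$⟩ʳ i ≡ σ ⟨$⟩ʳ j → i ≡ j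
σ-injective σ e = trans (sym (inverseˡ σ)) (trans (cong (σ ⟨$⟩ˡ_) e) (inverseˡ σ))

Tiling-relabel : ∀ {n} {R : Rectangulation n} (σ : Permutation′ n) → Tiling R → Tiling (relabel σ R)
Tiling-relabel {R = R} σ T = record
  { x< = λ i → x< _ ; x≤ = λ i → x≤ _ ; y< = λ i → y< _ ; y≤ = λ i → y≤ _
  ; cover = λ {a} {b} p q → let (i , c) = cover p q in
      σ ⟨$⟩ˡ i , subst (λ v → Covers R v a b) (sym (inverseʳ σ)) c
  ; unique = λ p q → σ-injective σ (unique p q)
  ; noCross = λ i j k l → noCross (σ ⟨$⟩ʳ i) (σ ⟨$⟩ʳ j) (σ ⟨$⟩ʳ k) (σ ⟨$⟩ʳ l) }
  where open Tiling T

-- The lower left vertex of the corner rectangle is a T-junction (or lies on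
-- the boundary): one of its two sides continues beyond it.
corner-cases : ∀ {n} {R : Rectangulation (suc (suc n))} → Tiling R → x₂ R zero ≡ N R → y₂ R zero ≡ N R →
  ∃ λ s → ∃ λ d → ∃ λ t → LeftCorner (orient s R) d t
corner-cases {R = R} T x-end y-end = go (leftNeighbour T zero) (leftNeighbour (Tiling-ᵀ T) zero)
  where
  open Tiling T
  X = x₁ R zero
  Y = y₁ R zero
  X<N : X < N R
  X<N = <-≤-trans (x< zero) (x≤ zero)
  Y<N : Y < N R
  Y<N = <-≤-trans (y< zero) (y≤ zero)
  not-all : 0 ≡ X → 0 ≡ Y → ⊥
  not-all e f with unique {zero} {suc zero}
    (≤-trans (≤-reflexive (sym e)) z≤n , <-≤-trans (x< (suc zero)) (≤-trans (x≤ _) (≤-reflexive (sym x-end)))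
    , ≤-trans (≤-reflexive (sym f)) z≤n , <-≤-trans (y< (suc zero)) (≤-trans (y≤ _) (≤-reflexive (sym y-end))))
    (≤-refl , x< _ , ≤-refl , y< _)
  ... | ()
  go : (∃ λ c → Touches R c zero × Y₁ R c ≤ Y) → (∃ λ c → Touches (R ᵀ) c zero × Y₁ (R ᵀ) c ≤ X) →
       ∃ λ s → ∃ λ d → ∃ λ t → LeftCorner (orient s R) d t
  go (just zero , (e , _) , _) _ = contradiction X<N (<-irrefl (trans (sym e) x-end))
  go _ (just zero , (e , _) , _) = contradiction Y<N (<-irrefl (trans (sym e) y-end))
  go (nothing , (e , _) , _) (nothing , (f , _) , _) = ⊥-elim (not-all e f)
  go (nothing , (e , _) , _) (just (suc t) , (f , _) , le) = lft , nothing , t , record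
    { x-end = x-end ; y-end = y-end ; d-x = e
    ; d-low = ≤-<-trans z≤n (<-≤-trans (y< (suc t)) (≤-reflexive f)) ; d-high = Y<N
    ; t-x = trans (n≤0⇒n≡0 (≤-trans le (≤-reflexive (sym e)))) e ; t-y = f }
  go (just (suc l) , (e , _) , le) (nothing , (f , _) , _) = btm , nothing , l , record
    { x-end = y-end ; y-end = x-end ; d-x = f
    ; d-low = ≤-<-trans z≤n (<-≤-trans (x< (suc l)) (≤-reflexive e)) ; d-high = X<N
    ; t-x = trans (n≤0⇒n≡0 (≤-trans le (≤-reflexive (sym f)))) f ; t-y = e }
  go (just (suc l) , (e , _ , lh) , ll) (just (suc t) , (f , _ , th) , tl)
    with m≤n⇒m<n∨m≡n ll | m≤n⇒m<n∨m≡n tl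
  ... | inj₁ l< | inj₂ t≡ = lft , just l , t , record
    { x-end = x-end ; y-end = y-end ; d-x = e ; d-low = l< ; d-high = lh ; t-x = t≡ ; t-y = f }
  ... | inj₂ l≡ | inj₁ t< = btm , just t , l , record
    { x-end = y-end ; y-end = x-end ; d-x = f ; d-low = t< ; d-high = th ; t-x = l≡ ; t-y = e }
  -- `l` goes on below the vertex and `t` to the left of it, so both contain the cell between.
  ... | inj₁ l< | inj₁ t< with unique {suc l} {suc t} {pred X} {pred Y}
        (<⇒≤pred x₁l<X , <-≤-trans (pred< t<) (≤-reflexive (sym e)) , <⇒≤pred l< , <-trans (pred< l<) lh)
        (<⇒≤pred t< , <-trans (pred< t<) th , <⇒≤pred y₁t<Y , <-≤-trans (pred< l<) (≤-reflexive (sym f)))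
    where
    x₁l<X = <-≤-trans (x< (suc l)) (≤-reflexive e)
    y₁t<Y = <-≤-trans (y< (suc t)) (≤-reflexive f)
  ...   | refl = contradiction th (<-irrefl (sym e))
  -- Neither side goes on, so the rectangle of the cell to the lower left would be the fourth with a
  -- corner at this vertex.
  go (just (suc l) , (e , _ , lh) , ll) (just (suc t) , (f , _ , th) , tl) | inj₂ l≡ | inj₂ t≡ =
    ⊥-elim (noCross zero (suc l) (suc t) d refl refl e l≡ t≡ f x₂d y₂d)
    where
    X>0 : 0 < X
    X>0 = ≤-<-trans z≤n (<-≤-trans (x< (suc l)) (≤-reflexive e))
    Y>0 : 0 < Y
    Y>0 = ≤-<-trans z≤n (<-≤-trans (y< (suc t)) (≤-reflexive f))
    c = cover (<-trans (pred< X>0) X<N) (<-trans (pred< Y>0) Y<N)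
    d = proj₁ c
    x₂d : x₂ R d ≡ X
    x₂d with c
    ... | d , p , q , r , s with m≤n⇒m<n∨m≡n (≤-trans (≤-reflexive (sym (suc-pred-< X>0))) q)
    ...   | inj₂ u = sym u
    ...   | inj₁ lt with unique {d} {suc t} {X} {pred Y}
              (≤-trans p pred[n]≤n , lt , r , s)
              (≤-reflexive t≡ , th , <⇒≤pred (<-≤-trans (y< (suc t)) (≤-reflexive f)) , <-≤-trans (pred< Y>0) (≤-reflexive (sym f)))
    ...     | refl = contradiction (≤-<-trans p (pred< X>0)) (<-irrefl t≡)
    y₂d : y₂ R d ≡ Y
    y₂d with c
    ... | d , p , q , r , s with m≤n⇒m<n∨m≡n (≤-trans (≤-reflexive (sym (suc-pred-< Y>0))) s)
    ...   | inj₂ u = sym u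
    ...   | inj₁ lt with unique {d} {suc l} {pred X} {Y}
              (p , q , ≤-trans r pred[n]≤n , lt)
              (<⇒≤pred (<-≤-trans (x< (suc l)) (≤-reflexive e)) , <-≤-trans (pred< X>0) (≤-reflexive (sym e)) , ≤-reflexive l≡ , lh)
    ...     | refl = contradiction (≤-<-trans r (pred< Y>0)) (<-irrefl l≡)

corner-exists : ∀ {n} {R : Rectangulation (suc n)} → Tiling R → ∃ λ c → x₂ R c ≡ N R × y₂ R c ≡ N R
corner-exists {R = R} T = c , reaches (x≤ c) (proj₁ (proj₂ covers)) , reaches (y≤ c) (proj₂ (proj₂ (proj₂ covers)))
  where
  open Tiling T
  N>0 : 0 < N R
  N>0 = ≤-<-trans z≤n (<-≤-trans (x< zero) (x≤ zero))
  found = cover (pred< N>0) (pred< N>0)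
  c = proj₁ found
  covers = proj₂ found
  reaches : ∀ {v} → v ≤ N R → pred (N R) < v → v ≡ N R
  reaches le lt = ≤-antisym le (≤-trans (≤-reflexive (sym (suc-pred-< N>0))) lt)

LeftCorner-relabel : ∀ {n} {R : Rectangulation (suc n)} (σ : Permutation′ n) {d t} → LeftCorner R d t →
  LeftCorner (relabel (lift₀ σ) R) (Maybe.map (σ ⟨$⟩ˡ_) d) (σ ⟨$⟩ˡ t)
LeftCorner-relabel {R = R} σ {d} {t} C = record
  { x-end = x-end ; y-end = y-end
  ; d-x = trans (on-d X₂ d (λ _ → refl) refl) d-x
  ; d-low = subst (_< y₁ R zero) (sym (on-d Y₁ d (λ _ → refl) refl)) d-low
  ; d-high = subst (y₁ R zero <_) (sym (on-d Y₂ d (λ _ → refl) refl)) d-high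
  ; t-x = trans (cong (λ v → x₁ R (suc v)) (inverseʳ σ)) t-x
  ; t-y = trans (cong (λ v → y₂ R (suc v)) (inverseʳ σ)) t-y }
  where
  open LeftCorner C
  on-d : (F : Rectangulation _ → Maybe (Fin _) → ℕ) → ∀ d →
    (∀ i → F (relabel (lift₀ σ) R) (just (suc i)) ≡ F R (just (suc (σ ⟨$⟩ʳ i)))) →
    F (relabel (lift₀ σ) R) nothing ≡ F R nothing →
    F (relabel (lift₀ σ) R) (up (Maybe.map (σ ⟨$⟩ˡ_) d)) ≡ F R (up d)
  on-d F nothing  _ h = h
  on-d F (just i) h _ = trans (h _) (cong (λ v → F R (just (suc v))) (inverseʳ σ))

LeftCorner⇒Touches : ∀ {n} {R : Rectangulation (suc n)} {d t} → Tiling R → LeftCorner R d t →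
  Touches (del R) d t × y₂ (del R) t ≡ N R
LeftCorner⇒Touches {R = R} {d} {t} T C =
    proj₁ (touch-zero⁺ T C d (d-x , <-trans d-low (Tiling.y< T zero) , d-high))
  , del-raised R {t} (t-y , subst (_< x₂ R (suc t)) t-x (Tiling.x< T (suc t)))
  where open LeftCorner C

extend-path : ∀ {m} {R : Rectangulation (suc (suc m))} s {d t} (π : Path m) → Tiling R →
  LeftCorner (orient s R) d t → Realises (del-orient s R) (Adj π) → ∃ λ ρ → Realises R (Adj ρ)
extend-path lft {d} {t} π T C real =
  let (a , e) = LeftCorner⇒Touches T C
      (f , f∈ , eq) = Good.full (good π) (edge⇒ItemOf real {lft} {d} {t} (Realises.to real lft d t a) e)
      (k , look) = ∈⇒lookup f∈
  in π ▸ k , Realises-▸ lft T C real (good π) k (trans (cong item look) eq)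
extend-path btm {d} {t} π T C real =
  let (a , e) = LeftCorner⇒Touches (Tiling-ᵀ T) C
      (f , f∈ , eq) = Good.full (good π) (edge⇒ItemOf real {btm} {d} {t} (Realises.to real btm d t a) e)
      (k , look) = ∈⇒lookup f∈
  in π ▸ k , Realises-▸ btm T C real (good π) k (trans (cong item look) eq)

-- A path labels the rectangles by insertion, the last one being `zero`. So the corner is first
-- swapped to `zero`, and the others are relabelled by the induction.
rectangulation-path : ∀ m {R : Rectangulation (suc m)} → Tiling R →
  ∃ λ (π : Path m) → ∃ λ σ → Realises (relabel σ R) (Adj π)
rectangulation-path zero T = start , idₚ , realises-start T
rectangulation-path (suc m) {R} T with corner-exists T
... | c , cx , cy = go (corner-cases T₁ cx cy)
  where
  τ : Permutation′ (suc (suc m))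
  τ = transpose zero c
  R₁ : Rectangulation (suc (suc m))
  R₁ = relabel τ R
  T₁ : Tiling R₁
  T₁ = Tiling-relabel τ T
  go : (∃ λ s → ∃ λ d → ∃ λ t → LeftCorner (orient s R₁) d t) →
       ∃ λ (π : Path (suc m)) → ∃ λ σ → Realises (relabel σ R) (Adj π)
  go (lft , d , t , C) =
    -- `del` commutes definitionally with relabelling, so `real` already concerns the relabelled
    -- rectangulation with its corner deleted.
    let (π , σ , real) = rectangulation-path m (Tiling-del T₁ C)
        (ρ , real′) = extend-path lft π (Tiling-relabel (lift₀ σ) T₁) (LeftCorner-relabel σ C) real
    in ρ , lift₀ σ ∘ₚ τ , real′
  go (btm , d , t , C) =
    let (π , σ , real) = rectangulation-path m (Tiling-ᵀ (Tiling-del (Tiling-ᵀ T₁) C))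
        (ρ , real′) = extend-path btm π (Tiling-relabel (lift₀ σ) T₁) (LeftCorner-relabel σ C) real
    in ρ , lift₀ σ ∘ₚ τ , real′

-- Rigidity

Iso : ∀ {n} → Adjacency n → Adjacency n → (Fin n → Fin n) → Set
Iso A B f = ∀ s c u → (A s c u → B s (Maybe.map f c) (f u)) × (B s (Maybe.map f c) (f u) → A s c u)

mapItem : ∀ {n} → (Fin n → Fin n) → Item n → Item n
mapItem f (it s d t) = it s (Maybe.map f d) (f t)

-- The item at which the corner rectangle was inserted, read off the adjacencies.
CornerItem : ∀ {n} → Adjacency (suc n) → Item n → Set
CornerItem A (it s d t) = A s (up d) zero × A s (up d) (suc t) × A (opp s) (just (suc t)) zero

module _ {n} {R : Rectangulation (suc n)} (T : Tiling R) where
  open Tiling T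

  private
    X Y : ℕ
    X = x₁ R zero
    Y = y₁ R zero

  -- `d` is the left neighbour spanning height `Y`: it reaches above because it touches `zero`, and
  -- below because it touches `suc t`. And `suc t` holds the cell under the lower left cell of
  -- `zero`.
  CornerItem-unique-side : ∀ {d t d′ t′} →
    Touches R (up d) zero → Touches R (up d) (suc t) → Touches (R ᵀ) (just (suc t)) zero →
    Touches R (up d′) zero → Touches R (up d′) (suc t′) → Touches (R ᵀ) (just (suc t′)) zero →
    d ≡ d′ × t ≡ t′
  CornerItem-unique-side {d} {t} {d′} {t′} (p , _ , q) (r , s , _) (v , _ , w) (p′ , _ , q′) (r′ , s′ , _) (v′ , _ , w′) =
      Maybe.map-injective Fin.suc-injective (X₂-unique T {up d} {up d′} {Y} (trans p (sym p′))
        (<⇒≤ (<-≤-trans s (≤-reflexive v))) q (<⇒≤ (<-≤-trans s′ (≤-reflexive v′))) q′)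
    , Fin.suc-injective (unique (covers-under {up d} p r v w) (covers-under {up d′} p′ r′ v′ w′))
    where
    covers-under : ∀ {d t} → X₂ R d ≡ X → X₂ R d ≡ x₁ R (suc t) → y₂ R (suc t) ≡ Y → X < x₂ R (suc t) →
            Covers R (suc t) X (pred Y)
    covers-under {t = t} p r v w = ≤-reflexive (trans (sym r) p) , w
      , <⇒≤pred lt , <-≤-trans (pred< lt) (≤-reflexive (sym v))
      where lt = <-≤-trans (y< (suc t)) (≤-reflexive v)

  -- Both sides of `zero` would go on beyond its lower left vertex; away from the boundary of the
  -- square, `d` and `d′` would then share the cell diagonal to it.
  CornerItem-one-side : ∀ {d t d′ t′} →
    Touches R (up d) zero → Touches R (up d) (suc t) → Touches (R ᵀ) (just (suc t)) zero →
    Touches (R ᵀ) (up d′) zero → Touches (R ᵀ) (up d′) (suc t′) → Touches R (just (suc t′)) zero → ⊥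
  CornerItem-one-side {nothing} (p , _) _ _ _ _ (e , _) = <⇒≱ (≤-<-trans z≤n (x< _)) (≤-reflexive (trans e (sym p)))
  CornerItem-one-side {just i} {d′ = nothing} _ _ (e , _) (p , _) _ _ = <⇒≱ (≤-<-trans z≤n (y< _)) (≤-reflexive (trans e (sym p)))
  CornerItem-one-side {just i} {t} {just j} {t′} (p , _ , q) (r , s , _) (v , _) (p′ , _ , q′) (r′ , s′ , _) (v′ , _)
    with unique {suc i} {suc j} {pred X} {pred Y}
      (<⇒≤pred (<-≤-trans (x< (suc i)) (≤-reflexive p)) , <-≤-trans (pred< X>0) (≤-reflexive (sym p))
      , <⇒≤pred (<-≤-trans s (≤-reflexive v)) , <-trans (pred< Y>0) q)
      (<⇒≤pred (<-≤-trans s′ (≤-reflexive v′)) , <-trans (pred< X>0) q′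
      , <⇒≤pred (<-≤-trans (y< (suc j)) (≤-reflexive p′)) , <-≤-trans (pred< Y>0) (≤-reflexive (sym p′)))
    where
    X>0 = ≤-<-trans z≤n (<-≤-trans (x< (suc i)) (≤-reflexive p))
    Y>0 = ≤-<-trans z≤n (<-≤-trans (y< (suc j)) (≤-reflexive p′))
  ... | refl = <-irrefl (sym p′) q

CornerItem-unique : ∀ {n} {R : Rectangulation (suc n)} {A} → Realises R A →
  ∀ {x y} → CornerItem A x → CornerItem A y → x ≡ y
CornerItem-unique {R = R} real {it lft d t} {it lft d′ t′} (a , b , c) (a′ , b′ , c′)
  with CornerItem-unique-side tiling {d} {t} {d′} {t′}
    (from _ _ _ a) (from _ _ _ b) (from btm _ _ c)
    (from _ _ _ a′) (from _ _ _ b′) (from btm _ _ c′)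
  where open Realises real
... | refl , refl = refl
CornerItem-unique {R = R} real {it btm d t} {it btm d′ t′} (a , b , c) (a′ , b′ , c′)
  with CornerItem-unique-side (Tiling-ᵀ tiling) {d} {t} {d′} {t′}
    (from _ _ _ a) (from _ _ _ b) (from lft _ _ c)
    (from _ _ _ a′) (from _ _ _ b′) (from lft _ _ c′)
  where open Realises real
... | refl , refl = refl
CornerItem-unique {R = R} real {it lft d t} {it btm d′ t′} (a , b , c) (a′ , b′ , c′) =
  ⊥-elim (CornerItem-one-side tiling {d} {t} {d′} {t′}
    (from lft _ _ a) (from lft _ _ b) (from btm _ _ c)
    (from btm _ _ a′) (from btm _ _ b′) (from lft _ _ c′))
  where open Realises real
CornerItem-unique {R = R} real {it btm d t} {it lft d′ t′} (a , b , c) (a′ , b′ , c′) =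
  ⊥-elim (CornerItem-one-side tiling {d′} {t′} {d} {t}
    (from lft _ _ a′) (from lft _ _ b′) (from btm _ _ c′)
    (from btm _ _ a) (from btm _ _ b) (from lft _ _ c))
  where open Realises real

_≟ˢ_ : (s s′ : Side) → Dec (s ≡ s′)
lft ≟ˢ lft = yes refl
lft ≟ˢ btm = no λ ()
btm ≟ˢ lft = no λ ()
btm ≟ˢ btm = yes refl

module _ {m} (π : Path m) (k : Fin (length (entries π))) where
  private
    A : Adjacency (suc m)
    A = Adj π
    es : List (Entry (suc m))
    es = entries π
    z : Item (suc m)
    z = item (lookup es k)
    real : Realises (proj₁ (realise π)) A
    real = proj₁ (proj₂ (realise π))
    Near Far : Item (suc m) → Set
    Near = near (side z) es k
    Far = far (side z) es k

    z-near : ∀ s → near s es k z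
    z-near lft = _ , lookup∈prefix es k , refl
    z-near btm = _ , lookup∈suffix es k , refl

    z-far : ∀ s → far s es k z
    z-far lft = _ , lookup∈suffix es k , refl
    z-far btm = _ , lookup∈prefix es k , refl

    z-item : ItemOf A z
    z-item = Good.sound (good π) (_ , ∈-lookup k , refl)

  CornerItem-▸ : CornerItem (Adj (π ▸ k)) z
  CornerItem-▸ =
      Ext-up⁺ A (side z) (rect z) Near Far (nbr z) (inj₁ (refl , z-near (side z)))
    , Ext-up⁺ A (side z) (rect z) Near Far (nbr z) (inj₁ (refl , refl , z-far (side z)))
    , inj₂ (refl , _ , refl , nbr z , z-far (side z))

  -- The adjacency before the last insertion, recovered from the one after it: contacts taken over
  -- by `zero` are given back to `rect z`. An isomorphism that respects the corner and the chosen
  -- item therefore restricts.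
  Restricted : Side → Maybe (Fin (suc m)) → Fin (suc m) → Set
  Restricted s c u = Adj (π ▸ k) s (up c) (suc u) ⊎ (s ≡ side z × u ≡ rect z × Adj (π ▸ k) s (up c) zero)

  restrict⁺ : ∀ s c u → A s c u → Restricted s c u
  restrict⁺ s c u a with s ≟ˢ side z | u Fin.≟ rect z
  ... | no s≢ | _ = inj₁ (Ext-up⁺ A (side z) (rect z) Near Far c (inj₂ ((λ e → contradiction e s≢) , a)))
  ... | yes _ | no u≢ = inj₁ (Ext-up⁺ A (side z) (rect z) Near Far c (inj₂ ((λ _ → u≢) , a)))
  ... | yes refl | yes refl with near-or-far real (good π) k (side z) (Good.full (good π) {it (side z) c (rect z)} (a , proj₂ z-item))
  ...   | inj₁ nr = inj₂ (refl , refl , Ext-up⁺ A (side z) (rect z) Near Far c (inj₁ (refl , nr)))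
  ...   | inj₂ fr = inj₁ (Ext-up⁺ A (side z) (rect z) Near Far c (inj₁ (refl , refl , fr)))

  restrict⁻ : ∀ s c u → Restricted s c u → A s c u
  restrict⁻ s c u (inj₁ a) with Ext-up⁻ A (side z) (rect z) Near Far c a
  ... | inj₁ (refl , refl , fr) = proj₁ (Good.sound (good π) (far⊆ real (good π) k (side z) fr))
  ... | inj₂ (_ , b) = b
  restrict⁻ s c u (inj₂ (refl , refl , a)) with Ext-up⁻ A (side z) (rect z) Near Far c a
  ... | inj₁ (_ , nr) = proj₁ (Good.sound (good π) (near⊆ real (good π) k (side z) nr))
  ... | inj₂ (e , _) = contradiction (sym e) (opp≢ (side z))

items-injective : ∀ {m} (π : Path m) k l → item (lookup (entries π) k) ≡ item (lookup (entries π) l) → k ≡ l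
items-injective π = go (Chain⇒AllPairs (proj₁ (proj₂ (realise π))) (Good.chain (good π)))
  where
  R = proj₁ (realise π)
  go : ∀ {es} → AllPairs (Ord R) es → ∀ k l → item (lookup es k) ≡ item (lookup es l) → k ≡ l
  go (q ∷ qs) zero    zero    _  = refl
  go {e ∷ es} (q ∷ qs) zero    (suc l) eq = contradiction
    (subst (OrdI R (item e) (tag e)) (sym eq) (lookupAll q (∈-lookup l))) (OrdI-irrefl R {item e} {tag e})
  go {e ∷ es} (q ∷ qs) (suc k) zero    eq = contradiction
    (subst (OrdI R (item e) (tag e)) eq (lookupAll q (∈-lookup k))) (OrdI-irrefl R {item e} {tag e})
  go (q ∷ qs) (suc k) (suc l) eq = cong suc (go qs k l eq)

Iso-cong : ∀ {n} {A B : Adjacency n} {f g : Fin n → Fin n} → (∀ i → f i ≡ g i) → Iso A B f → Iso A B g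
Iso-cong {B = B} e iso s c u =
    (λ a → subst₂ (B s) (Maybe.map-cong e c) (e u) (proj₁ (iso s c u) a))
  , (λ b → proj₂ (iso s c u) (subst₂ (B s) (sym (Maybe.map-cong e c)) (sym (e u)) b))

module _ {m} (π ρ : Path m) (k : Fin (length (entries π))) (l : Fin (length (entries ρ)))
         (σ : Permutation′ (suc m)) (iso : Iso (Adj (π ▸ k)) (Adj (ρ ▸ l)) (lift₀ σ ⟨$⟩ʳ_)) where
  private
    f : Fin (suc m) → Fin (suc m)
    f = σ ⟨$⟩ʳ_

    map-up : ∀ c → Maybe.map (lift₀ σ ⟨$⟩ʳ_) (up c) ≡ up (Maybe.map f c)
    map-up nothing  = refl
    map-up (just _) = refl

    iso-up : ∀ {s} c u → Adj (π ▸ k) s (up c) u → Adj (ρ ▸ l) s (up (Maybe.map f c)) (lift₀ σ ⟨$⟩ʳ u)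
    iso-up {s} c u a = subst (λ v → Adj (ρ ▸ l) s v (lift₀ σ ⟨$⟩ʳ u)) (map-up c) (proj₁ (iso s (up c) u) a)

    iso-down : ∀ {s} c u → Adj (ρ ▸ l) s (up (Maybe.map f c)) (lift₀ σ ⟨$⟩ʳ u) → Adj (π ▸ k) s (up c) u
    iso-down {s} c u b = proj₂ (iso s (up c) u) (subst (λ v → Adj (ρ ▸ l) s v (lift₀ σ ⟨$⟩ʳ u)) (sym (map-up c)) b)

    mapped : ∀ x → CornerItem (Adj (π ▸ k)) x → CornerItem (Adj (ρ ▸ l)) (mapItem f x)
    mapped (it s d t) (a , b , c) = iso-up d zero a , iso-up d (suc t) b , iso-up (just t) zero c

  chosen-item : mapItem f (item (lookup (entries π) k)) ≡ item (lookup (entries ρ) l)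
  chosen-item = CornerItem-unique (proj₁ (proj₂ (realise (ρ ▸ l))))
    (mapped (item (lookup (entries π) k)) (CornerItem-▸ π k)) (CornerItem-▸ ρ l)

  Iso-restrict : Iso (Adj π) (Adj ρ) f
  Iso-restrict s c u =
      (λ a → restrict⁻ ρ l s (Maybe.map f c) (f u) (to (restrict⁺ π k s c u a)))
    , (λ b → restrict⁻ π k s c u (from (restrict⁺ ρ l s (Maybe.map f c) (f u) b)))
    where
    to : Restricted π k s c u → Restricted ρ l s (Maybe.map f c) (f u)
    to (inj₁ a) = inj₁ (iso-up c (suc u) a)
    to (inj₂ (refl , refl , a)) = inj₂ (cong side chosen-item , cong rect chosen-item , iso-up c zero a)
    from : Restricted ρ l s (Maybe.map f c) (f u) → Restricted π k s c u
    from (inj₁ b) = inj₁ (iso-down c (suc u) b)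
    from (inj₂ (e , e′ , b)) = inj₂ (trans e (sym (cong side chosen-item))
      , σ-injective σ (trans e′ (sym (cong rect chosen-item))) , iso-down c zero b)

-- Only the corner rectangle has nothing to its right and nothing above it, and adjacencies express
-- this.
corner-fixed : ∀ {m} (π ρ : Path m) k l (σ : Permutation′ (suc (suc m))) →
  Iso (Adj (π ▸ k)) (Adj (ρ ▸ l)) (σ ⟨$⟩ʳ_) → σ ⟨$⟩ʳ zero ≡ zero
corner-fixed π ρ k l σ iso = corner-unique tiling
    (noRightNeighbour tiling _ λ j h → no-σ lft j (to lft _ _ h))
    (noRightNeighbour (Tiling-ᵀ tiling) _ λ j h → no-σ btm j (to btm _ _ h))
    (noRightNeighbour tiling zero λ j h → to lft _ _ h)
    (noRightNeighbour (Tiling-ᵀ tiling) zero λ j h → to btm _ _ h)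
  where
  open Realises (proj₁ (proj₂ (realise (ρ ▸ l))))
  no-σ : ∀ s j → ¬ Adj (ρ ▸ l) s (just (σ ⟨$⟩ʳ zero)) j
  no-σ s j b = proj₂ (iso s (just zero) (σ ⟨$⟩ˡ j)) (subst (Adj (ρ ▸ l) s (just (σ ⟨$⟩ʳ zero))) (sym (inverseʳ σ)) b)

mapItem-id : ∀ {n} {f : Fin n → Fin n} → (∀ i → f i ≡ i) → ∀ x → mapItem f x ≡ x
mapItem-id e (it s nothing t)  = cong (it s nothing) (e t)
mapItem-id e (it s (just i) t) = cong₂ (it s) (cong just (e i)) (e t)

-- That `σ` is the identity has to be carried through the induction: `chosen-item` identifies the
-- chosen items only up to `σ`.
rigid : ∀ {m} (π ρ : Path m) (σ : Permutation′ (suc m)) → Iso (Adj π) (Adj ρ) (σ ⟨$⟩ʳ_) →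
  π ≡ ρ × (∀ i → σ ⟨$⟩ʳ i ≡ i)
rigid start start σ iso = refl , only
  where
  only : ∀ i → σ ⟨$⟩ʳ i ≡ i
  only zero with σ ⟨$⟩ʳ zero
  ... | zero = refl
rigid (π ▸ k) (ρ ▸ l) σ iso = result (rigid π ρ σ₀ (Iso-restrict π ρ k l σ₀ iso₀))
  where
  σ₀ = remove zero σ
  σ≡ : ∀ i → σ ⟨$⟩ʳ i ≡ lift₀ σ₀ ⟨$⟩ʳ i
  σ≡ zero = corner-fixed π ρ k l σ iso
  σ≡ (suc i) = trans (punchIn-permute σ zero i)
    (cong (λ v → punchIn v (σ₀ ⟨$⟩ʳ i)) (corner-fixed π ρ k l σ iso))
  iso₀ : Iso (Adj (π ▸ k)) (Adj (ρ ▸ l)) (lift₀ σ₀ ⟨$⟩ʳ_)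
  iso₀ = Iso-cong {A = Adj (π ▸ k)} {Adj (ρ ▸ l)} σ≡ iso
  result : π ≡ ρ × (∀ i → σ₀ ⟨$⟩ʳ i ≡ i) → (π ▸ k) ≡ (ρ ▸ l) × (∀ i → σ ⟨$⟩ʳ i ≡ i)
  result (refl , e) =
      cong (π ▸_) (items-injective π k l (trans (sym (mapItem-id e _)) (chosen-item π ρ k l σ₀ iso₀)))
    , λ { zero → σ≡ zero ; (suc i) → trans (σ≡ (suc i)) (cong suc (e i)) }

-- Equivalence compares only rectangles with each other. Contacts with the left and bottom sides
-- follow, since a rectangle has such a contact exactly when it has no neighbouring rectangle in
-- that direction.
≈ᴿ⇒Iso : ∀ {n} {R S : Rectangulation n} {A B} → Realises R A → Realises S B →
  ((σ , _) : R ≈ᴿ S) → Iso A B (σ ⟨$⟩ʳ_)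
≈ᴿ⇒Iso {R = R} {S} {A} {B} ra rb (σ , e) s c u = (λ a → RB.to s _ _ (fwd s c u (RA.from s c u a)))
                                             , (λ b → RA.to s _ _ (bwd s c u (RB.from s _ _ b)))
  where
  module RA = Realises ra
  module RB = Realises rb
  f = σ ⟨$⟩ʳ_

  just⁺ : ∀ s i u → adj R s (just i) u → adj S s (just (f i)) (f u)
  just⁺ lft i u = Equivalence.to (proj₁ (e i u))
  just⁺ btm i u = Equivalence.to (proj₂ (e i u))

  just⁻ : ∀ s i u → adj S s (just (f i)) (f u) → adj R s (just i) u
  just⁻ lft i u = Equivalence.from (proj₁ (e i u))
  just⁻ btm i u = Equivalence.from (proj₂ (e i u))

  fwd : ∀ s c u → adj R s c u → adj S s (Maybe.map f c) (f u)
  fwd s (just i) u h = just⁺ s i u h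
  fwd s nothing  u h with leftNeighbour (Tiling-orient s RB.tiling) (f u)
  ... | nothing , h′ , _ = h′
  ... | just j , h′ , _ = contradiction
          (just⁻ s (σ ⟨$⟩ˡ j) u (subst (λ v → adj S s (just v) (f u)) (sym (inverseʳ σ)) h′))
          (Touches-nothing⇒¬just (Tiling-orient s RA.tiling) h)

  bwd : ∀ s c u → adj S s (Maybe.map f c) (f u) → adj R s c u
  bwd s (just i) u h = just⁻ s i u h
  bwd s nothing  u h with leftNeighbour (Tiling-orient s RA.tiling) u
  ... | nothing , h′ , _ = h′
  ... | just i , h′ , _ = contradiction (just⁺ s i u h′) (Touches-nothing⇒¬just (Tiling-orient s RB.tiling) h)

Realises⇒≈ᴿ : ∀ {n} {R : Rectangulation n} (S : Rectangulation n) {A} (σ : Permutation′ n) →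
  Realises R A → Realises (relabel σ S) A → R ≈ᴿ S
Realises⇒≈ᴿ S σ ra rb = σ , λ i j →
    mk⇔ (λ h → RB.from lft (just i) j (RA.to lft (just i) j h)) (λ h → RA.from lft (just i) j (RB.to lft (just i) j h))
  , mk⇔ (λ h → RB.from btm (just i) j (RA.to btm (just i) j h)) (λ h → RA.from btm (just i) j (RB.to btm (just i) j h))
  where
  module RA = Realises ra
  module RB = Realises rb

-- The bijection

path : ∀ {m} → NCDiagram≤1 (suc m) → Path m
path (D , ok) = proj₁ (diagram-path ok)

path-follows : ∀ {m} (D : NCDiagram≤1 (suc m)) → Follows (proj₁ D) (path D)
path-follows (D , ok) = proj₁ (proj₂ (diagram-path ok))

path-≈ : ∀ {m} (D : NCDiagram≤1 (suc m)) → proj₁ D ≈ᴰ arcs (path D)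
path-≈ (D , ok) = proj₂ (proj₂ (diagram-path ok))

bottoms : ∀ {n D} → IsNCDiagram≤1 n D → Bottoms D
bottoms ok a∈ = proj₁ (lookupAll (proj₁ ok) a∈)

path-cong : ∀ {m} (D F : NCDiagram≤1 (suc m)) → proj₁ D ≈ᴰ proj₁ F → path D ≡ path F
path-cong D F D≈F = Follows-unique {D = proj₁ D} {proj₁ F} (path D) (path F) D≈F
  (bottoms (proj₂ D)) (bottoms (proj₂ F)) (path-follows D) (path-follows F)

diagramOf : ∀ {m} → Path m → NCDiagram≤1 (suc m)
diagramOf π = arcs π , arcs-noncrossing π

path-diagramOf : ∀ {m} (π : Path m) → path (diagramOf π) ≡ π
path-diagramOf π = Follows-unique {D = arcs π} {arcs π} (path (diagramOf π)) π (≈ᴰ-refl {arcs π})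
  (bottoms (arcs-noncrossing π)) (bottoms (arcs-noncrossing π)) (path-follows (diagramOf π))
  (Traced⇒Follows (arcs π) π (λ a∈ → proj₁ (proj₂ (ArcOK.valid (arcOK π a∈)))) (Traced-arcs π))

rectangulationOf : ∀ {m} → Path m → GenericRectangulation (suc m)
rectangulationOf π = let (R , real , _) = realise π in R , Tiling⇒Generic (Realises.tiling real)

theorem1p2 : (n : ℕ) → 1 ≤ n →
    Bijection (NCDiagram≤1-Setoid n) (GenericRectangulation-Setoid n)
theorem1p2 (suc m) _ = record
  { to = λ D → rectangulationOf (path D)
  ; cong = λ {D} {F} D≈F → subst (λ π → proj₁ (rectangulationOf (path D)) ≈ᴿ proj₁ (rectangulationOf π))
      (path-cong D F D≈F) (≈ᴿ-refl {R = proj₁ (rectangulationOf (path D))})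
  ; bijective = injective , surjective }
  where
  injective : ∀ {D F : NCDiagram≤1 (suc m)} →
    proj₁ (rectangulationOf (path D)) ≈ᴿ proj₁ (rectangulationOf (path F)) → proj₁ D ≈ᴰ proj₁ F
  injective {D} {F} iso = ≈ᴰ-trans {proj₁ D} {arcs (path D)} {proj₁ F} (path-≈ D)
      (subst (λ π → arcs π ≈ᴰ proj₁ F) (sym same) (≈ᴰ-sym {proj₁ F} {arcs (path F)} (path-≈ F)))
    where
    same : path D ≡ path F
    same = proj₁ (rigid (path D) (path F) (proj₁ iso)
      (≈ᴿ⇒Iso (proj₁ (proj₂ (realise (path D)))) (proj₁ (proj₂ (realise (path F)))) iso))
  surjective : ∀ (S : GenericRectangulation (suc m)) → ∃ λ D → ∀ {F : NCDiagram≤1 (suc m)} →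
    proj₁ F ≈ᴰ proj₁ D → proj₁ (rectangulationOf (path F)) ≈ᴿ proj₁ S
  surjective (S , gen) with rectangulation-path m (Generic⇒Tiling gen)
  ... | π , σ , real = diagramOf π , λ {F} F≈ →
      subst (λ ρ → proj₁ (rectangulationOf ρ) ≈ᴿ S)
        (sym (trans (path-cong F (diagramOf π) F≈) (path-diagramOf π)))
        (Realises⇒≈ᴿ S σ (proj₁ (proj₂ (realise π))) real)
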